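{- For every integer $h \ge 3$ there are constants $\varepsilon_0,\delta_0,C>0$ such that if $H$ is a graph on $h$ vertices and $0<\varepsilon \le \varepsilon_0$, then $$\mathrm{Rem}_H(\varepsilon) \le \big[S(\varepsilon^{C},\,\delta_0,\,\varepsilon)\big]^C .$$
   Context: All graphs are finite and simple. For a graph $G$ on vertex set $V$, its density is $d_G=2|E(G)|/|V|^2$. For vertex sets $A,B$, $e_G(A,B)$ is the number of ordered pairs $(u,v)\in A\times B$ with $uv\in E(G)$ and $d_G(A,B)=e_G(A,B)/(|A||B|)$. A pair $(A,B)$ is $\varepsilon$-regular if $|d_G(A,B)-d_G(A',B')|\le \varepsilon$ for all $A'\subseteq A$, $B'\subseteq B$ with $|A'|\ge\varepsilon|A|$, $|B'|\ge\varepsilon|B|$. An equipartition is a partition of $V$ whose part sizes differ by at most $1$; its order is its number of parts. An equipartition $\{Z_1,\dots,Z_k\}$ is $\varepsilon$-regular if all but at most $\varepsilon k^2$ pairs $(Z_i,Z_j)$ are $\varepsilon$-regular. For $\varepsilon,\delta,p>0$, $S(\varepsilon,\delta,p)$ is the smallest integer $S$ such that: whenever $G$ is a graph of density at least $p$ and $\mathcal P_0$ is an equipartition of $V(G)$ of order at most $1/\varepsilon$, one can add/remove at most $\delta|E(G)|$ edges of $G$ so that the resulting graph has an $\varepsilon$-regular equipartition refining $\mathcal P_0$ of order at most $S$. For a fixed graph $H$ on $h$ vertices, $\mathrm{Rem}_H(\varepsilon)$ is the smallest number such that every $n$-vertex graph from which one must remove at least $\varepsilon n^2$ edges to make it $H$-free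 contains at least $n^h/\mathrm{Rem}_H(\varepsilon)$ copies of $H$.
   Formalization: The parameter ε, which the English statement lets range over all real numbers with 0 < ε ≤ ε₀, ranges here over rational numbers only. -}

module Defs where

open import Data.Bool using (Bool; true; false; _∧_; if_then_else_)
open import Data.Nat as ℕ using (ℕ; zero; suc)
open import Data.Integer using (+_)
open import Data.Fin using (Fin; zero; suc; _≟_)
open import Data.Fin.Subset using (Subset; _∈_; _⊆_; ∣_∣)
open import Data.Vec using (Vec; []; _∷_; lookup)
open import Data.List using (List; []; _∷_; map; concatMap; length; filterᵇ)
import Data.List
import Data.Vec
open import Data.Product using (Σ; _×_; ∃; _,_)
open import Relation.Nullary using (¬_)
open import Relation.Nullary.Decidable using (⌊_⌋)
open import Relation.Binary.PropositionalEquality using (_≡_; _≢_)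
open import Data.Rational as ℚ using (ℚ; 0ℚ; 1ℚ; _/_; _*_; _-_) renaming (∣_∣ to absℚ)

⟦_⟧ : ℕ → ℚ
⟦ n ⟧ = + n / 1

_^ℚ_ : ℚ → ℕ → ℚ
q ^ℚ zero  = 1ℚ
q ^ℚ suc k = q * (q ^ℚ k)

ratio : ℕ → ℕ → ℚ
ratio a zero    = 0ℚ
ratio a (suc b) = + a / suc b

count : ∀ k → (Fin k → Bool) → ℕ
count zero    P = 0
count (suc k) P = (if P zero then 1 else 0) ℕ.+ count k (λ i → P (suc i))

allᵇ : ∀ k → (Fin k → Bool) → Bool
allᵇ zero    P = true
allᵇ (suc k) P = P zero ∧ allᵇ k (λ i → P (suc i))

record Graph (n : ℕ) : Set where
  field
    adj   : Fin n → Fin n → Bool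
    sym   : ∀ u v → adj u v ≡ adj v u
    irrefl : ∀ u → adj u u ≡ false
open Graph public

sumFin : ∀ k → (Fin k → ℕ) → ℕ
sumFin zero    f = 0
sumFin (suc k) f = f zero ℕ.+ sumFin k (λ i → f (suc i))

eG : ∀ {n} → Graph n → Subset n → Subset n → ℕ
eG {n} G A B = sumFin n (λ u → count n (λ v → mem u A ∧ (mem v B ∧ adj G u v)))
  where
  mem : Fin n → Subset n → Bool
  mem u X = lookup X u

fullSet : ∀ n → Subset n
fullSet n = Data.Vec.replicate n true

numEdges : ∀ {n} → Graph n → ℚ
numEdges {n} G = + eG G (fullSet n) (fullSet n) / 2

density : ∀ {n} → Graph n → ℚ
density {n} G = ratio (eG G (fullSet n) (fullSet n)) (n ℕ.* n)

-- d_G(A,B) = e_G(A,B)/(|A||B|)   (convention: 0 if A or B is empty)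
dG : ∀ {n} → Graph n → Subset n → Subset n → ℚ
dG G A B = ratio (eG G A B) (∣ A ∣ ℕ.* ∣ B ∣)

RegularPair : ∀ {n} → ℚ → Graph n → Subset n → Subset n → Set
RegularPair ε G A B =
  ∀ (A' B' : Subset _) → A' ⊆ A → B' ⊆ B →
  ε * ⟦ ∣ A ∣ ⟧ ℚ.≤ ⟦ ∣ A' ∣ ⟧ → ε * ⟦ ∣ B ∣ ⟧ ℚ.≤ ⟦ ∣ B' ∣ ⟧ →
  absℚ (dG G A B - dG G A' B') ℚ.≤ ε

record Partition (n k : ℕ) : Set where
  field
    part     : Fin n → Fin k
    nonempty : ∀ (i : Fin k) → ∃ λ v → part v ≡ i
open Partition public

Part : ∀ {n k} → Partition n k → Fin k → Subset n
Part P i = Data.Vec.tabulate (λ v → ⌊ part P v ≟ i ⌋)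

IsEquipartition : ∀ {n k} → Partition n k → Set
IsEquipartition P = ∀ i j → ∣ Part P i ∣ ℕ.≤ ∣ Part P j ∣ ℕ.+ 1

Refines : ∀ {n k l} → Partition n l → Partition n k → Set
Refines Q P = ∀ u v → part Q u ≡ part Q v → part P u ≡ part P v

IsRegularPartition : ∀ {n k} → ℚ → Graph n → Partition n k → Set
IsRegularPartition {n} {k} ε G P =
  IsEquipartition P ×
  Σ (Fin k → Fin k → Bool) λ bad →
    (⟦ sumFin k (λ i → count k (bad i)) ⟧ ℚ.≤ ε * ⟦ k ℕ.* k ⟧) ×
    (∀ i j → i ≢ j → bad i j ≡ false → RegularPair ε G (Part P i) (Part P j))

diffᵇ : Bool → Bool → Bool
diffᵇ true  false = true
diffᵇ false true  = true
diffᵇ _     _     = false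

editDist : ∀ {n} → Graph n → Graph n → ℚ
editDist {n} G G' =
  + sumFin n (λ u → count n (λ v → diffᵇ (adj G u v) (adj G' u v))) / 2

-- The property defining S(ε,δ,p):  "S satisfies SProp ε δ p S".
-- S(ε,δ,p) is the least natural number S with SProp ε δ p S.

SProp : ℚ → ℚ → ℚ → ℕ → Set
SProp ε δ p S =
  ∀ n (G : Graph n) → p ℚ.≤ density G →
  ∀ k (P₀ : Partition n k) → IsEquipartition P₀ → ⟦ k ⟧ * ε ℚ.≤ 1ℚ →
  Σ (Graph n) λ G' → editDist G G' ℚ.≤ δ * numEdges G ×
  Σ ℕ λ l → l ℕ.≤ S × Σ (Partition n l) λ Q →
    Refines Q P₀ × IsRegularPartition ε G' Q

allVecs : ∀ h n → List (Vec (Fin n) h)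
allVecs zero    n = [] ∷ []
allVecs (suc h) n =
  concatMap (λ xs → map (λ x → x ∷ xs) (Data.List.allFin n)) (allVecs h n)

isCopyᵇ : ∀ {h n} → Graph h → Graph n → Vec (Fin n) h → Bool
isCopyᵇ {h} H G f =
  allᵇ h λ i → allᵇ h λ j →
    (⌊ i ≟ j ⌋ ∨ not ⌊ lookup f i ≟ lookup f j ⌋) ∧
    (not (adj H i j) ∨ adj G (lookup f i) (lookup f j))
  where open Data.Bool using (_∨_; not)

IsCopy : ∀ {h n} → Graph h → Graph n → (Fin h → Fin n) → Set
IsCopy H G f =
  (∀ i j → f i ≡ f j → i ≡ j) × (∀ i j → adj H i j ≡ true → adj G (f i) (f j) ≡ true)

copies : ∀ {h n} → Graph h → Graph n → ℕ
copies H G = length (filterᵇ (isCopyᵇ H G) (allVecs _ _))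

HFree : ∀ {h n} → Graph h → Graph n → Set
HFree H G = ¬ (Σ (Fin _ → Fin _) λ f → IsCopy H G f)

SubgraphOf : ∀ {n} → Graph n → Graph n → Set
SubgraphOf G' G = ∀ u v → adj G' u v ≡ true → adj G u v ≡ true

FarFromHFree : ∀ {h n} → ℚ → Graph h → Graph n → Set
FarFromHFree {n = n} ε H G =
  ∀ (G' : Graph n) → SubgraphOf G' G → HFree H G' →
  ε * ⟦ n ℕ.* n ⟧ ℚ.≤ editDist G G'

-- The property defining Rem_H(ε): every ε-far n-vertex graph contains
-- at least n^h / R copies of H.  Rem_H(ε) is the least such R.
RemProp : ∀ {h} → Graph h → ℚ → ℕ → Set
RemProp {h} H ε R =
  ∀ n (G : Graph n) → FarFromHFree ε H G → n ℕ.^ h ℕ.≤ R ℕ.* copies H G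

{-# OPTIONS --safe #-}
module Submission where

-- Let G be ε-far from H-free and put q = h². Removing copies of H greedily yields a
-- subgraph G₁ of G, an edge-disjoint union of copies of H, with e(G₁) ≥ ε n². Since
-- δ₀ = 1/12q², the approximation G' of G₁ given by the hypothesis misses only a
-- small fraction of e(G₁), although it may differ from G₁ in many more than ε n² edges when
-- ε n² is much smaller than e(G₁). Discard from G₁ the pairs that are not in G', lie inside
-- a part, or lie between parts that are irregular, too sparse in G', or of whose G'-edges a
-- fraction larger than 1/2q has been added. Fewer than e(G₁)/q edges are lost, so one of the
-- edge-disjoint copies survives. Between its parts, the counting lemma for G' gives about the
-- expected number of copies of H, and at most half of them use an added edge: replacing one
-- factor G' by the added edges costs a factor 1/2q, and there are at most q factors. The
-- other copies lie in G. Finally S ≥ m² for m = ⌊1/ε⌋, so all losses are powers of S.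

open import Defs hiding (sym)
open import Data.Bool using (Bool; true; false; _∧_; _∨_; not; if_then_else_) renaming (_≟_ to _≟ᵇ_)
open import Data.Bool.Properties using (∧-identityʳ; ∧-comm)
open import Data.Empty using (⊥-elim)
open import Data.Fin as Fin using (Fin; zero; suc; _≟_)
import Data.Fin.Properties as Fin
open import Data.Fin.Subset using (∣_∣; _⊆_)
import Data.Integer as ℤ
import Data.Integer.Properties as ℤ
open import Data.List as List using (List; []; _∷_; map; concatMap; length; filterᵇ; _++_; filter; cartesianProduct; allFin)
open import Data.List.Membership.Propositional using (_∈_)
open import Data.List.Membership.Propositional.Properties
  using (∈-filter⁻; ∈-filter⁺; ∈-concatMap⁺; ∈-map⁺; ∈-allFin; ∈-cartesianProduct⁺)
open import Data.List.Properties
  using (filter-all; filter-accept; filter-reject; length-filter; length-map; length-tabulate; length-++)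
open import Data.List.Relation.Unary.All as All using (All; []; _∷_)
import Data.List.Relation.Unary.All.Properties as All
open import Data.List.Relation.Unary.AllPairs using ([]; _∷_)
open import Data.List.Relation.Unary.Any as Any using (here; there)
open import Data.List.Relation.Unary.Unique.Propositional using (Unique)
import Data.List.Relation.Unary.Unique.Propositional.Properties as Unique
open import Data.Nat hiding (_/_; _≟_; ∣_-_∣)
import Data.Nat.DivMod as ℕ
open import Data.Nat.Properties hiding (_≟_)
open import Data.Nat.Tactic.RingSolver using (solve-∀)
open import Data.Product using (Σ; _×_; ∃; _,_; proj₁; proj₂)
open import Data.Product.Properties using (≡-dec)
open import Data.Rational as ℚ using (ℚ; 0ℚ; 1ℚ; mkℚ; toℚᵘ; NonNegative; Positive)
import Data.Rational.Properties as ℚ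
open import Data.Rational.Solver using (module +-*-Solver)
open import Data.Rational.Unnormalised as ℚᵘ using (mkℚᵘ; _≃_; *≡*; *≤*)
import Data.Rational.Unnormalised.Properties as ℚᵘ
open import Data.Sum using (_⊎_; inj₁; inj₂; [_,_]′)
open import Data.Vec using (Vec; []; _∷_; lookup; _[_]≔_; tabulate)
open import Data.Vec.Properties
  using (lookup∘updateAt; lookup∘updateAt′; lookup∘tabulate; lookup-replicate; lookup⇒[]=; []=⇒lookup)
open import Function using (_∘_)
open import Relation.Binary.Definitions using (tri<; tri≈; tri>)
open import Relation.Binary.PropositionalEquality hiding ([_])
open import Relation.Nullary using (¬_; yes; no; Dec)
open import Relation.Nullary.Decidable using (⌊_⌋; ¬?; _×-dec_)

-- Applying the hypothesis to `G` itself would fail: its `δ₀ e(G)` edits may outnumber `ε n²` and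
-- destroy every copy that farness provides. In an edge-disjoint union each copy owns a fixed share
-- of the edges, so a loss proportional to the number of edges is affordable with a `δ₀` that does
-- not depend on `ε`. The approximation is regular but need not be a subgraph, while its
-- intersection with `G₁` is a subgraph but need not be regular; hence the detour through counting
-- and subtracting. About the added edges nothing is known except how many there are between two
-- parts. This suffices because two distinct edges of `H` share at most one vertex: while one edge
-- of `H` is exchanged for its density, every other factor, regular or not, is the indicator of a
-- rectangle in the two free variables. The regularity parameter, at most `1/m^C`, has to beat a
-- product of up to `q` densities that may each be as small as `1/(6qm)`; a large enough power of
-- `ε` does.

𝟙 : Bool → ℕ
𝟙 b = if b then 1 else 0

true≢false : true ≢ false
true≢false ()

not-true : ∀ {b} → not b ≡ true → b ≡ false
not-true {false} _ = refl

not-false : ∀ {b} → not b ≡ false → b ≡ true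
not-false {true} _ = refl

*-swap : ∀ a b c → a * (b * c) ≡ b * (a * c)
*-swap = solve-∀

𝟙≤1 : ∀ b → 𝟙 b ≤ 1
𝟙≤1 true  = ≤-refl
𝟙≤1 false = z≤n

𝟙-∧ : ∀ a b → 𝟙 (a ∧ b) ≡ 𝟙 a * 𝟙 b
𝟙-∧ true  b = sym (+-identityʳ (𝟙 b))
𝟙-∧ false b = refl

⌊≟⌋-refl : ∀ {k} (i : Fin k) → ⌊ i ≟ i ⌋ ≡ true
⌊≟⌋-refl i with i ≟ i
... | yes _ = refl
... | no  p = ⊥-elim (p refl)

⌊≟⌋-suc : ∀ {k} (i j : Fin k) → ⌊ suc i ≟ suc j ⌋ ≡ ⌊ i ≟ j ⌋
⌊≟⌋-suc i j with i ≟ j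
... | yes _ = refl
... | no  _ = refl

-- Finite sums

∑-cong : ∀ k {f g : Fin k → ℕ} → (∀ i → f i ≡ g i) → sumFin k f ≡ sumFin k g
∑-cong zero    e = refl
∑-cong (suc k) e = cong₂ _+_ (e zero) (∑-cong k (λ i → e (suc i)))

∑-mono : ∀ k {f g : Fin k → ℕ} → (∀ i → f i ≤ g i) → sumFin k f ≤ sumFin k g
∑-mono zero    e = z≤n
∑-mono (suc k) e = +-mono-≤ (e zero) (∑-mono k (λ i → e (suc i)))

∑-+ : ∀ k (f g : Fin k → ℕ) → sumFin k (λ i → f i + g i) ≡ sumFin k f + sumFin k g
∑-+ zero    f g = refl
∑-+ (suc k) f g = trans (cong (f zero + g zero +_) (∑-+ k _ _)) (shuffle (f zero) (g zero) _ _)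
  where
  shuffle : ∀ a b c d → (a + b) + (c + d) ≡ (a + c) + (b + d)
  shuffle = solve-∀

∑-*ˡ : ∀ k c (f : Fin k → ℕ) → sumFin k (λ i → c * f i) ≡ c * sumFin k f
∑-*ˡ zero    c f = sym (*-zeroʳ c)
∑-*ˡ (suc k) c f = trans (cong (c * f zero +_) (∑-*ˡ k c _)) (sym (*-distribˡ-+ c _ _))

∑-*ʳ : ∀ k (f : Fin k → ℕ) c → sumFin k (λ i → f i * c) ≡ sumFin k f * c
∑-*ʳ k f c = trans (∑-cong k (λ i → *-comm (f i) c)) (trans (∑-*ˡ k c f) (*-comm c _))

∑-const : ∀ k c → sumFin k (λ _ → c) ≡ k * c
∑-const zero    c = refl
∑-const (suc k) c = cong (c +_) (∑-const k c)

∑-swap : ∀ k l (f : Fin k → Fin l → ℕ) →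
  sumFin k (λ i → sumFin l (f i)) ≡ sumFin l (λ j → sumFin k (λ i → f i j))
∑-swap zero    l f = sym (trans (∑-const l 0) (*-zeroʳ l))
∑-swap (suc k) l f = trans (cong (sumFin l (f zero) +_) (∑-swap k l _)) (sym (∑-+ l _ _))

∑-bound : ∀ k c {f : Fin k → ℕ} → (∀ i → f i ≤ c) → sumFin k f ≤ k * c
∑-bound k c p = ≤-trans (∑-mono k p) (≤-reflexive (∑-const k c))

∑-term : ∀ k (f : Fin k → ℕ) i → f i ≤ sumFin k f
∑-term (suc k) f zero    = m≤m+n _ _
∑-term (suc k) f (suc i) = ≤-trans (∑-term k (λ i → f (suc i)) i) (m≤n+m _ _)

∑-zero : ∀ k → sumFin k (λ _ → 0) ≡ 0
∑-zero k = trans (∑-const k 0) (*-zeroʳ k)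

∑-δ : ∀ k (a : Fin k) (f : Fin k → ℕ) → sumFin k (λ i → 𝟙 ⌊ a ≟ i ⌋ * f i) ≡ f a
∑-δ (suc k) zero    f =
  trans (cong₂ _+_ (+-identityʳ (f zero)) (∑-zero k)) (+-identityʳ (f zero))
∑-δ (suc k) (suc a) f =
  trans (∑-cong k (λ i → cong (λ b → 𝟙 b * f (suc i)) (⌊≟⌋-suc a i))) (∑-δ k a (λ i → f (suc i)))

∑-δ1 : ∀ k (a : Fin k) → sumFin k (λ i → 𝟙 ⌊ a ≟ i ⌋) ≡ 1
∑-δ1 k a = trans (∑-cong k (λ i → sym (*-identityʳ _))) (∑-δ k a (λ _ → 1))

⌊≟⌋-sym : ∀ {k} (i j : Fin k) → ⌊ i ≟ j ⌋ ≡ ⌊ j ≟ i ⌋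
⌊≟⌋-sym i j with i ≟ j | j ≟ i
... | yes _ | yes _ = refl
... | no  _ | no  _ = refl
... | yes p | no  q = ⊥-elim (q (sym p))
... | no  p | yes q = ⊥-elim (p (sym q))

count≡∑ : ∀ k (P : Fin k → Bool) → count k P ≡ sumFin k (λ i → 𝟙 (P i))
count≡∑ zero    P = refl
count≡∑ (suc k) P = cong (𝟙 (P zero) +_) (count≡∑ k _)

∑₂ : ∀ k l → (Fin k → Fin l → ℕ) → ℕ
∑₂ k l f = sumFin k (λ i → sumFin l (f i))

∑₂-cong : ∀ k l {f g : Fin k → Fin l → ℕ} → (∀ i j → f i j ≡ g i j) → ∑₂ k l f ≡ ∑₂ k l g
∑₂-cong k l e = ∑-cong k (λ i → ∑-cong l (e i))

∑₂-mono : ∀ k l {f g : Fin k → Fin l → ℕ} → (∀ i j → f i j ≤ g i j) → ∑₂ k l f ≤ ∑₂ k l g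
∑₂-mono k l e = ∑-mono k (λ i → ∑-mono l (e i))

∑₂-+ : ∀ k l (f g : Fin k → Fin l → ℕ) → ∑₂ k l (λ i j → f i j + g i j) ≡ ∑₂ k l f + ∑₂ k l g
∑₂-+ k l f g = trans (∑-cong k (λ i → ∑-+ l _ _)) (∑-+ k _ _)

∑₂-*ˡ : ∀ k l c (f : Fin k → Fin l → ℕ) → ∑₂ k l (λ i j → c * f i j) ≡ c * ∑₂ k l f
∑₂-*ˡ k l c f = trans (∑-cong k (λ i → ∑-*ˡ l c _)) (∑-*ˡ k c _)

∑₂-const : ∀ k l c → ∑₂ k l (λ _ _ → c) ≡ k * (l * c)
∑₂-const k l c = trans (∑-cong k (λ _ → ∑-const l c)) (∑-const k _)

∑₂-prod : ∀ k l (f : Fin k → ℕ) (g : Fin l → ℕ) →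
  ∑₂ k l (λ i j → f i * g j) ≡ sumFin k f * sumFin l g
∑₂-prod k l f g = trans (∑-cong k (λ i → ∑-*ˡ l (f i) g)) (∑-*ʳ k f _)

∑₂-term : ∀ k l (f : Fin k → Fin l → ℕ) i j → f i j ≤ ∑₂ k l f
∑₂-term k l f i j = ≤-trans (∑-term l (f i) j) (∑-term k (λ i → sumFin l (f i)) i)

∑-zero⇒ : ∀ k (f : Fin k → ℕ) → 1 ≤ sumFin k f → ∃ λ i → 1 ≤ f i
∑-zero⇒ (suc k) f p with f zero in eq
... | suc m = zero , subst (1 ≤_) (sym eq) (s≤s z≤n)
... | zero  with ∑-zero⇒ k (λ i → f (suc i)) p
...   | i , q = suc i , q

-- Sorting pairs (u,v) by the pair (π u, π v).
∑₂-fibre : ∀ {n l} (π : Fin n → Fin l) (β : Fin l → Fin l → ℕ) (F : Fin n → Fin n → ℕ) →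
  ∑₂ n n (λ u v → β (π u) (π v) * F u v) ≡
  ∑₂ l l (λ i j → β i j * ∑₂ n n (λ u v → 𝟙 ⌊ π u ≟ i ⌋ * 𝟙 ⌊ π v ≟ j ⌋ * F u v))
∑₂-fibre {n} {l} π β F = begin
  ∑₂ n n (λ u v → β (π u) (π v) * F u v)
    ≡⟨ ∑₂-cong n n (λ u v → sym (pt u v)) ⟩
  ∑₂ n n (λ u v → ∑₂ l l (λ i j → T i j u v))
    ≡⟨ ∑-cong n (λ u → trans (∑-swap n l _) (∑-cong l (λ i → ∑-swap n l _))) ⟩
  sumFin n (λ u → ∑₂ l l (λ i j → sumFin n (T i j u)))
    ≡⟨ trans (∑-swap n l _) (∑-cong l (λ i → ∑-swap n l _)) ⟩
  ∑₂ l l (λ i j → ∑₂ n n (T i j))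
    ≡⟨ ∑₂-cong l l (λ i j → trans (∑₂-cong n n (λ u v → re (𝟙 ⌊ π u ≟ i ⌋) (𝟙 ⌊ π v ≟ j ⌋) (β i j) (F u v))) (∑₂-*ˡ n n (β i j) _)) ⟩
  _ ∎
  where
  open ≡-Reasoning
  T : Fin l → Fin l → Fin n → Fin n → ℕ
  T i j u v = 𝟙 ⌊ π u ≟ i ⌋ * (𝟙 ⌊ π v ≟ j ⌋ * (β i j * F u v))
  re : ∀ a b c d → a * (b * (c * d)) ≡ c * (a * b * d)
  re = solve-∀
  pt : ∀ u v → ∑₂ l l (λ i j → T i j u v) ≡ β (π u) (π v) * F u v
  pt u v = begin
    ∑₂ l l (λ i j → T i j u v)
      ≡⟨ ∑-cong l (λ i → trans (∑-*ˡ l (𝟙 ⌊ π u ≟ i ⌋) _) (cong (𝟙 ⌊ π u ≟ i ⌋ *_) (∑-δ l (π v) (λ j → β i j * F u v)))) ⟩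
    sumFin l (λ i → 𝟙 ⌊ π u ≟ i ⌋ * (β i (π v) * F u v))
      ≡⟨ ∑-δ l (π u) _ ⟩
    _ ∎

-- From rationals to natural numbers

-- toℚᵘ only computes up to ≃, so arithmetic on ⟦_⟧ goes through unnormalised fractions.
toℚᵘ-⟦⟧ : ∀ n → toℚᵘ ⟦ n ⟧ ≃ mkℚᵘ (ℤ.+ n) 0
toℚᵘ-⟦⟧ n = ℚ.toℚᵘ-fromℚᵘ (mkℚᵘ (ℤ.+ n) 0)

⟦⟧-* : ∀ a b → ⟦ a * b ⟧ ≡ ⟦ a ⟧ ℚ.* ⟦ b ⟧
⟦⟧-* a b = ℚ.toℚᵘ-injective (begin
  toℚᵘ ⟦ a * b ⟧                    ≈⟨ toℚᵘ-⟦⟧ (a * b) ⟩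
  mkℚᵘ (ℤ.+ (a * b)) 0                ≈⟨ *≡* (cong (ℤ._* ℤ.+ 1) (ℤ.pos-* a b)) ⟩
  mkℚᵘ (ℤ.+ a) 0 ℚᵘ.* mkℚᵘ (ℤ.+ b) 0      ≈⟨ ℚᵘ.*-cong (ℚᵘ.≃-sym (toℚᵘ-⟦⟧ a)) (ℚᵘ.≃-sym (toℚᵘ-⟦⟧ b)) ⟩
  toℚᵘ ⟦ a ⟧ ℚᵘ.* toℚᵘ ⟦ b ⟧          ≈⟨ ℚᵘ.≃-sym (ℚ.toℚᵘ-homo-* ⟦ a ⟧ ⟦ b ⟧) ⟩
  toℚᵘ (⟦ a ⟧ ℚ.* ⟦ b ⟧)                ∎)
  where open import Relation.Binary.Reasoning.Setoid ℚᵘ.≃-setoid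

⟦⟧-+ : ∀ a b → ⟦ a + b ⟧ ≡ ⟦ a ⟧ ℚ.+ ⟦ b ⟧
⟦⟧-+ a b = ℚ.toℚᵘ-injective (begin
  toℚᵘ ⟦ a + b ⟧                    ≈⟨ toℚᵘ-⟦⟧ (a + b) ⟩
  mkℚᵘ (ℤ.+ (a + b)) 0                ≈⟨ *≡* (cong (ℤ._* ℤ.+ 1) (cong₂ ℤ._+_ (sym (ℤ.*-identityʳ (ℤ.+ a))) (sym (ℤ.*-identityʳ (ℤ.+ b))))) ⟩
  mkℚᵘ (ℤ.+ a) 0 ℚᵘ.+ mkℚᵘ (ℤ.+ b) 0      ≈⟨ ℚᵘ.+-cong (ℚᵘ.≃-sym (toℚᵘ-⟦⟧ a)) (ℚᵘ.≃-sym (toℚᵘ-⟦⟧ b)) ⟩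
  toℚᵘ ⟦ a ⟧ ℚᵘ.+ toℚᵘ ⟦ b ⟧          ≈⟨ ℚᵘ.≃-sym (ℚ.toℚᵘ-homo-+ ⟦ a ⟧ ⟦ b ⟧) ⟩
  toℚᵘ (⟦ a ⟧ ℚ.+ ⟦ b ⟧)              ∎)
  where open import Relation.Binary.Reasoning.Setoid ℚᵘ.≃-setoid

⟦⟧-mono : ∀ {a b} → a ≤ b → ⟦ a ⟧ ℚ.≤ ⟦ b ⟧
⟦⟧-mono {a} {b} a≤b = ℚ.toℚᵘ-cancel-≤ (ℚᵘ.≤-respˡ-≃ (ℚᵘ.≃-sym (toℚᵘ-⟦⟧ a))
  (ℚᵘ.≤-respʳ-≃ (ℚᵘ.≃-sym (toℚᵘ-⟦⟧ b)) (*≤* (ℤ.*-monoʳ-≤-nonNeg (ℤ.+ 1) (ℤ.+≤+ a≤b)))))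

⟦⟧-cancel : ∀ {a b} → ⟦ a ⟧ ℚ.≤ ⟦ b ⟧ → a ≤ b
⟦⟧-cancel {a} {b} p with ℚᵘ.≤-respˡ-≃ (toℚᵘ-⟦⟧ a) (ℚᵘ.≤-respʳ-≃ (toℚᵘ-⟦⟧ b) (ℚ.toℚᵘ-mono-≤ p))
... | *≤* q = ℤ.drop‿+≤+ (subst₂ ℤ._≤_ (ℤ.*-identityʳ (ℤ.+ a)) (ℤ.*-identityʳ (ℤ.+ b)) q)

ratio-* : ∀ a b .{{_ : NonZero b}} → ratio a b ℚ.* ⟦ b ⟧ ≡ ⟦ a ⟧
ratio-* a (suc b) = ℚ.toℚᵘ-injective (begin
  toℚᵘ (ratio a (suc b) ℚ.* ⟦ suc b ⟧)          ≈⟨ ℚ.toℚᵘ-homo-* (ratio a (suc b)) ⟦ suc b ⟧ ⟩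
  toℚᵘ (ratio a (suc b)) ℚᵘ.* toℚᵘ ⟦ suc b ⟧  ≈⟨ ℚᵘ.*-cong (ℚ.toℚᵘ-fromℚᵘ (mkℚᵘ (ℤ.+ a) b)) (toℚᵘ-⟦⟧ (suc b)) ⟩
  mkℚᵘ (ℤ.+ a) b ℚᵘ.* mkℚᵘ (ℤ.+ suc b) 0          ≈⟨ *≡* (trans (ℤ.*-identityʳ _) (cong (ℤ.+ a ℤ.*_) (cong ℤ.+_ (sym (*-identityʳ (suc b)))))) ⟩
  mkℚᵘ (ℤ.+ a) 0                                ≈⟨ ℚᵘ.≃-sym (toℚᵘ-⟦⟧ a) ⟩
  toℚᵘ ⟦ a ⟧                                  ∎)
  where open import Relation.Binary.Reasoning.Setoid ℚᵘ.≃-setoid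

⟦⟧-nonNeg : ∀ n → NonNegative ⟦ n ⟧
⟦⟧-nonNeg n = ℚ.nonNegative (⟦⟧-mono {0} {n} z≤n)

⟦⟧-pos : ∀ n .{{_ : NonZero n}} → Positive ⟦ n ⟧
⟦⟧-pos n = ℚ.positive (ℚ.≰⇒> (λ n≤0 → ≢-nonZero⁻¹ n (n≤0⇒n≡0 (⟦⟧-cancel {n} {0} n≤0))))

*-mono-⟦⟧ : ∀ n {p q} → p ℚ.≤ q → ⟦ n ⟧ ℚ.* p ℚ.≤ ⟦ n ⟧ ℚ.* q
*-mono-⟦⟧ n = ℚ.*-monoˡ-≤-nonNeg ⟦ n ⟧ {{⟦⟧-nonNeg n}}

*-cancel-⟦⟧ : ∀ n .{{_ : NonZero n}} {p q} → ⟦ n ⟧ ℚ.* p ℚ.≤ ⟦ n ⟧ ℚ.* q → p ℚ.≤ q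
*-cancel-⟦⟧ n = ℚ.*-cancelˡ-≤-pos ⟦ n ⟧ {{⟦⟧-pos n}}

p≤absp : ∀ p → p ℚ.≤ ℚ.∣ p ∣
p≤absp p with ℚ.≤-total 0ℚ p
... | inj₁ 0≤p = ℚ.≤-reflexive (sym (ℚ.0≤p⇒∣p∣≡p 0≤p))
... | inj₂ p≤0 = ℚ.≤-trans p≤0 (ℚ.0≤∣p∣ p)

^ℚ-nonNeg : ∀ {ε} → 0ℚ ℚ.≤ ε → ∀ C → 0ℚ ℚ.≤ ε ^ℚ C
^ℚ-nonNeg 0≤ε zero    = ⟦⟧-mono {0} {1} z≤n
^ℚ-nonNeg {ε} 0≤ε (suc C) = ℚ.nonNegative⁻¹ (ε ℚ.* (ε ^ℚ C))
  {{ℚ.nonNeg*nonNeg⇒nonNeg ε {{ℚ.nonNegative 0≤ε}} (ε ^ℚ C) {{ℚ.nonNegative (^ℚ-nonNeg 0≤ε C)}}}}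

ℚ-*-interchange : ∀ a b c d → (a ℚ.* b) ℚ.* (c ℚ.* d) ≡ (a ℚ.* c) ℚ.* (b ℚ.* d)
ℚ-*-interchange = solve 4 (λ a b c d → (a :* b) :* (c :* d) := (a :* c) :* (b :* d)) refl
  where open +-*-Solver using (solve; _:*_; _:+_; _:-_; :-_; _:=_)

power-bound : ∀ {m ε} → 0ℚ ℚ.≤ ε → ⟦ m ⟧ ℚ.* ε ℚ.≤ 1ℚ → ∀ C → ⟦ m ^ C ⟧ ℚ.* (ε ^ℚ C) ℚ.≤ 1ℚ
power-bound         0≤ε p zero    = ℚ.≤-refl
power-bound {m} {ε} 0≤ε p (suc C) = begin
  ⟦ m * m ^ C ⟧ ℚ.* (ε ℚ.* ε ^ℚ C)       ≡⟨ cong (ℚ._* (ε ℚ.* ε ^ℚ C)) (⟦⟧-* m (m ^ C)) ⟩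
  ⟦ m ⟧ ℚ.* ⟦ m ^ C ⟧ ℚ.* (ε ℚ.* ε ^ℚ C)     ≡⟨ ℚ-*-interchange ⟦ m ⟧ ⟦ m ^ C ⟧ ε (ε ^ℚ C) ⟩
  (⟦ m ⟧ ℚ.* ε) ℚ.* (⟦ m ^ C ⟧ ℚ.* ε ^ℚ C)   ≤⟨ ℚ.*-monoʳ-≤-nonNeg (⟦ m ^ C ⟧ ℚ.* ε ^ℚ C) {{nn}} p ⟩
  1ℚ ℚ.* (⟦ m ^ C ⟧ ℚ.* ε ^ℚ C)            ≡⟨ ℚ.*-identityˡ _ ⟩
  ⟦ m ^ C ⟧ ℚ.* ε ^ℚ C                   ≤⟨ power-bound 0≤ε p C ⟩
  1ℚ                                      ∎
  where
  open ℚ.≤-Reasoning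
  nn : NonNegative (⟦ m ^ C ⟧ ℚ.* ε ^ℚ C)
  nn = ℚ.nonNeg*nonNeg⇒nonNeg ⟦ m ^ C ⟧ {{⟦⟧-nonNeg (m ^ C)}} (ε ^ℚ C) {{ℚ.nonNegative (^ℚ-nonNeg 0≤ε C)}}

-- m = ⌊1/ε⌋; it replaces 1/ε from here on, so that all later estimates are over ℕ.
floor-inverse : ∀ N .{{_ : NonZero N}} ε → 0ℚ ℚ.< ε → ε ℚ.≤ ratio 1 N →
  ∃ λ m → N ≤ m × ⟦ m ⟧ ℚ.* ε ℚ.≤ 1ℚ × 1ℚ ℚ.≤ ⟦ 2 * m ⟧ ℚ.* ε
floor-inverse N ε 0<ε ε≤ with ε in eq | ℚ.positive 0<ε
... | mkℚ (ℤ.+ suc p) d cop | _ = m , N≤m , below , above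
  where
  P = suc p
  Q = suc d
  m = Q ℕ./ P
  εQ : ⟦ Q ⟧ ℚ.* ε ≡ ⟦ P ⟧
  εQ = trans (ℚ.*-comm ⟦ Q ⟧ ε) (trans (cong (ℚ._* ⟦ Q ⟧) (trans eq (sym (ℚ.↥p/↧p≡p (mkℚ (ℤ.+ suc p) d cop))))) (ratio-* P Q))
  scale : ∀ k → ⟦ Q ⟧ ℚ.* (⟦ k ⟧ ℚ.* ε) ≡ ⟦ k * P ⟧
  scale k = trans (swap ⟦ Q ⟧ ⟦ k ⟧ ε) (trans (cong (⟦ k ⟧ ℚ.*_) εQ) (sym (⟦⟧-* k P)))
    where
    open +-*-Solver using (solve; _:*_; _:+_; _:-_; :-_; _:=_)
    swap : ∀ a b c → a ℚ.* (b ℚ.* c) ≡ b ℚ.* (a ℚ.* c)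
    swap = solve 3 (λ a b c → a :* (b :* c) := b :* (a :* c)) refl
  Q·1 : ⟦ Q ⟧ ℚ.* 1ℚ ≡ ⟦ Q ⟧
  Q·1 = ℚ.*-identityʳ ⟦ Q ⟧
  Nε≤1 : ⟦ N ⟧ ℚ.* ε ℚ.≤ 1ℚ
  Nε≤1 = ℚ.≤-trans (*-mono-⟦⟧ N (subst (ℚ._≤ ratio 1 N) (sym eq) ε≤)) (ℚ.≤-reflexive (trans (ℚ.*-comm ⟦ N ⟧ _) (ratio-* 1 N)))
  NP≤Q : N * P ≤ Q
  NP≤Q = ⟦⟧-cancel (subst₂ ℚ._≤_ (scale N) Q·1 (*-mono-⟦⟧ Q Nε≤1))
  N≤m : N ≤ m
  N≤m = ≤-trans (≤-reflexive (sym (ℕ.m*n/n≡m N P))) (ℕ./-monoˡ-≤ P NP≤Q)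
  below' : ⟦ m ⟧ ℚ.* ε ℚ.≤ 1ℚ
  below' = *-cancel-⟦⟧ Q (subst₂ ℚ._≤_ (sym (scale m)) (sym Q·1) (⟦⟧-mono (ℕ.m/n*n≤m Q P)))
  below = subst (λ z → ⟦ m ⟧ ℚ.* z ℚ.≤ 1ℚ) eq below'
  Q≤2mP : Q ≤ 2 * m * P
  Q≤2mP = begin
    Q                        ≡⟨ ℕ.m≡m%n+[m/n]*n Q P ⟩
    -- The remainder is below `P`, and `P ≤ m * P` because `m ≥ N ≥ 1`: rounding down loses at most
    -- a factor two.
    Q ℕ.% P + m * P      ≤⟨ +-monoˡ-≤ (m * P) (≤-trans (<⇒≤ (ℕ.m%n<n Q P)) (m≤n*m P m {{>-nonZero (≤-trans (>-nonZero⁻¹ N) N≤m)}})) ⟩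
    m * P + m * P      ≡⟨ double m P ⟩
    2 * m * P            ∎
    where
    open ≤-Reasoning
    double : ∀ m p → m * p + m * p ≡ 2 * m * p
    double = solve-∀
  above = subst (λ z → 1ℚ ℚ.≤ ⟦ 2 * m ⟧ ℚ.* z) eq
    (*-cancel-⟦⟧ Q (subst₂ ℚ._≤_ (sym Q·1) (sym (scale (2 * m))) (⟦⟧-mono Q≤2mP)))

-- x counts ordered pairs, so x/2 is an edit distance.
far⇒many : ∀ m ε nn x → 1ℚ ℚ.≤ ⟦ 2 * m ⟧ ℚ.* ε → ε ℚ.* ⟦ nn ⟧ ℚ.≤ ratio x 2 → nn ≤ m * x
far⇒many m ε nn x 1≤ far = ⟦⟧-cancel (begin
  ⟦ nn ⟧                          ≡⟨ sym (ℚ.*-identityˡ ⟦ nn ⟧) ⟩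
  1ℚ ℚ.* ⟦ nn ⟧                     ≤⟨ ℚ.*-monoʳ-≤-nonNeg ⟦ nn ⟧ {{⟦⟧-nonNeg nn}} 1≤ ⟩
  ⟦ 2 * m ⟧ ℚ.* ε ℚ.* ⟦ nn ⟧        ≡⟨ ℚ.*-assoc ⟦ 2 * m ⟧ ε ⟦ nn ⟧ ⟩
  ⟦ 2 * m ⟧ ℚ.* (ε ℚ.* ⟦ nn ⟧)      ≤⟨ *-mono-⟦⟧ (2 * m) far ⟩
  ⟦ 2 * m ⟧ ℚ.* ratio x 2         ≡⟨ cong (ℚ._* ratio x 2) (trans (cong ⟦_⟧ (*-comm 2 m)) (⟦⟧-* m 2)) ⟩
  ⟦ m ⟧ ℚ.* ⟦ 2 ⟧ ℚ.* ratio x 2       ≡⟨ trans (ℚ.*-assoc ⟦ m ⟧ ⟦ 2 ⟧ (ratio x 2)) (cong (⟦ m ⟧ ℚ.*_) (trans (ℚ.*-comm ⟦ 2 ⟧ (ratio x 2)) (ratio-* x 2))) ⟩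
  ⟦ m ⟧ ℚ.* ⟦ x ⟧                   ≡⟨ sym (⟦⟧-* m x) ⟩
  ⟦ m * x ⟧                     ∎)
  where open ℚ.≤-Reasoning

-- A round trip with `far⇒many`: the factor two lost in rounding `1/ε` is the one gained by counting
-- ordered pairs, so the density condition of `SProp` holds with `ε` itself.
many⇒dense : ∀ m ε nn .{{_ : NonZero nn}} x → ⟦ m ⟧ ℚ.* ε ℚ.≤ 1ℚ → 0ℚ ℚ.≤ ε → nn ≤ m * x → ε ℚ.≤ ratio x nn
many⇒dense m ε nn x p 0≤ε many = *-cancel-⟦⟧ nn (begin
  ⟦ nn ⟧ ℚ.* ε              ≤⟨ ℚ.*-monoʳ-≤-nonNeg ε {{ℚ.nonNegative 0≤ε}} (⟦⟧-mono many) ⟩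
  ⟦ m * x ⟧ ℚ.* ε         ≡⟨ cong (ℚ._* ε) (trans (cong ⟦_⟧ (*-comm m x)) (⟦⟧-* x m)) ⟩
  ⟦ x ⟧ ℚ.* ⟦ m ⟧ ℚ.* ε       ≡⟨ ℚ.*-assoc ⟦ x ⟧ ⟦ m ⟧ ε ⟩
  ⟦ x ⟧ ℚ.* (⟦ m ⟧ ℚ.* ε)     ≤⟨ *-mono-⟦⟧ x p ⟩
  ⟦ x ⟧ ℚ.* 1ℚ              ≡⟨ trans (ℚ.*-identityʳ ⟦ x ⟧) (sym (trans (ℚ.*-comm ⟦ nn ⟧ _) (ratio-* x nn))) ⟩
  ⟦ nn ⟧ ℚ.* ratio x nn     ∎)
  where open ℚ.≤-Reasoning

edits-cancel : ∀ Δ .{{_ : NonZero Δ}} x y → ratio x 2 ℚ.≤ ratio 1 Δ ℚ.* ratio y 2 → Δ * x ≤ y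
edits-cancel Δ x y p = ⟦⟧-cancel (begin
  ⟦ Δ * x ⟧                        ≡⟨ ⟦⟧-* Δ x ⟩
  ⟦ Δ ⟧ ℚ.* ⟦ x ⟧                      ≡⟨ cong (⟦ Δ ⟧ ℚ.*_) (sym (ratio-* x 2)) ⟩
  ⟦ Δ ⟧ ℚ.* (ratio x 2 ℚ.* ⟦ 2 ⟧)        ≤⟨ *-mono-⟦⟧ Δ (ℚ.*-monoʳ-≤-nonNeg ⟦ 2 ⟧ {{⟦⟧-nonNeg 2}} p) ⟩
  ⟦ Δ ⟧ ℚ.* (ratio 1 Δ ℚ.* ratio y 2 ℚ.* ⟦ 2 ⟧) ≡⟨ re ⟦ Δ ⟧ (ratio 1 Δ) (ratio y 2) ⟦ 2 ⟧ ⟩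
  (ratio 1 Δ ℚ.* ⟦ Δ ⟧) ℚ.* (ratio y 2 ℚ.* ⟦ 2 ⟧) ≡⟨ cong₂ ℚ._*_ (ratio-* 1 Δ) (ratio-* y 2) ⟩
  1ℚ ℚ.* ⟦ y ⟧                         ≡⟨ ℚ.*-identityˡ ⟦ y ⟧ ⟩
  ⟦ y ⟧                              ∎)
  where
  open ℚ.≤-Reasoning
  re : ∀ a b c d → a ℚ.* (b ℚ.* c ℚ.* d) ≡ (b ℚ.* a) ℚ.* (c ℚ.* d)
  re = solve 4 (λ a b c d → a :* (b :* c :* d) := (b :* a) :* (c :* d)) refl
    where open +-*-Solver using (solve; _:*_; _:+_; _:-_; :-_; _:=_)

scale-cancel : ∀ K {η} → ⟦ K ⟧ ℚ.* η ℚ.≤ 1ℚ → ∀ a b → ⟦ a ⟧ ℚ.≤ η ℚ.* ⟦ b ⟧ → K * a ≤ b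
scale-cancel K {η} Kη≤1 a b p = ⟦⟧-cancel (begin
  ⟦ K * a ⟧          ≡⟨ ⟦⟧-* K a ⟩
  ⟦ K ⟧ ℚ.* ⟦ a ⟧        ≤⟨ *-mono-⟦⟧ K p ⟩
  ⟦ K ⟧ ℚ.* (η ℚ.* ⟦ b ⟧)  ≡⟨ sym (ℚ.*-assoc ⟦ K ⟧ η ⟦ b ⟧) ⟩
  ⟦ K ⟧ ℚ.* η ℚ.* ⟦ b ⟧    ≤⟨ ℚ.*-monoʳ-≤-nonNeg ⟦ b ⟧ {{⟦⟧-nonNeg b}} Kη≤1 ⟩
  1ℚ ℚ.* ⟦ b ⟧           ≡⟨ ℚ.*-identityˡ ⟦ b ⟧ ⟩
  ⟦ b ⟧                ∎)
  where open ℚ.≤-Reasoning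

scale-up : ∀ K {η} → ⟦ K ⟧ ℚ.* η ℚ.≤ 1ℚ → 0ℚ ℚ.≤ η → ∀ a b → a ≤ K * b → η ℚ.* ⟦ a ⟧ ℚ.≤ ⟦ b ⟧
scale-up K {η} Kη≤1 0≤η a b p = begin
  η ℚ.* ⟦ a ⟧            ≤⟨ ℚ.*-monoˡ-≤-nonNeg η {{ℚ.nonNegative 0≤η}} (⟦⟧-mono p) ⟩
  η ℚ.* ⟦ K * b ⟧      ≡⟨ cong (η ℚ.*_) (⟦⟧-* K b) ⟩
  η ℚ.* (⟦ K ⟧ ℚ.* ⟦ b ⟧)  ≡⟨ trans (sym (ℚ.*-assoc η ⟦ K ⟧ ⟦ b ⟧)) (cong (ℚ._* ⟦ b ⟧) (ℚ.*-comm η ⟦ K ⟧)) ⟩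
  ⟦ K ⟧ ℚ.* η ℚ.* ⟦ b ⟧    ≤⟨ ℚ.*-monoʳ-≤-nonNeg ⟦ b ⟧ {{⟦⟧-nonNeg b}} Kη≤1 ⟩
  1ℚ ℚ.* ⟦ b ⟧           ≡⟨ ℚ.*-identityˡ ⟦ b ⟧ ⟩
  ⟦ b ⟧                ∎
  where open ℚ.≤-Reasoning

-- The difference is multiplied by `K * P * a`. One side is enough, since exchanging the two
-- fractions gives the other.
clear-denominators : ∀ K {η} → ⟦ K ⟧ ℚ.* η ℚ.≤ 1ℚ → ∀ E P e a .{{_ : NonZero P}} .{{_ : NonZero a}} →
  ratio E P ℚ.- ratio e a ℚ.≤ η → K * (E * a) ≤ K * (P * e) + P * a
clear-denominators K {η} Kη≤1 E P e a p = ⟦⟧-cancel (begin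
  ⟦ K * (E * a) ⟧                      ≡⟨ trans (⟦⟧-* K _) (cong (⟦ K ⟧ ℚ.*_) (⟦⟧-* E a)) ⟩
  ⟦ K ⟧ ℚ.* (⟦ E ⟧ ℚ.* ⟦ a ⟧)                  ≡⟨ cong (λ z → ⟦ K ⟧ ℚ.* (z ℚ.* ⟦ a ⟧)) (sym (ratio-* E P)) ⟩
  ⟦ K ⟧ ℚ.* (ratio E P ℚ.* ⟦ P ⟧ ℚ.* ⟦ a ⟧)      ≡⟨ expand ⟦ K ⟧ (ratio E P) (ratio e a) ⟦ P ⟧ ⟦ a ⟧ ⟩
  ⟦ K ⟧ ℚ.* (⟦ P ⟧ ℚ.* (ratio e a ℚ.* ⟦ a ⟧)) ℚ.+ ⟦ K ⟧ ℚ.* (⟦ P ⟧ ℚ.* ⟦ a ⟧ ℚ.* (ratio E P ℚ.- ratio e a))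
    ≤⟨ ℚ.+-mono-≤ (ℚ.≤-reflexive (cong (λ z → ⟦ K ⟧ ℚ.* (⟦ P ⟧ ℚ.* z)) (ratio-* e a)))
         (*-mono-⟦⟧ K (ℚ.≤-trans (ℚ.≤-reflexive (cong (ℚ._* (ratio E P ℚ.- ratio e a)) (sym (⟦⟧-* P a)))) (*-mono-⟦⟧ (P * a) p))) ⟩
  ⟦ K ⟧ ℚ.* (⟦ P ⟧ ℚ.* ⟦ e ⟧) ℚ.+ ⟦ K ⟧ ℚ.* (⟦ P * a ⟧ ℚ.* η) ≡⟨ cong₂ ℚ._+_ (sym (trans (⟦⟧-* K _) (cong (⟦ K ⟧ ℚ.*_) (⟦⟧-* P e)))) (re ⟦ K ⟧ ⟦ P * a ⟧ η) ⟩
  ⟦ K * (P * e) ⟧ ℚ.+ ⟦ P * a ⟧ ℚ.* (⟦ K ⟧ ℚ.* η) ≤⟨ ℚ.+-monoʳ-≤ ⟦ K * (P * e) ⟧ (*-mono-⟦⟧ (P * a) Kη≤1) ⟩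
  ⟦ K * (P * e) ⟧ ℚ.+ ⟦ P * a ⟧ ℚ.* 1ℚ ≡⟨ cong (⟦ K * (P * e) ⟧ ℚ.+_) (ℚ.*-identityʳ ⟦ P * a ⟧) ⟩
  ⟦ K * (P * e) ⟧ ℚ.+ ⟦ P * a ⟧      ≡⟨ sym (⟦⟧-+ (K * (P * e)) (P * a)) ⟩
  ⟦ K * (P * e) + P * a ⟧          ∎)
  where
  open ℚ.≤-Reasoning
  open +-*-Solver using (solve; _:*_; _:+_; _:-_; :-_; _:=_)
  expand : ∀ k x y p a → k ℚ.* (x ℚ.* p ℚ.* a) ≡ k ℚ.* (p ℚ.* (y ℚ.* a)) ℚ.+ k ℚ.* (p ℚ.* a ℚ.* (x ℚ.- y))
  expand = solve 5 (λ k x y p a → k :* (x :* p :* a) := k :* (p :* (y :* a)) :+ k :* (p :* a :* (x :- y))) refl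
  re : ∀ k p e → k ℚ.* (p ℚ.* e) ≡ p ℚ.* (k ℚ.* e)
  re = solve 3 (λ k p e → k :* (p :* e) := p :* (k :* e)) refl

clear-denominators₂ : ∀ K {η} → ⟦ K ⟧ ℚ.* η ℚ.≤ 1ℚ → ∀ E P e a .{{_ : NonZero P}} .{{_ : NonZero a}} →
  ℚ.∣ ratio E P ℚ.- ratio e a ∣ ℚ.≤ η →
  K * (P * e) ≤ K * (E * a) + P * a × K * (E * a) ≤ K * (P * e) + P * a
clear-denominators₂ K {η} Kη≤1 E P e a p =
  subst₂ _≤_ (cong (K *_) (*-comm e P)) (cong₂ _+_ (cong (K *_) (*-comm a E)) (*-comm a P))
    (clear-denominators K Kη≤1 e a E P (ℚ.≤-trans (p≤absp _) (ℚ.≤-trans (ℚ.≤-reflexive flip) p))) ,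
  clear-denominators K Kη≤1 E P e a (ℚ.≤-trans (p≤absp _) p)
  where
  open +-*-Solver using (solve; _:*_; _:+_; _:-_; :-_; _:=_)
  flip : ℚ.∣ ratio e a ℚ.- ratio E P ∣ ≡ ℚ.∣ ratio E P ℚ.- ratio e a ∣
  flip = trans (cong ℚ.∣_∣ (solve 2 (λ x y → x :- y := :- (y :- x)) refl (ratio e a) (ratio E P))) (ℚ.∣-p∣≡∣p∣ (ratio E P ℚ.- ratio e a))

-- Sums over tuples

Weights : ℕ → ℕ → Set
Weights h n = Fin h → Fin n → ℕ

-- Each tuple is weighted by the product of the weights of its entries. Indicators of parts as
-- weights confine the `i`-th entry to the `i`-th part; constant weights one give the sum over all
-- tuples. The tail is summed outermost, as in `allVecs`.
∑W : ∀ {n} h → Weights h n → (Vec (Fin n) h → ℕ) → ℕ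
∑W {n} zero    w F = F []
∑W {n} (suc h) w F = ∑W h (w ∘ suc) (λ xs → sumFin n (λ x → w zero x * F (x ∷ xs)))

module _ {n : ℕ} where

  ∑W-cong : ∀ h (w : Weights h n) {F G : Vec (Fin n) h → ℕ} → (∀ φ → F φ ≡ G φ) → ∑W h w F ≡ ∑W h w G
  ∑W-cong zero    w e = e []
  ∑W-cong (suc h) w e = ∑W-cong h _ (λ xs → ∑-cong n (λ x → cong (w zero x *_) (e (x ∷ xs))))

  ∑W-mono : ∀ h (w : Weights h n) {F G : Vec (Fin n) h → ℕ} → (∀ φ → F φ ≤ G φ) → ∑W h w F ≤ ∑W h w G
  ∑W-mono zero    w e = e []
  ∑W-mono (suc h) w e = ∑W-mono h _ (λ xs → ∑-mono n (λ x → *-monoʳ-≤ (w zero x) (e (x ∷ xs))))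

  ∑W-monoʷ : ∀ h {w w' : Weights h n} (F : Vec (Fin n) h → ℕ) → (∀ i x → w i x ≤ w' i x) → ∑W h w F ≤ ∑W h w' F
  ∑W-monoʷ zero    F e = ≤-refl
  ∑W-monoʷ (suc h) F e = ≤-trans
    (∑W-mono h _ (λ xs → ∑-mono n (λ x → *-monoˡ-≤ (F (x ∷ xs)) (e zero x))))
    (∑W-monoʷ h _ (λ i → e (suc i)))

  ∑W-+ : ∀ h (w : Weights h n) (F G : Vec (Fin n) h → ℕ) →
    ∑W h w (λ φ → F φ + G φ) ≡ ∑W h w F + ∑W h w G
  ∑W-+ zero    w F G = refl
  ∑W-+ (suc h) w F G = trans
    (∑W-cong h _ (λ xs → trans (∑-cong n (λ x → *-distribˡ-+ (w zero x) _ _)) (∑-+ n _ _)))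
    (∑W-+ h _ _ _)

  ∑W-*ˡ : ∀ h (w : Weights h n) c (F : Vec (Fin n) h → ℕ) → ∑W h w (λ φ → c * F φ) ≡ c * ∑W h w F
  ∑W-*ˡ zero    w c F = refl
  ∑W-*ˡ (suc h) w c F = trans
    (∑W-cong h _ (λ xs → trans (∑-cong n (λ x → *-swap (w zero x) c _)) (∑-*ˡ n c _)))
    (∑W-*ˡ h _ c _)

  ∑W-∑ : ∀ h (w : Weights h n) k (F : Fin k → Vec (Fin n) h → ℕ) →
    ∑W h w (λ φ → sumFin k (λ i → F i φ)) ≡ sumFin k (λ i → ∑W h w (F i))
  ∑W-∑ h w zero    F = zeroW h w
    where
    zeroW : ∀ h (w : Weights h n) → ∑W h w (λ _ → 0) ≡ 0
    zeroW h w = ∑W-*ˡ h w 0 (λ _ → 0)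
  ∑W-∑ h w (suc k) F = trans (∑W-+ h w _ _) (cong (∑W h w (F zero) +_) (∑W-∑ h w k _))

  mass : ∀ {h} → Weights h n → Fin h → ℕ
  mass w i = sumFin n (w i)

  ∏mass : ∀ h → Weights h n → ℕ
  ∏mass zero    w = 1
  ∏mass (suc h) w = mass w zero * ∏mass h (w ∘ suc)

  ∑W-1 : ∀ h (w : Weights h n) → ∑W h w (λ _ → 1) ≡ ∏mass h w
  ∑W-1 zero    w = refl
  ∑W-1 (suc h) w = begin
    ∑W h (w ∘ suc) (λ _ → sumFin n (λ x → w zero x * 1))
      ≡⟨ ∑W-cong h _ (λ _ → trans (∑-cong n (λ x → *-identityʳ _)) (sym (*-identityʳ (mass w zero)))) ⟩
    ∑W h (w ∘ suc) (λ _ → mass w zero * 1)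
      ≡⟨ ∑W-*ˡ h _ (mass w zero) (λ _ → 1) ⟩
    mass w zero * ∑W h (w ∘ suc) (λ _ → 1)
      ≡⟨ cong (mass w zero *_) (∑W-1 h _) ⟩
    ∏mass (suc h) w ∎
    where open ≡-Reasoning

  -- Coordinate `i` is overwritten, so its old value enters through its weight alone and contributes
  -- the factor `mass w i`.
  resample : ∀ h (w : Weights h n) (i : Fin h) (F : Vec (Fin n) h → ℕ) →
    ∑W h w (λ φ → sumFin n (λ x → w i x * F (φ [ i ]≔ x))) ≡ mass w i * ∑W h w F
  resample (suc h) w zero F = begin
    ∑W h (w ∘ suc) (λ xs → sumFin n (λ x → w zero x * G xs))
      ≡⟨ ∑W-cong h _ (λ xs → ∑-*ʳ n (w zero) (G xs)) ⟩
    ∑W h (w ∘ suc) (λ xs → mass w zero * G xs)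
      ≡⟨ ∑W-*ˡ h _ (mass w zero) G ⟩
    _ ∎
    where
    open ≡-Reasoning
    G : Vec (Fin n) h → ℕ
    G xs = sumFin n (λ x → w zero x * F (x ∷ xs))
  resample (suc h) w (suc i) F = begin
    ∑W h (w ∘ suc) (λ xs → sumFin n (λ x → w zero x * sumFin n (λ y → w (suc i) y * F (x ∷ (xs [ i ]≔ y)))))
      ≡⟨ ∑W-cong h _ pt ⟩
    ∑W h (w ∘ suc) (λ xs → sumFin n (λ y → w (suc i) y * G (xs [ i ]≔ y)))
      ≡⟨ resample h (w ∘ suc) i G ⟩
    _ ∎
    where
    open ≡-Reasoning
    G : Vec (Fin n) h → ℕ
    G xs = sumFin n (λ x → w zero x * F (x ∷ xs))
    pt : ∀ xs → sumFin n (λ x → w zero x * sumFin n (λ y → w (suc i) y * F (x ∷ (xs [ i ]≔ y)))) ≡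
                sumFin n (λ y → w (suc i) y * G (xs [ i ]≔ y))
    pt xs = begin
      _ ≡⟨ ∑-cong n (λ x → sym (∑-*ˡ n (w zero x) _)) ⟩
      _ ≡⟨ ∑-swap n n _ ⟩
      _ ≡⟨ ∑-cong n (λ y → trans (∑-cong n (λ x → *-swap (w zero x) (w (suc i) y) _)) (∑-*ˡ n (w (suc i) y) _)) ⟩
      _ ∎

  -- Lets an inequality that holds for each choice of the other coordinates, with only `i` and `j`
  -- running, be summed over `φ`. This is how the regularity of a single pair enters the count.
  resample₂ : ∀ h (w : Weights h n) (i j : Fin h) (F : Vec (Fin n) h → ℕ) →
    ∑W h w (λ φ → ∑₂ n n (λ x y → w i x * w j y * F ((φ [ i ]≔ x) [ j ]≔ y))) ≡
    mass w i * mass w j * ∑W h w F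
  resample₂ h w i j F = begin
    ∑W h w (λ φ → ∑₂ n n (λ x y → w i x * w j y * F ((φ [ i ]≔ x) [ j ]≔ y)))
      ≡⟨ ∑W-cong h w (λ φ → ∑-cong n (λ x → trans (∑-cong n (λ y → *-assoc (w i x) (w j y) _)) (∑-*ˡ n (w i x) _))) ⟩
    ∑W h w (λ φ → sumFin n (λ x → w i x * G (φ [ i ]≔ x)))
      ≡⟨ resample h w i G ⟩
    mass w i * ∑W h w G
      ≡⟨ cong (mass w i *_) (resample h w j F) ⟩
    mass w i * (mass w j * ∑W h w F)
      ≡⟨ sym (*-assoc (mass w i) (mass w j) _) ⟩
    _ ∎
    where
    open ≡-Reasoning
    G : Vec (Fin n) h → ℕ
    G φ = sumFin n (λ y → w j y * F (φ [ j ]≔ y))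

-- The number of copies as a sum over tuples

sumList : ∀ {A : Set} → (A → ℕ) → List A → ℕ
sumList f []       = 0
sumList f (x ∷ xs) = f x + sumList f xs

length-filterᵇ : ∀ {A : Set} (P : A → Bool) xs → length (filterᵇ P xs) ≡ sumList (𝟙 ∘ P) xs
length-filterᵇ P []       = refl
length-filterᵇ P (x ∷ xs) with P x
... | true  = cong suc (length-filterᵇ P xs)
... | false = length-filterᵇ P xs

sumList-++ : ∀ {A : Set} (f : A → ℕ) xs ys → sumList f (xs ++ ys) ≡ sumList f xs + sumList f ys
sumList-++ f []       ys = refl
sumList-++ f (x ∷ xs) ys = trans (cong (f x +_) (sumList-++ f xs ys)) (sym (+-assoc (f x) _ _))

sumList-map : ∀ {A B : Set} (f : B → ℕ) (g : A → B) xs → sumList f (map g xs) ≡ sumList (f ∘ g) xs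
sumList-map f g []       = refl
sumList-map f g (x ∷ xs) = cong (f (g x) +_) (sumList-map f g xs)

sumList-concatMap : ∀ {A B : Set} (f : B → ℕ) (g : A → List B) xs →
  sumList f (concatMap g xs) ≡ sumList (λ x → sumList f (g x)) xs
sumList-concatMap f g []       = refl
sumList-concatMap f g (x ∷ xs) =
  trans (sumList-++ f (g x) _) (cong (sumList f (g x) +_) (sumList-concatMap f g xs))

sumList-tabulate : ∀ {A : Set} (f : A → ℕ) n (g : Fin n → A) → sumList f (List.tabulate g) ≡ sumFin n (f ∘ g)
sumList-tabulate f zero    g = refl
sumList-tabulate f (suc n) g = cong (f (g zero) +_) (sumList-tabulate f n _)

sumList-cong : ∀ {A : Set} {f g : A → ℕ} → (∀ x → f x ≡ g x) → ∀ xs → sumList f xs ≡ sumList g xs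
sumList-cong e []       = refl
sumList-cong e (x ∷ xs) = cong₂ _+_ (e x) (sumList-cong e xs)

sumList-allVecs : ∀ h n (F : Vec (Fin n) h → ℕ) → sumList F (allVecs h n) ≡ ∑W h (λ _ _ → 1) F
sumList-allVecs zero    n F = +-identityʳ _
sumList-allVecs (suc h) n F = begin
  sumList F (concatMap (λ xs → map (λ x → x ∷ xs) (List.allFin n)) (allVecs h n))
    ≡⟨ sumList-concatMap F _ (allVecs h n) ⟩
  sumList (λ xs → sumList F (map (λ x → x ∷ xs) (List.allFin n))) (allVecs h n)
    ≡⟨ sumList-cong (λ xs → trans (sumList-map F _ (List.allFin n)) (trans (sumList-tabulate _ n _) (∑-cong n (λ x → sym (*-identityˡ _))))) (allVecs h n) ⟩
  sumList (λ xs → sumFin n (λ x → 1 * F (x ∷ xs))) (allVecs h n)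
    ≡⟨ sumList-allVecs h n _ ⟩
  _ ∎
  where open ≡-Reasoning

copies≡∑W : ∀ {h n} (H : Graph h) (G : Graph n) → copies H G ≡ ∑W h (λ _ _ → 1) (λ φ → 𝟙 (isCopyᵇ H G φ))
copies≡∑W {h} {n} H G = trans (length-filterᵇ (isCopyᵇ H G) (allVecs h n)) (sumList-allVecs h n _)

-- The counting lemma

Rel : ℕ → Set
Rel n = Fin n → Fin n → Bool

Edge : ℕ → Set
Edge h = Fin h × Fin h

_≟ᴱ_ : ∀ {h} (e e' : Edge h) → Dec (e ≡ e')
_≟ᴱ_ = ≡-dec _≟_ _≟_

-- One orientation per edge: distinct increasing pairs are distinct as unordered pairs too.
Increasing : ∀ {h} → Edge h → Set
Increasing (i , j) = i Fin.< j

_without_ : ∀ {h} → List (Edge h) → Edge h → List (Edge h)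
es without e₀ = filter (λ e → ¬? (e ≟ᴱ e₀)) es

∏ : ∀ {A : Set} → (A → ℕ) → List A → ℕ
∏ f []       = 1
∏ f (x ∷ xs) = f x * ∏ f xs

-- `without` drops every occurrence of `e₀`; by uniqueness this is a single factor.
∏-without : ∀ {h} (f : Edge h → ℕ) {es e₀} → Unique es → e₀ ∈ es → ∏ f es ≡ f e₀ * ∏ f (es without e₀)
∏-without f {e ∷ es} (e∉ ∷ u) (here refl) = cong (λ l → f e * ∏ f l) (sym (trans
  (filter-reject (λ e' → ¬? (e' ≟ᴱ e)) {xs = es} (λ p → p refl))
  (filter-all (λ e' → ¬? (e' ≟ᴱ e)) (All.map (λ p q → p (sym q)) e∉))))
∏-without f {e ∷ es} {e₀} (e∉ ∷ u) (there p) = begin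
  f e * ∏ f es
    ≡⟨ cong (f e *_) (∏-without f u p) ⟩
  f e * (f e₀ * ∏ f (es without e₀))
    ≡⟨ *-swap (f e) (f e₀) _ ⟩
  f e₀ * ∏ f (e ∷ (es without e₀))
    ≡⟨ cong (λ l → f e₀ * ∏ f l) (sym (filter-accept (λ e' → ¬? (e' ≟ᴱ e₀)) (All.lookup e∉ p))) ⟩
  _ ∎
  where
  open ≡-Reasoning

at : ∀ {h n} → Rel n → Edge h → Vec (Fin n) h → Bool
at R (i , j) φ = R (lookup φ i) (lookup φ j)

-- The slot `g` holds a factor that need not be regular: constantly true when all edges are counted,
-- and the added edges on one edge of `H` when those are to be bounded.
conj : ∀ {h n} → Rel n → (Vec (Fin n) h → Bool) → List (Edge h) → Vec (Fin n) h → Bool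
conj R g []       φ = g φ
conj R g (e ∷ es) φ = conj R g es φ ∧ at R e φ

-- Once all coordinates but i and j are frozen, F is the indicator of a rectangle.
Splits : ∀ {h n} → Fin h → Fin h → (Vec (Fin n) h → Bool) → Set
Splits {h} {n} i j F = ∀ φ → Σ (Fin n → Bool) λ X → Σ (Fin n → Bool) λ Y →
  ∀ x y → F ((φ [ i ]≔ x) [ j ]≔ y) ≡ X x ∧ Y y

Apart : ∀ {h} → Edge h → Edge h → Set
Apart (i , j) (a , b) = (a ≢ i × b ≢ i) ⊎ (a ≢ j × b ≢ j)

-- An edge through both `i` and `j` would equal `(i , j)`, both being increasing; any other one
-- avoids `i` or avoids `j`.
apart : ∀ {h} {e e' : Edge h} → Increasing e → Increasing e' → e' ≢ e → Apart e e'
apart {e = i , j} {a , b} i<j a<b ne with a ≟ i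
... | yes refl = inj₂ (Fin.<⇒≢ i<j , λ { refl → ne refl })
... | no a≢i with b ≟ i
...   | no b≢i   = inj₁ (a≢i , b≢i)
...   | yes refl = inj₂ (Fin.<⇒≢ (Fin.<-trans a<b i<j) , Fin.<⇒≢ i<j)

module _ {h n : ℕ} where

  splits-true : ∀ (i j : Fin h) → Splits {n = n} i j (λ _ → true)
  splits-true i j φ = (λ _ → true) , (λ _ → true) , λ _ _ → refl

  splits-∧ : ∀ {i j : Fin h} {F G : Vec (Fin n) h → Bool} →
    Splits i j F → Splits i j G → Splits i j (λ φ → F φ ∧ G φ)
  splits-∧ sF sG φ with sF φ | sG φ
  ... | X , Y , p | X' , Y' , p' = (λ x → X x ∧ X' x) , (λ y → Y y ∧ Y' y) ,
    λ x y → trans (cong₂ _∧_ (p x y) (p' x y)) (interchange (X x) (Y y) (X' x) (Y' y))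
    where
    interchange : ∀ a b c d → (a ∧ b) ∧ (c ∧ d) ≡ (a ∧ c) ∧ (b ∧ d)
    interchange false b c     d = refl
    interchange true  b true  d = refl
    interchange true  true  false d = refl
    interchange true  false false d = refl

  -- An edge that avoids `i` or `j` depends on at most one of the two free coordinates, so its
  -- indicator is a rectangle with one full side.
  splits-at : ∀ (R : Rel n) {e e' : Edge h} → Apart e e' → Splits (proj₁ e) (proj₂ e) (at R e')
  splits-at R {i , j} {a , b} (inj₁ (a≢i , b≢i)) φ =
    (λ _ → true) , (λ y → at R (a , b) (φ [ j ]≔ y)) , λ x y → cong₂ R (skip a≢i x y) (skip b≢i x y)
    where
    skip : ∀ {c} → c ≢ i → ∀ x y → lookup ((φ [ i ]≔ x) [ j ]≔ y) c ≡ lookup (φ [ j ]≔ y) c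
    skip {c} c≢i x y with c ≟ j
    ... | yes refl = trans (lookup∘updateAt c (φ [ i ]≔ x)) (sym (lookup∘updateAt c φ))
    ... | no c≢j   = trans (lookup∘updateAt′ c j c≢j (φ [ i ]≔ x))
                       (trans (lookup∘updateAt′ c i c≢i φ) (sym (lookup∘updateAt′ c j c≢j φ)))
  splits-at R {i , j} {a , b} (inj₂ (a≢j , b≢j)) φ =
    (λ x → at R (a , b) (φ [ i ]≔ x)) , (λ _ → true) , λ x y →
      trans (cong₂ R (lookup∘updateAt′ a j a≢j (φ [ i ]≔ x)) (lookup∘updateAt′ b j b≢j (φ [ i ]≔ x))) (sym (∧-identityʳ _))

  splits-conj : ∀ (R : Rel n) {i j : Fin h} {g} es → Splits i j g →
    All (Apart (i , j)) es → Splits i j (conj R g es)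
  splits-conj R         []       sg []       = sg
  splits-conj R {i} {j} (e ∷ es) sg (p ∷ ps) =
    splits-∧ {i} {j} {conj R _ es} {at R e} (splits-conj R es sg ps) (splits-at R p)

  module _ (w : Weights h n) where

    T : (Vec (Fin n) h → Bool) → ℕ
    T F = ∑W h w (λ φ → 𝟙 (F φ))

    rect : Fin h → Fin h → Rel n → ℕ
    rect i j W = ∑₂ n n (λ x y → w i x * w j y * 𝟙 (W x y))

    area : Edge h → ℕ
    area (i , j) = mass w i * mass w j

    edges : Rel n → Edge h → ℕ
    edges R (i , j) = rect i j R

    vol : ℕ
    vol = ∏mass h w

    -- 1/K-regularity in cut-norm form, with all denominators cleared.
    Cut : ℕ → Rel n → Edge h → Set
    Cut K R (i , j) = ∀ (X Y : Fin n → Bool) →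
      let P = area (i , j); E = edges R (i , j)
          e = rect i j (λ x y → (X x ∧ Y y) ∧ R x y)
          a = rect i j (λ x y → X x ∧ Y y) in
      K * (P * e) ≤ K * (E * a) + P * P × K * (E * a) ≤ K * (P * e) + P * P

    edges≤area : ∀ R e → edges R e ≤ area e
    edges≤area R (i , j) = ≤-trans
      (∑₂-mono n n (λ x y → ≤-trans (*-monoʳ-≤ (w i x * w j y) (𝟙≤1 (R x y))) (≤-reflexive (*-identityʳ _))))
      (≤-reflexive (∑₂-prod n n (w i) (w j)))

    module _ (K : ℕ) (R : Rel n) {i j : Fin h} (i≢j : i ≢ j) .{{_ : NonZero (area (i , j))}}
             (cut : Cut K R (i , j)) (F : Vec (Fin n) h → Bool) (sF : Splits i j F) where
      private
        P = area (i , j)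
        E = edges R (i , j)

        F' : Vec (Fin n) h → Bool
        F' φ = F φ ∧ at R (i , j) φ

        inner inner' : Vec (Fin n) h → ℕ
        inner  φ = ∑₂ n n (λ x y → w i x * w j y * 𝟙 (F  ((φ [ i ]≔ x) [ j ]≔ y)))
        inner' φ = ∑₂ n n (λ x y → w i x * w j y * 𝟙 (F' ((φ [ i ]≔ x) [ j ]≔ y)))

        at-ij : ∀ φ x y → at R (i , j) ((φ [ i ]≔ x) [ j ]≔ y) ≡ R x y
        at-ij φ x y = cong₂ R (trans (lookup∘updateAt′ i j i≢j (φ [ i ]≔ x)) (lookup∘updateAt i φ))
                             (lookup∘updateAt j (φ [ i ]≔ x))

        pt : ∀ φ → K * (P * inner' φ) ≤ K * (E * inner φ) + P * P * 1 ×
                   K * (E * inner φ) ≤ K * (P * inner' φ) + P * P * 1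
        pt φ with sF φ
        ... | X , Y , p = subst₂ (λ a b → K * (P * a) ≤ K * (E * b) + P * P * 1 × K * (E * b) ≤ K * (P * a) + P * P * 1)
          (∑₂-cong n n (λ x y → cong (λ c → w i x * w j y * 𝟙 c) (sym (cong₂ _∧_ (p x y) (at-ij φ x y)))))
          (∑₂-cong n n (λ x y → cong (λ c → w i x * w j y * 𝟙 c) (sym (p x y))))
          (subst (λ z → K * (P * e) ≤ K * (E * a) + z × K * (E * a) ≤ K * (P * e) + z) (sym (*-identityʳ (P * P))) (cut X Y))
          where
          e = rect i j (λ x y → (X x ∧ Y y) ∧ R x y)
          a = rect i j (λ x y → X x ∧ Y y)

        ∑inner : ∀ c G → ∑W h w (λ φ → K * (c * ∑₂ n n (λ x y → w i x * w j y * 𝟙 (G ((φ [ i ]≔ x) [ j ]≔ y))))) ≡ P * (K * (c * T G))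
        ∑inner c G = begin
          _ ≡⟨ ∑W-*ˡ h w K _ ⟩
          _ ≡⟨ cong (K *_) (∑W-*ˡ h w c _) ⟩
          _ ≡⟨ cong (λ z → K * (c * z)) (resample₂ h w i j (λ φ → 𝟙 (G φ))) ⟩
          K * (c * (P * T G)) ≡⟨ comm K c P (T G) ⟩
          P * (K * (c * T G)) ∎
          where
          open ≡-Reasoning
          comm : ∀ a b c d → a * (b * (c * d)) ≡ c * (a * (b * d))
          comm = solve-∀

        ∑err : ∀ (G : Vec (Fin n) h → ℕ) → ∑W h w (λ φ → G φ + P * P * 1) ≡ ∑W h w G + P * (P * vol)
        ∑err G = trans (∑W-+ h w G _) (cong (∑W h w G +_) (trans (∑W-*ˡ h w (P * P) (λ _ → 1))
          (trans (cong (P * P *_) (∑W-1 h w)) (*-assoc P P vol))))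

      -- With the other coordinates frozen, `F` is a rectangle, and `pt` is the cut inequality for
      -- it. Summing over `φ` gives the main terms a factor `P` by `resample₂`; the error `P * P`
      -- per tuple contains it as well, and it cancels.
      step-upper : K * (P * T F') ≤ K * (E * T F) + P * vol
      step-upper = *-cancelˡ-≤ P (begin
        P * (K * (P * T F'))                            ≡⟨ sym (∑inner P F') ⟩
        ∑W h w (λ φ → K * (P * inner' φ))               ≤⟨ ∑W-mono h w (λ φ → proj₁ (pt φ)) ⟩
        ∑W h w (λ φ → K * (E * inner φ) + P * P * 1)    ≡⟨ ∑err _ ⟩
        ∑W h w (λ φ → K * (E * inner φ)) + P * (P * vol) ≡⟨ cong (_+ P * (P * vol)) (∑inner E F) ⟩
        P * (K * (E * T F)) + P * (P * vol)             ≡⟨ sym (*-distribˡ-+ P _ _) ⟩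
        P * (K * (E * T F) + P * vol)                   ∎)
        where open ≤-Reasoning

      step-lower : K * (E * T F) ≤ K * (P * T F') + P * vol
      step-lower = *-cancelˡ-≤ P (begin
        P * (K * (E * T F))                             ≡⟨ sym (∑inner E F) ⟩
        ∑W h w (λ φ → K * (E * inner φ))                ≤⟨ ∑W-mono h w (λ φ → proj₂ (pt φ)) ⟩
        ∑W h w (λ φ → K * (P * inner' φ) + P * P * 1)   ≡⟨ ∑err _ ⟩
        ∑W h w (λ φ → K * (P * inner' φ)) + P * (P * vol) ≡⟨ cong (_+ P * (P * vol)) (∑inner P F') ⟩
        P * (K * (P * T F')) + P * (P * vol)            ≡⟨ sym (*-distribˡ-+ P _ _) ⟩
        P * (K * (P * T F') + P * vol)                  ∎)
        where open ≤-Reasoning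

    module _ (K : ℕ) (R : Rel n) (pos : ∀ i → NonZero (mass w i)) where

      private
        nz : ∀ e → NonZero (area e)
        nz (i , j) = m*n≢0 (mass w i) (mass w j) {{pos i}} {{pos j}}

      -- One edge at a time is exchanged for its density, with an error of a `1/K` fraction of
      -- `vol`. Errors are afterwards multiplied by densities only, which are at most one by
      -- `edges≤area`, so they add up to at most `length es` such fractions. The factor `g` is never
      -- exchanged; it only has to be a rectangle in the endpoints of every edge of `es`.
      count-upper : ∀ g es → Unique es → All Increasing es → All (Cut K R) es →
        All (λ e → Splits (proj₁ e) (proj₂ e) g) es →
        K * (∏ area es * T (conj R g es)) ≤ K * (∏ (edges R) es * T g) + length es * (∏ area es * vol)
      count-upper g [] u inc cuts sp = m≤m+n _ _
      count-upper g (e ∷ es) (e∉ ∷ u) (lt ∷ inc) (cut ∷ cuts) (s ∷ sp) = begin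
        K * (P * PP * T')                          ≡⟨ a1 K P PP T' ⟩
        PP * (K * (P * T'))                        ≤⟨ *-monoʳ-≤ PP hyp ⟩
        PP * (K * (E * t) + P * vol)               ≡⟨ a2 PP K E t (P * vol) ⟩
        E * (K * (PP * t)) + PP * (P * vol)        ≤⟨ +-monoˡ-≤ _ (*-monoʳ-≤ E (count-upper g es u inc cuts sp)) ⟩
        E * (K * (EE * T g) + l * (PP * vol)) + PP * (P * vol) ≡⟨ a3 E K EE (T g) (l * (PP * vol)) (PP * (P * vol)) ⟩
        K * (E * EE * T g) + (E * (l * (PP * vol)) + PP * (P * vol)) ≤⟨ +-monoʳ-≤ (K * (E * EE * T g)) (+-monoˡ-≤ _ (*-monoˡ-≤ (l * (PP * vol)) (edges≤area R e))) ⟩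
        K * (E * EE * T g) + (P * (l * (PP * vol)) + PP * (P * vol)) ≡⟨ cong (K * (E * EE * T g) +_) (a4 P l PP vol) ⟩
        K * (E * EE * T g) + suc l * (P * PP * vol) ∎
        where
        open ≤-Reasoning
        P = area e; E = edges R e; PP = ∏ area es; EE = ∏ (edges R) es; l = length es
        T' = T (conj R g (e ∷ es))
        t = T (conj R g es)
        hyp : K * (P * T') ≤ K * (E * t) + P * vol
        hyp = step-upper K R (Fin.<⇒≢ lt) {{nz e}} cut (conj R g es)
          (splits-conj R es s (All.zipWith (λ { (ne , i) → apart lt i (λ q → ne (sym q)) }) (e∉ , inc)))
        a1 : ∀ a b c d → a * (b * c * d) ≡ c * (a * (b * d))
        a1 = solve-∀
        a2 : ∀ p k e t x → p * (k * (e * t) + x) ≡ e * (k * (p * t)) + p * x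
        a2 = solve-∀
        a3 : ∀ e k f t x y → e * (k * (f * t) + x) + y ≡ k * (e * f * t) + (e * x + y)
        a3 = solve-∀
        a4 : ∀ p l q v → p * (l * (q * v)) + q * (p * v) ≡ (1 + l) * (p * q * v)
        a4 = solve-∀

      count-lower : ∀ g es → Unique es → All Increasing es → All (Cut K R) es →
        All (λ e → Splits (proj₁ e) (proj₂ e) g) es →
        K * (∏ (edges R) es * T g) ≤ K * (∏ area es * T (conj R g es)) + length es * (∏ area es * vol)
      count-lower g [] u inc cuts sp = m≤m+n _ _
      count-lower g (e ∷ es) (e∉ ∷ u) (lt ∷ inc) (cut ∷ cuts) (s ∷ sp) = begin
        K * (E * EE * T g)                         ≡⟨ a1 K E EE (T g) ⟩
        E * (K * (EE * T g))                       ≤⟨ *-monoʳ-≤ E (count-lower g es u inc cuts sp) ⟩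
        E * (K * (PP * t) + l * (PP * vol))        ≡⟨ a2 E K PP t (l * (PP * vol)) ⟩
        PP * (K * (E * t)) + E * (l * (PP * vol))  ≤⟨ +-mono-≤ (*-monoʳ-≤ PP hyp) (*-monoˡ-≤ (l * (PP * vol)) (edges≤area R e)) ⟩
        PP * (K * (P * T') + P * vol) + P * (l * (PP * vol)) ≡⟨ a4 PP K P T' vol l ⟩
        K * (P * PP * T') + suc l * (P * PP * vol) ∎
        where
        open ≤-Reasoning
        P = area e; E = edges R e; PP = ∏ area es; EE = ∏ (edges R) es; l = length es
        T' = T (conj R g (e ∷ es))
        t = T (conj R g es)
        hyp : K * (E * t) ≤ K * (P * T') + P * vol
        hyp = step-lower K R (Fin.<⇒≢ lt) {{nz e}} cut (conj R g es)
          (splits-conj R es s (All.zipWith (λ { (ne , i) → apart lt i (λ q → ne (sym q)) }) (e∉ , inc)))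
        a1 : ∀ a b c d → a * (b * c * d) ≡ b * (a * (c * d))
        a1 = solve-∀
        a2 : ∀ e k p t x → e * (k * (p * t) + x) ≡ p * (k * (e * t)) + e * x
        a2 = solve-∀
        a4 : ∀ q k p t v l → q * (k * (p * t) + p * v) + p * (l * (q * v)) ≡ k * (p * q * t) + (1 + l) * (p * q * v)
        a4 = solve-∀

-- Counting the tuples that use no added edge

sumList-mono : ∀ {A : Set} {f g : A → ℕ} xs → (∀ x → x ∈ xs → f x ≤ g x) → sumList f xs ≤ sumList g xs
sumList-mono []       p = z≤n
sumList-mono (x ∷ xs) p = +-mono-≤ (p x (here refl)) (sumList-mono xs (λ y q → p y (there q)))

sumList-const : ∀ {A : Set} c (xs : List A) → sumList (λ _ → c) xs ≡ length xs * c
sumList-const c []       = refl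
sumList-const c (x ∷ xs) = cong (c +_) (sumList-const c xs)

sumList-*ˡ : ∀ {A : Set} c (f : A → ℕ) xs → sumList (λ x → c * f x) xs ≡ c * sumList f xs
sumList-*ˡ c f []       = sym (*-zeroʳ c)
sumList-*ˡ c f (x ∷ xs) = trans (cong (c * f x +_) (sumList-*ˡ c f xs)) (sym (*-distribˡ-+ c _ _))

sumList-term : ∀ {A : Set} (f : A → ℕ) {x xs} → x ∈ xs → f x ≤ sumList f xs
sumList-term f (here refl) = m≤m+n _ _
sumList-term f (there p)   = ≤-trans (sumList-term f p) (m≤n+m _ _)

∑W-sumList : ∀ {n} h (w : Weights h n) {A : Set} (F : A → Vec (Fin n) h → ℕ) xs →
  ∑W h w (λ φ → sumList (λ a → F a φ) xs) ≡ sumList (λ a → ∑W h w (F a)) xs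
∑W-sumList h w F []       = ∑W-*ˡ h w 0 (λ _ → 0)
∑W-sumList h w F (x ∷ xs) = trans (∑W-+ h w _ _) (cong (∑W h w (F x) +_) (∑W-sumList h w F xs))

∏-pos : ∀ {A : Set} (f : A → ℕ) xs → (∀ x → NonZero (f x)) → NonZero (∏ f xs)
∏-pos f []       p = _
∏-pos f (x ∷ xs) p = m*n≢0 (f x) (∏ f xs) {{p x}} {{∏-pos f xs p}}

module _ {h n : ℕ} where

  conj-∈ : ∀ (R : Rel n) g es (φ : Vec (Fin n) h) → conj R g es φ ≡ true → ∀ {e} → e ∈ es → at R e φ ≡ true
  conj-∈ R g (e ∷ es) φ p q with conj R g es φ in c | at R e φ in r
  conj-∈ R g (e ∷ es) φ p (here refl) | true | true = r
  conj-∈ R g (e ∷ es) φ p (there q)   | true | true = conj-∈ R g es φ c q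
  conj-∈ R g (e ∷ es) φ () q | true  | false
  conj-∈ R g (e ∷ es) φ () q | false | _

  conj-intro : ∀ (R : Rel n) g es (φ : Vec (Fin n) h) → g φ ≡ true →
    (∀ {e} → e ∈ es → at R e φ ≡ true) → conj R g es φ ≡ true
  conj-intro R g []       φ pg p = pg
  conj-intro R g (e ∷ es) φ pg p = cong₂ _∧_ (conj-intro R g es φ pg (λ q → p (there q))) (p (here refl))

  all-or-fail : ∀ (B : Rel n) (φ : Vec (Fin n) h) es →
    conj B (λ _ → true) es φ ≡ true ⊎ ∃ λ e → e ∈ es × at B e φ ≡ false
  all-or-fail B φ []       = inj₁ refl
  all-or-fail B φ (e ∷ es) with all-or-fail B φ es | at B e φ in eq
  ... | inj₂ (e' , q , f) | _     = inj₂ (e' , there q , f)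
  ... | inj₁ p            | false = inj₂ (e , here refl , eq)
  ... | inj₁ p            | true  = inj₁ (cong (_∧ true) p)

  module _ (R B A : Rel n) (cover : ∀ x y → R x y ≡ true → B x y ≡ false → A x y ≡ true) where

    private
      ⊤ᵇ : Vec (Fin n) h → Bool
      ⊤ᵇ _ = true

    -- If the edges of a tuple all lie in `R` but not all in `B`, some edge `e` lies in `A`, and the
    -- summand of `e` is one. Being a union bound, it keeps `R` in all the other factors, where
    -- regularity is available.
    telescope : ∀ es (φ : Vec (Fin n) h) →
      𝟙 (conj R ⊤ᵇ es φ) ≤ 𝟙 (conj B ⊤ᵇ es φ) + sumList (λ e → 𝟙 (conj R (at A e) (es without e) φ)) es
    telescope es φ with conj R ⊤ᵇ es φ in r
    ... | false = z≤n
    ... | true with all-or-fail B φ es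
    ...   | inj₁ p rewrite p = s≤s z≤n
    ...   | inj₂ (e , q , f) = ≤-trans
      (≤-trans (≤-reflexive (cong 𝟙 (sym (conj-intro R (at A e) (es without e) φ
          (cover _ _ (conj-∈ R ⊤ᵇ es φ r q) f)
          (λ q' → conj-∈ R ⊤ᵇ es φ r (proj₁ (∈-filter⁻ (λ e' → ¬? (e' ≟ᴱ e)) {xs = es} q')))))))
        (sumList-term (λ e → 𝟙 (conj R (at A e) (es without e) φ)) q))
      (m≤n+m _ _)

    module _ (w : Weights h n) (pos : ∀ i → NonZero (mass w i)) (K D q : ℕ)
             (K-large : 8 * (q * q) * D ^ q ≤ K) (1≤q : 1 ≤ q) (1≤D : 1 ≤ D)
             (es : List (Edge h)) (u : Unique es) (inc : All Increasing es) (len : length es ≤ q)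
             (cut : All (Cut w K R) es)
             (dense : ∀ e → e ∈ es → area w e ≤ D * edges w R e)
             (few : ∀ e → e ∈ es → 2 * q * edges w A e ≤ edges w R e) where
      private
        PP = ∏ (area w) es
        EE = ∏ (edges w R) es
        V = vol w
        tR = T w (conj R ⊤ᵇ es)
        tB = T w (conj B ⊤ᵇ es)
        tA : Edge h → ℕ
        tA e = T w (conj R (at A e) (es without e))

        vol≡ : T w ⊤ᵇ ≡ V
        vol≡ = ∑W-1 h w

        nz : ∀ e → NonZero (area w e)
        nz (i , j) = m*n≢0 (mass w i) (mass w j) {{pos i}} {{pos j}}

        instance
          PP≢0 : NonZero PP
          PP≢0 = ∏-pos (area w) es nz

        -- Nothing is assumed on the distribution of `A`: a single edge is counted exactly, by
        -- resampling its two endpoints.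
        base-A : ∀ e → Increasing e → area w e * T w (at A e) ≡ edges w A e * V
        base-A (i , j) i<j = begin
          area w (i , j) * T w (at A (i , j))
            ≡⟨ sym (resample₂ h w i j (λ φ → 𝟙 (at A (i , j) φ))) ⟩
          ∑W h w (λ φ → ∑₂ n n (λ x y → w i x * w j y * 𝟙 (at A (i , j) ((φ [ i ]≔ x) [ j ]≔ y))))
            ≡⟨ ∑W-cong h w (λ φ → ∑₂-cong n n (λ x y → cong (λ c → w i x * w j y * 𝟙 c) (at-ij φ x y))) ⟩
          ∑W h w (λ φ → edges w A (i , j))
            ≡⟨ trans (∑W-cong h w (λ φ → sym (*-identityʳ _))) (∑W-*ˡ h w (edges w A (i , j)) (λ _ → 1)) ⟩
          edges w A (i , j) * ∑W h w (λ _ → 1)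
            ≡⟨ cong (edges w A (i , j) *_) (∑W-1 h w) ⟩
          _ ∎
          where
          open ≡-Reasoning
          at-ij : ∀ φ x y → at A (i , j) ((φ [ i ]≔ x) [ j ]≔ y) ≡ A x y
          at-ij φ x y = cong₂ A (trans (lookup∘updateAt′ i j (Fin.<⇒≢ i<j) (φ [ i ]≔ x)) (lookup∘updateAt i φ))
                                (lookup∘updateAt j (φ [ i ]≔ x))

        -- Only the edges other than `e` are exchanged for densities, with `at A e` in the slot `g`.
        -- The density of `A` at `e` is then compared with that of `R` by `few`, which gains the
        -- factor `2 * q`.
        upper-A : ∀ e → e ∈ es → 2 * q * K * PP * tA e ≤ K * (EE * V) + 2 * q * q * (PP * V)
        upper-A e e∈ = begin
          2 * q * K * PP * tA e
            ≡⟨ cong (λ p → 2 * q * K * p * tA e) (∏-without (area w) u e∈) ⟩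
          2 * q * K * (P * PP') * tA e
            ≡⟨ a1 q K P PP' (tA e) ⟩
          2 * q * P * (K * (PP' * tA e))
            ≤⟨ *-monoʳ-≤ (2 * q * P) (count-upper w K R pos (at A e) es' u' inc' cut' sp) ⟩
          2 * q * P * (K * (EE' * T w (at A e)) + length es' * (PP' * V))
            ≡⟨ a2 q P K EE' (T w (at A e)) (length es') (PP' * V) ⟩
          2 * q * K * EE' * (P * T w (at A e)) + 2 * q * length es' * (P * (PP' * V))
            ≤⟨ +-monoʳ-≤ (2 * q * K * EE' * (P * T w (at A e))) (*-monoˡ-≤ (P * (PP' * V)) (*-monoʳ-≤ (2 * q) len')) ⟩
          2 * q * K * EE' * (P * T w (at A e)) + 2 * q * q * (P * (PP' * V))
            ≡⟨ cong (λ z → 2 * q * K * EE' * z + 2 * q * q * (P * (PP' * V))) (base-A e (All.lookup inc e∈)) ⟩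
          2 * q * K * EE' * (edges w A e * V) + 2 * q * q * (P * (PP' * V))
            ≡⟨ a3 q K EE' (edges w A e) V (2 * q * q * (P * (PP' * V))) ⟩
          K * (2 * q * edges w A e * EE' * V) + 2 * q * q * (P * (PP' * V))
            ≤⟨ +-monoˡ-≤ _ (*-monoʳ-≤ K (*-monoˡ-≤ V (*-monoˡ-≤ EE' (few e e∈)))) ⟩
          K * (edges w R e * EE' * V) + 2 * q * q * (P * (PP' * V))
            ≡⟨ cong₂ (λ a b → K * (a * V) + 2 * q * q * b) (sym (∏-without (edges w R) u e∈))
                 (trans (sym (*-assoc P PP' V)) (cong (_* V) (sym (∏-without (area w) u e∈)))) ⟩
          K * (EE * V) + 2 * q * q * (PP * V) ∎
          where
          open ≤-Reasoning
          P? = λ e' → ¬? (e' ≟ᴱ e)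
          es' = es without e
          P = area w e
          PP' = ∏ (area w) es'
          EE' = ∏ (edges w R) es'
          u' : Unique es'
          u' = Unique.filter⁺ P? u
          inc' : All Increasing es'
          inc' = All.filter⁺ P? inc
          cut' : All (Cut w K R) es'
          cut' = All.filter⁺ P? cut
          len' : length es' ≤ q
          len' = ≤-trans (length-filter P? es) len
          sp : All (λ e' → Splits (proj₁ e') (proj₂ e') (at A e)) es'
          sp = All.zipWith (λ { (ne , i) → splits-at A (apart i (All.lookup inc e∈) (λ z → ne (sym z))) })
                 (All.all-filter P? es , inc')
          a1 : ∀ q k p r t → 2 * q * k * (p * r) * t ≡ 2 * q * p * (k * (r * t))
          a1 = solve-∀
          a2 : ∀ q p k e t l x → 2 * q * p * (k * (e * t) + l * x) ≡ 2 * q * k * e * (p * t) + 2 * q * l * (p * x)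
          a2 = solve-∀
          a3 : ∀ q k e a v y → 2 * q * k * e * (a * v) + y ≡ k * (2 * q * a * e * v) + y
          a3 = solve-∀

        tA-sum : 2 * K * PP * sumList tA es ≤ K * (EE * V) + 2 * q * q * (PP * V)
        tA-sum = *-cancelˡ-≤ q {{>-nonZero 1≤q}} (begin
          q * (2 * K * PP * sumList tA es)      ≡⟨ a1 q K PP (sumList tA es) ⟩
          2 * q * K * PP * sumList tA es        ≡⟨ sym (sumList-*ˡ (2 * q * K * PP) tA es) ⟩
          sumList (λ e → 2 * q * K * PP * tA e) es ≤⟨ sumList-mono es upper-A ⟩
          sumList (λ _ → X) es                  ≡⟨ sumList-const X es ⟩
          length es * X                         ≤⟨ *-monoˡ-≤ X len ⟩
          q * X ∎)
          where
          open ≤-Reasoning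
          X = K * (EE * V) + 2 * q * q * (PP * V)
          a1 : ∀ q k p t → q * (2 * k * p * t) ≡ 2 * q * k * p * t
          a1 = solve-∀

        tR≤ : tR ≤ tB + sumList tA es
        tR≤ = ≤-trans (∑W-mono h w (telescope es))
          (≤-reflexive (trans (∑W-+ h w _ _) (cong (tB +_) (∑W-sumList h w _ es))))

        lower-R : K * (EE * V) ≤ K * (PP * tR) + q * (PP * V)
        lower-R = begin
          K * (EE * V)      ≡⟨ cong (λ z → K * (EE * z)) (sym vol≡) ⟩
          K * (EE * T w ⊤ᵇ) ≤⟨ count-lower w K R pos ⊤ᵇ es u inc cut (All.tabulate (λ {e} _ → splits-true (proj₁ e) (proj₂ e))) ⟩
          K * (PP * tR) + length es * (PP * V) ≤⟨ +-monoʳ-≤ (K * (PP * tR)) (*-monoˡ-≤ (PP * V) len) ⟩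
          _ ∎
          where open ≤-Reasoning

        PP≤EE : PP ≤ D ^ q * EE
        PP≤EE = ≤-trans (go es dense) (*-monoˡ-≤ EE (^-monoʳ-≤ D {{>-nonZero 1≤D}} len))
          where
          a1 : ∀ d e x y → d * e * (x * y) ≡ d * x * (e * y)
          a1 = solve-∀
          go : ∀ es → (∀ e → e ∈ es → area w e ≤ D * edges w R e) →
               ∏ (area w) es ≤ D ^ length es * ∏ (edges w R) es
          go []       d = ≤-refl
          go (e ∷ es) d = ≤-trans (*-mono-≤ (d e (here refl)) (go es (λ e' q' → d e' (there q'))))
            (≤-reflexive (a1 D (edges w R e) (D ^ length es) (∏ (edges w R) es)))

        -- With `X` the main term, the tuples in `R` give at least `X` and the at most `q` sums over
        -- added edges together take away half of it, up to errors. The errors sum to at most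
        -- `2 * q * q * (PP * V)`, which is at most `X / 4` by `K-large` and `PP≤EE`.
        main : K * (EE * V) ≤ 4 * K * PP * tB
        -- Subtracting in ℕ is avoided by adding `3 * X` on both sides: `2 * X` for the half that is
        -- lost and `X` for the errors, after multiplying by four.
        main = +-cancelˡ-≤ (3 * X) _ _ (begin
          3 * X + X                          ≡⟨ a0 X ⟩
          4 * X                              ≤⟨ *-monoʳ-≤ 4 lower-R ⟩
          4 * (K * (PP * tR) + q * (PP * V)) ≤⟨ *-monoʳ-≤ 4 (+-monoˡ-≤ _ (*-monoʳ-≤ K (*-monoʳ-≤ PP tR≤))) ⟩
          4 * (K * (PP * (tB + sA)) + q * (PP * V)) ≡⟨ a1 K PP tB sA (q * (PP * V)) ⟩
          4 * K * PP * tB + 2 * (2 * K * PP * sA) + 4 * (q * (PP * V)) ≤⟨ +-monoˡ-≤ _ (+-monoʳ-≤ (4 * K * PP * tB) (*-monoʳ-≤ 2 tA-sum)) ⟩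
          4 * K * PP * tB + 2 * (X + 2 * q * q * (PP * V)) + 4 * (q * (PP * V)) ≤⟨ +-monoʳ-≤ (4 * K * PP * tB + 2 * (X + 2 * q * q * (PP * V))) (*-monoʳ-≤ 4 (*-monoˡ-≤ (PP * V) q≤q²)) ⟩
          4 * K * PP * tB + 2 * (X + 2 * q * q * (PP * V)) + 4 * (q * q * (PP * V)) ≡⟨ a2 (4 * K * PP * tB) X q (PP * V) ⟩
          2 * X + 8 * (q * q) * (PP * V) + 4 * K * PP * tB ≤⟨ +-monoˡ-≤ _ (+-monoʳ-≤ (2 * X) err) ⟩
          2 * X + X + 4 * K * PP * tB        ≡⟨ a3 X (4 * K * PP * tB) ⟩
          3 * X + 4 * K * PP * tB ∎)
          where
          open ≤-Reasoning
          X = K * (EE * V)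
          sA = sumList tA es
          q≤q² : q ≤ q * q
          q≤q² = m≤m*n q q {{>-nonZero 1≤q}}
          err : 8 * (q * q) * (PP * V) ≤ X
          err = begin
            8 * (q * q) * (PP * V)            ≤⟨ *-monoʳ-≤ (8 * (q * q)) (*-monoˡ-≤ V PP≤EE) ⟩
            8 * (q * q) * (D ^ q * EE * V)    ≡⟨ b1 (8 * (q * q)) (D ^ q) EE V ⟩
            8 * (q * q) * D ^ q * (EE * V)    ≤⟨ *-monoˡ-≤ (EE * V) K-large ⟩
            X ∎
            where
            b1 : ∀ a b c d → a * (b * c * d) ≡ a * b * (c * d)
            b1 = solve-∀
          a0 : ∀ x → 3 * x + x ≡ 4 * x
          a0 = solve-∀
          a1 : ∀ k p b s y → 4 * (k * (p * (b + s)) + y) ≡ 4 * k * p * b + 2 * (2 * k * p * s) + 4 * y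
          a1 = solve-∀
          a2 : ∀ t x q p → t + 2 * (x + 2 * q * q * p) + 4 * (q * q * p) ≡ 2 * x + 8 * (q * q) * p + t
          a2 = solve-∀
          a3 : ∀ x y → 2 * x + x + y ≡ 3 * x + y
          a3 = solve-∀

      -- A product of at most `q` densities, each at least `1 / D`, is at least `1 / D ^ q`; `main`
      -- leaves a quarter of the expected number.
      counting-lemma : vol w ≤ 4 * D ^ q * T w (conj B (λ _ → true) es)
      counting-lemma = *-cancelˡ-≤ (K * PP) {{m*n≢0 K PP {{>-nonZero 1≤K}}}} (begin
        K * PP * V              ≡⟨ a1 K PP V ⟩
        K * V * PP              ≤⟨ *-monoʳ-≤ (K * V) PP≤EE ⟩
        K * V * (D ^ q * EE)    ≡⟨ a2 K V (D ^ q) EE ⟩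
        D ^ q * (K * (EE * V))  ≤⟨ *-monoʳ-≤ (D ^ q) main ⟩
        D ^ q * (4 * K * PP * tB) ≡⟨ a3 (D ^ q) K PP tB ⟩
        K * PP * (4 * D ^ q * tB) ∎)
        where
        open ≤-Reasoning
        1≤K : 1 ≤ K
        1≤K = ≤-trans (*-mono-≤ {1} {8 * (q * q)} (*-mono-≤ {1} {8} (s≤s z≤n) (*-mono-≤ 1≤q 1≤q)) (m^n>0 D {{>-nonZero 1≤D}} q)) K-large
        a1 : ∀ a b c → a * b * c ≡ a * c * b
        a1 = solve-∀
        a2 : ∀ a b c d → a * b * (c * d) ≡ c * (a * (d * b))
        a2 = solve-∀
        a3 : ∀ d k p t → d * (4 * k * p * t) ≡ k * p * (4 * d * t)
        a3 = solve-∀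

-- From homomorphisms to copies

allᵇ-elim : ∀ k {P : Fin k → Bool} → allᵇ k P ≡ true → ∀ i → P i ≡ true
allᵇ-elim (suc k) {P} e i with P zero in p0
allᵇ-elim (suc k) {P} e zero    | true = p0
allᵇ-elim (suc k) {P} e (suc i) | true = allᵇ-elim k e i
allᵇ-elim (suc k) {P} () i      | false

allᵇ-intro : ∀ k {P : Fin k → Bool} → (∀ i → P i ≡ true) → allᵇ k P ≡ true
allᵇ-intro zero    p = refl
allᵇ-intro (suc k) p = cong₂ _∧_ (p zero) (allᵇ-intro k (λ i → p (suc i)))

⌊≟⌋-false : ∀ {k} {i j : Fin k} → i ≢ j → ⌊ i ≟ j ⌋ ≡ false
⌊≟⌋-false {i = i} {j} ne with i ≟ j
... | yes p = ⊥-elim (ne p)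
... | no  _ = refl

isCopyᵇ-complete : ∀ {h n} (H : Graph h) (G : Graph n) φ → IsCopy H G (lookup φ) → isCopyᵇ H G φ ≡ true
isCopyᵇ-complete {h} H G φ (inj , hom) = allᵇ-intro h (λ i → allᵇ-intro h (λ j → cong₂ _∧_ (a i j) (b i j)))
  where
  a : ∀ i j → ⌊ i ≟ j ⌋ ∨ not ⌊ lookup φ i ≟ lookup φ j ⌋ ≡ true
  a i j with i ≟ j
  ... | yes _ = refl
  ... | no  p = cong not (⌊≟⌋-false (λ e → p (inj i j e)))
  b : ∀ i j → not (adj H i j) ∨ adj G (lookup φ i) (lookup φ j) ≡ true
  b i j with adj H i j in e
  ... | false = refl
  ... | true  = hom i j e

isCopyᵇ-sound : ∀ {h n} (H : Graph h) (G : Graph n) φ → isCopyᵇ H G φ ≡ true → IsCopy H G (lookup φ)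
isCopyᵇ-sound {h} H G φ c = (λ i j → injective i j (both i j)) , (λ i j → hom i j (both i j))
  where
  both : ∀ i j → (⌊ i ≟ j ⌋ ∨ not ⌊ lookup φ i ≟ lookup φ j ⌋) ∧ (not (adj H i j) ∨ adj G (lookup φ i) (lookup φ j)) ≡ true
  both i j = allᵇ-elim h (allᵇ-elim h c i) j
  injective : ∀ i j → (⌊ i ≟ j ⌋ ∨ not ⌊ lookup φ i ≟ lookup φ j ⌋) ∧ (not (adj H i j) ∨ adj G (lookup φ i) (lookup φ j)) ≡ true →
    lookup φ i ≡ lookup φ j → i ≡ j
  injective i j p e with i ≟ j
  ... | yes q = q
  ... | no _ with lookup φ i ≟ lookup φ j
  injective i j () e | no _ | yes _
  ... | no ne = ⊥-elim (ne e)
  hom : ∀ i j → (⌊ i ≟ j ⌋ ∨ not ⌊ lookup φ i ≟ lookup φ j ⌋) ∧ (not (adj H i j) ∨ adj G (lookup φ i) (lookup φ j)) ≡ true →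
    adj H i j ≡ true → adj G (lookup φ i) (lookup φ j) ≡ true
  hom i j p e rewrite e with ⌊ i ≟ j ⌋ ∨ not ⌊ lookup φ i ≟ lookup φ j ⌋
  ... | true = p
  hom i j () e | false

unit : ∀ {h n} → Weights h n
unit _ _ = 1

mass-unit : ∀ {h} n (i : Fin h) → mass (unit {h} {n}) i ≡ n
mass-unit n i = trans (∑-const n 1) (*-identityʳ n)

∏mass-unit : ∀ h n → ∏mass h (unit {h} {n}) ≡ n ^ h
∏mass-unit zero    n = refl
∏mass-unit (suc h) n = cong₂ _*_ (mass-unit {suc h} n zero) (∏mass-unit h n)

collide : ∀ {h n} → Fin h → Fin h → Vec (Fin n) h → ℕ
collide i j φ = 𝟙 (not ⌊ i ≟ j ⌋) * 𝟙 ⌊ lookup φ i ≟ lookup φ j ⌋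

-- For `i` different from `j`, exactly one of the `n` values of coordinate `i` agrees with
-- coordinate `j`.
collisions : ∀ h n (i j : Fin h) → n * ∑W h (unit {h} {n}) (collide i j) ≤ n ^ h
collisions h n i j with i ≟ j
... | yes _ = ≤-trans (≤-reflexive (trans (cong (n *_) (∑W-*ˡ h unit 0 (λ _ → 0))) (*-zeroʳ n))) z≤n
... | no i≢j = ≤-reflexive (begin
  n * ∑W h unit F
    ≡⟨ cong (_* ∑W h unit F) (sym (mass-unit n i)) ⟩
  mass (unit {h} {n}) i * ∑W h unit F
    ≡⟨ sym (resample h unit i F) ⟩
  ∑W h unit (λ φ → sumFin n (λ x → 1 * F (φ [ i ]≔ x)))
    ≡⟨ ∑W-cong h unit (λ φ → trans (∑-cong n (λ x → pt φ x)) (∑-δ1 n (lookup φ j))) ⟩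
  ∑W h unit (λ _ → 1)
    ≡⟨ trans (∑W-1 h unit) (∏mass-unit h n) ⟩
  n ^ h ∎)
  where
  open ≡-Reasoning
  F : Vec (Fin n) h → ℕ
  F φ = 1 * 𝟙 ⌊ lookup φ i ≟ lookup φ j ⌋
  pt : ∀ φ x → 1 * F (φ [ i ]≔ x) ≡ 𝟙 ⌊ lookup φ j ≟ x ⌋
  pt φ x = trans (*-identityˡ _) (trans (*-identityˡ _) (cong 𝟙 (trans
    (cong₂ (λ a b → ⌊ a ≟ b ⌋) (lookup∘updateAt i φ) (lookup∘updateAt′ j i (λ e → i≢j (sym e)) φ))
    (⌊≟⌋-sym x (lookup φ j)))))

module _ {h n : ℕ} (H : Graph h) (G : Graph n) (es : List (Edge h))
         (covers : ∀ i j → adj H i j ≡ true → (i , j) ∈ es ⊎ (j , i) ∈ es)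
         (B : Rel n) (B⊆G : ∀ x y → B x y ≡ true → adj G x y ≡ true) where

  private
    ⊤ᵇ : Vec (Fin n) h → Bool
    ⊤ᵇ _ = true

  -- `conj` does not ask for injectivity; a tuple that fails it is paid for by two coordinates that
  -- collide.
  hom≤copy+collisions : ∀ φ → 𝟙 (conj B ⊤ᵇ es φ) ≤ 𝟙 (isCopyᵇ H G φ) + ∑₂ h h (λ i j → collide i j φ)
  hom≤copy+collisions φ with conj B ⊤ᵇ es φ in c
  ... | false = z≤n
  ... | true with ∑₂ h h (λ i j → collide i j φ) in e
  ...   | suc k = ≤-trans (s≤s z≤n) (m≤n+m (suc k) _)
  ...   | zero  = ≤-trans (≤-reflexive (cong 𝟙 (sym (isCopyᵇ-complete H G φ (injective , hom))))) (m≤m+n _ 0)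
    where
    injective : ∀ i j → lookup φ i ≡ lookup φ j → i ≡ j
    injective i j p with i ≟ j in q
    ... | yes r = r
    ... | no  r = ⊥-elim (1+n≰n (begin
      1             ≡⟨ sym (cong₂ (λ a b → 𝟙 (not a) * 𝟙 b) (cong ⌊_⌋ q) (trans (cong (λ z → ⌊ lookup φ i ≟ z ⌋) (sym p)) (⌊≟⌋-refl (lookup φ i)))) ⟩
      collide i j φ ≤⟨ ∑₂-term h h (λ i j → collide i j φ) i j ⟩
      _             ≡⟨ e ⟩
      0             ∎))
      where open ≤-Reasoning
    hom : ∀ i j → adj H i j ≡ true → adj G (lookup φ i) (lookup φ j) ≡ true
    hom i j a with covers i j a
    ... | inj₁ p = B⊆G _ _ (conj-∈ B ⊤ᵇ es φ c p)
    ... | inj₂ p = trans (Graph.sym G _ _) (B⊆G _ _ (conj-∈ B ⊤ᵇ es φ c p))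

  homs≤ : n * T unit (conj B ⊤ᵇ es) ≤ n * copies H G + h * h * n ^ h
  homs≤ = begin
    n * T unit (conj B ⊤ᵇ es)
      ≤⟨ *-monoʳ-≤ n (∑W-mono h unit hom≤copy+collisions) ⟩
    n * ∑W h unit (λ φ → 𝟙 (isCopyᵇ H G φ) + ∑₂ h h (λ i j → collide i j φ))
      ≡⟨ cong (n *_) (∑W-+ h unit _ _) ⟩
    n * (∑W h unit (λ φ → 𝟙 (isCopyᵇ H G φ)) + ∑W h unit (λ φ → ∑₂ h h (λ i j → collide i j φ)))
      ≡⟨ cong₂ (λ a b → n * (a + b)) (sym (copies≡∑W H G))
           (trans (∑W-∑ h unit h _) (∑-cong h (λ i → ∑W-∑ h unit h _))) ⟩
    n * (copies H G + ∑₂ h h (λ i j → ∑W h unit (collide i j)))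
      ≡⟨ trans (*-distribˡ-+ n (copies H G) _) (cong (n * copies H G +_) (sym (∑₂-*ˡ h h n (λ i j → ∑W h unit (collide i j))))) ⟩
    n * copies H G + ∑₂ h h (λ i j → n * ∑W h unit (collide i j))
      ≤⟨ +-monoʳ-≤ (n * copies H G) (∑₂-mono h h (collisions h n)) ⟩
    n * copies H G + ∑₂ h h (λ _ _ → n ^ h)
      ≡⟨ cong (n * copies H G +_) (trans (∑₂-const h h (n ^ h)) (sym (*-assoc h h (n ^ h)))) ⟩
    _ ∎
    where open ≤-Reasoning

  -- If `n` is at least `2 * Z * (h * h)`, the collisions are at most half of the guaranteed
  -- `n ^ h / Z` tuples. If `n` is smaller, then `n ^ h` is bounded and the single copy assumed in
  -- `1 ≤ copies H G` is enough.
  homs⇒copies : ∀ Z → 1 ≤ Z → 1 ≤ h → 1 ≤ n → 1 ≤ copies H G →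
    n ^ h ≤ Z * T unit (conj B ⊤ᵇ es) → n ^ h ≤ (2 * Z * (h * h)) ^ h * copies H G
  homs⇒copies Z 1≤Z 1≤h 1≤n 1≤c many with 2 * Z * (h * h) ≤? n
  ... | no  small = ≤-trans (^-monoˡ-≤ h (<⇒≤ (≰⇒> small))) (m≤m*n _ (copies H G) {{>-nonZero 1≤c}})
  ... | yes large = *-cancelˡ-≤ n {{>-nonZero 1≤n}} (+-cancelˡ-≤ (n * n ^ h) _ _ (begin
    n * n ^ h + n * n ^ h                 ≡⟨ a1 n (n ^ h) ⟩
    2 * n * n ^ h                         ≤⟨ *-monoʳ-≤ (2 * n) many ⟩
    2 * n * (Z * t)                       ≡⟨ a2 n Z t ⟩
    2 * Z * (n * t)                       ≤⟨ *-monoʳ-≤ (2 * Z) homs≤ ⟩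
    2 * Z * (n * c + h * h * n ^ h)       ≡⟨ a3 Z n c (h * h) (n ^ h) ⟩
    2 * Z * (h * h) * n ^ h + n * (2 * Z * c) ≤⟨ +-mono-≤ (*-monoˡ-≤ (n ^ h) large) (*-monoʳ-≤ n (*-monoˡ-≤ c big)) ⟩
    n * n ^ h + n * ((2 * Z * (h * h)) ^ h * c) ∎))
    where
    open ≤-Reasoning
    t = T unit (conj B ⊤ᵇ es)
    c = copies H G
    1≤q : 1 ≤ h * h
    1≤q = *-mono-≤ 1≤h 1≤h
    W = 2 * Z * (h * h)
    1≤W : 1 ≤ W
    1≤W = *-mono-≤ {1} {2 * Z} (*-mono-≤ {1} {2} (s≤s z≤n) 1≤Z) 1≤q
    big : 2 * Z ≤ W ^ h
    big = ≤-trans (m≤m*n (2 * Z) (h * h) {{>-nonZero 1≤q}})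
      (≤-trans (≤-reflexive (sym (*-identityʳ W))) (^-monoʳ-≤ W {{>-nonZero 1≤W}} 1≤h))
    a1 : ∀ n x → n * x + n * x ≡ 2 * n * x
    a1 = solve-∀
    a2 : ∀ n z t → 2 * n * (z * t) ≡ 2 * z * (n * t)
    a2 = solve-∀
    a3 : ∀ z n c q x → 2 * z * (n * c + q * x) ≡ 2 * z * q * x + n * (2 * z * c)
    a3 = solve-∀

bool-ext : ∀ {a b} → (a ≡ true → b ≡ true) → (b ≡ true → a ≡ true) → a ≡ b
bool-ext {true}  {b}     f g = sym (f refl)
bool-ext {false} {true}  f g = g refl
bool-ext {false} {false} f g = refl

∧-true : ∀ {a b} → a ∧ b ≡ true → a ≡ true × b ≡ true
∧-true {true} e = refl , e

∧-intro : ∀ {a b} → a ≡ true → b ≡ true → a ∧ b ≡ true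
∧-intro refl refl = refl

¬-true : ∀ {a} → ¬ (a ≡ true) → a ≡ false
¬-true {true}  f = ⊥-elim (f refl)
¬-true {false} f = refl

allᵇ-false : ∀ k {P : Fin k → Bool} → allᵇ k P ≡ false → ∃ λ i → P i ≡ false
allᵇ-false (suc k) {P} e with P zero in p
... | false = zero , p
... | true with allᵇ-false k e
...   | i , q = suc i , q

𝟙-¬allᵇ : ∀ k (P : Fin k → Bool) → 𝟙 (not (allᵇ k P)) ≤ sumFin k (λ i → 𝟙 (not (P i)))
𝟙-¬allᵇ zero    P = z≤n
𝟙-¬allᵇ (suc k) P with P zero
... | true  = 𝟙-¬allᵇ k (λ i → P (suc i))
... | false = s≤s z≤n

-- Packing edge-disjoint copies

_∖ᴳ_ : ∀ {n} → Graph n → Graph n → Graph n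
adj    (G ∖ᴳ G') u v = adj G u v ∧ not (adj G' u v)
Graph.sym (G ∖ᴳ G') u v = cong₂ (λ a b → a ∧ not b) (Graph.sym G u v) (Graph.sym G' u v)
irrefl (G ∖ᴳ G') u = cong (_∧ not (adj G' u u)) (irrefl G u)

#E : ∀ {n} → Graph n → ℕ
#E {n} G = ∑₂ n n (λ u v → 𝟙 (adj G u v))

∈-allVecs : ∀ {h n} (φ : Vec (Fin n) h) → φ ∈ allVecs h n
∈-allVecs []       = here refl
∈-allVecs (x ∷ xs) = ∈-concatMap⁺ _ (Any.map (λ { refl → ∈-map⁺ (_∷ _) (∈-allFin x) }) (∈-allVecs xs))

module _ {h n : ℕ} (H : Graph h) where

  -- Both orders of every edge of `H` are tested, which makes the relation symmetric and
  -- `removeCopy` a graph.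
  misses : Vec (Fin n) h → Rel n
  misses φ u v = allᵇ h λ i → allᵇ h λ j → not (adj H i j ∧ (⌊ lookup φ i ≟ u ⌋ ∧ ⌊ lookup φ j ≟ v ⌋))

  misses-edge : ∀ φ {i j} → adj H i j ≡ true → misses φ (lookup φ i) (lookup φ j) ≡ false
  misses-edge φ {i} {j} a = ¬-true λ m → true≢false (trans (sym (allᵇ-elim h (allᵇ-elim h m i) j))
      (cong₂ (λ x y → not (x ∧ y)) a (cong₂ _∧_ (⌊≟⌋-refl (lookup φ i)) (⌊≟⌋-refl (lookup φ j)))))

  misses-sym⇒ : ∀ φ u v → misses φ u v ≡ true → misses φ v u ≡ true
  misses-sym⇒ φ u v m = allᵇ-intro h λ i → allᵇ-intro h λ j → trans
    (cong not (cong₂ _∧_ (Graph.sym H i j) (∧-comm ⌊ lookup φ i ≟ v ⌋ _)))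
    (allᵇ-elim h (allᵇ-elim h m j) i)

  removeCopy : Graph n → Vec (Fin n) h → Graph n
  adj       (removeCopy G φ) u v = adj G u v ∧ misses φ u v
  Graph.sym (removeCopy G φ) u v = cong₂ _∧_ (Graph.sym G u v) (bool-ext (misses-sym⇒ φ u v) (misses-sym⇒ φ v u))
  irrefl    (removeCopy G φ) u = cong (_∧ misses φ u u) (irrefl G u)

  -- Each ordered pair `(i , j)` accounts for at most one pair of vertices, the images of `i` and
  -- `j`.
  hits≤ : ∀ φ → ∑₂ n n (λ u v → 𝟙 (not (misses φ u v))) ≤ h * h
  hits≤ φ = begin
    ∑₂ n n (λ u v → 𝟙 (not (misses φ u v)))
      ≤⟨ ∑₂-mono n n (λ u v → ≤-trans (𝟙-¬allᵇ h _) (∑-mono h (λ i → ≤-trans (𝟙-¬allᵇ h _) (∑-mono h (λ j → pt u v i j))))) ⟩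
    ∑₂ n n (λ u v → ∑₂ h h (λ i j → a i u * a j v))
      ≡⟨ ∑-cong n (λ u → trans (∑-swap n h _) (∑-cong h (λ i → ∑-swap n h _))) ⟩
    sumFin n (λ u → ∑₂ h h (λ i j → sumFin n (λ v → a i u * a j v)))
      ≡⟨ trans (∑-swap n h _) (∑-cong h (λ i → ∑-swap n h _)) ⟩
    ∑₂ h h (λ i j → ∑₂ n n (λ u v → a i u * a j v))
      ≡⟨ ∑₂-cong h h (λ i j → trans (∑₂-prod n n (a i) (a j)) (cong₂ _*_ (∑-δ1 n (lookup φ i)) (∑-δ1 n (lookup φ j)))) ⟩
    ∑₂ h h (λ _ _ → 1)
      ≡⟨ trans (∑₂-const h h 1) (cong (h *_) (*-identityʳ h)) ⟩
    h * h ∎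
    where
    open ≤-Reasoning
    a : Fin h → Fin n → ℕ
    a i u = 𝟙 ⌊ lookup φ i ≟ u ⌋
    pt : ∀ u v i j → 𝟙 (not (not (adj H i j ∧ (⌊ lookup φ i ≟ u ⌋ ∧ ⌊ lookup φ j ≟ v ⌋)))) ≤ a i u * a j v
    pt u v i j with adj H i j
    ... | false = z≤n
    ... | true with ⌊ lookup φ i ≟ u ⌋ | ⌊ lookup φ j ≟ v ⌋
    ...   | true  | true  = ≤-refl
    ...   | true  | false = z≤n
    ...   | false | _     = z≤n

  -- A single pass over all tuples suffices for a greedy packing: deleting edges creates no copy, so
  -- a tuple once treated need not be revisited.
  strip : List (Vec (Fin n) h) → Graph n → Graph n
  strip []      G = G
  strip (φ ∷ l) G = strip l (if isCopyᵇ H G φ then removeCopy G φ else G)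

  removeCopy-⊆ : ∀ G φ → SubgraphOf (removeCopy G φ) G
  removeCopy-⊆ G φ u v e = proj₁ (∧-true e)

  strip-⊆ : ∀ l G → SubgraphOf (strip l G) G
  strip-⊆ []      G u v e = e
  strip-⊆ (φ ∷ l) G u v e with isCopyᵇ H G φ
  ... | true  = removeCopy-⊆ G φ u v (strip-⊆ l (removeCopy G φ) u v e)
  ... | false = strip-⊆ l G u v e

  isCopy-⊆ : ∀ {G G' : Graph n} {f : Fin h → Fin n} → SubgraphOf G' G → IsCopy H G' f → IsCopy H G f
  isCopy-⊆ s (inj , hom) = inj , λ i j a → s _ _ (hom i j a)

  module _ (i₀ j₀ : Fin h) (edge₀ : adj H i₀ j₀ ≡ true) where

    -- A tuple that is a copy when its turn comes loses the image of the edge `i₀ j₀`; any other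
    -- tuple cannot become a copy in a subgraph. If `H` had no edge, removing a copy would delete
    -- nothing.
    strip-free : ∀ l G φ → φ ∈ l → ¬ IsCopy H (strip l G) (lookup φ)
    strip-free (φ ∷ l) G φ (here refl) c with isCopyᵇ H G φ in e
    ... | true  = true≢false (trans (sym (proj₂ (∧-true (proj₂ c' i₀ j₀ edge₀)))) (misses-edge φ edge₀))
      where
      c' : IsCopy H (removeCopy G φ) (lookup φ)
      c' = isCopy-⊆ {G = removeCopy G φ} {G' = strip l (removeCopy G φ)} (strip-⊆ l (removeCopy G φ)) c
    ... | false = true≢false (trans (sym (isCopyᵇ-complete H G φ (isCopy-⊆ {G = G} {G' = strip l G} (strip-⊆ l G) c))) e)
    strip-free (φ' ∷ l) G φ (there p) c = strip-free l _ φ p c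

    strip-HFree : ∀ G → HFree H (strip (allVecs h n) G)
    strip-HFree G (f , inj , hom) = strip-free (allVecs h n) G (tabulate f) (∈-allVecs (tabulate f))
      ( (λ i j e → inj i j (trans (sym (lookup∘tabulate f i)) (trans e (lookup∘tabulate f j))))
      , (λ i j a → trans (cong₂ (adj (strip (allVecs h n) G)) (lookup∘tabulate f i) (lookup∘tabulate f j)) (hom i j a)))

  CleanCopy : Graph n → Rel n → Set
  CleanCopy G κ = ∃ λ φ → IsCopy H G (lookup φ) ×
    (∀ i j → adj H i j ≡ true → κ (lookup φ i) (lookup φ j) ≡ false)

  -- The copies removed by strip are edge-disjoint, so if κ meets all of them it has
  -- at least one edge in each, i.e. a 1/h² fraction of the removed edges.
  strip-dichotomy : ∀ (κ : Rel n) l G → CleanCopy (G ∖ᴳ strip l G) κ ⊎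
    #E (G ∖ᴳ strip l G) ≤ h * h * ∑₂ n n (λ u v → 𝟙 (adj (G ∖ᴳ strip l G) u v ∧ κ u v))
  strip-dichotomy κ []      G = inj₂ (≤-trans (≤-reflexive (trans (∑₂-cong n n (λ u v → none (adj G u v)))
      (trans (∑₂-const n n 0) (trans (cong (n *_) (*-zeroʳ n)) (*-zeroʳ n))))) z≤n)
    where
    none : ∀ a → 𝟙 (a ∧ not a) ≡ 0
    none true  = refl
    none false = refl
  strip-dichotomy κ (φ ∷ l) G with isCopyᵇ H G φ in c
  ... | false = strip-dichotomy κ l G
  ... | true  = result
    where
    G' = removeCopy G φ
    G* = strip l G'
    G*⊆G' : SubgraphOf G* G'
    G*⊆G' = strip-⊆ l G'
    κ-avoids : Bool
    κ-avoids = allᵇ h λ i → allᵇ h λ j → not (adj H i j ∧ κ (lookup φ i) (lookup φ j))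
    copy-in-G : IsCopy H G (lookup φ)
    copy-in-G = isCopyᵇ-sound H G φ c
    removed : ∀ {i j} → adj H i j ≡ true → adj G* (lookup φ i) (lookup φ j) ≡ false
    removed a = ¬-true λ e → true≢false (trans (sym (proj₂ (∧-true (G*⊆G' _ _ e)))) (misses-edge φ a))
    clean : κ-avoids ≡ true → CleanCopy (G ∖ᴳ G*) κ
    clean av = φ , (proj₁ copy-in-G , λ i j a → cong₂ (λ x y → x ∧ not y) (proj₂ copy-in-G i j a) (removed a)) , λ i j a → κ≡ i j a
      where
      κ≡ : ∀ i j → adj H i j ≡ true → κ (lookup φ i) (lookup φ j) ≡ false
      κ≡ i j a = not-true (trans (sym (cong (λ z → not (z ∧ κ (lookup φ i) (lookup φ j))) a)) (allᵇ-elim h (allᵇ-elim h av i) j))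
    grow : CleanCopy (G' ∖ᴳ G*) κ → CleanCopy (G ∖ᴳ G*) κ
    grow (ψ , cp , cl) = ψ , isCopy-⊆ {G = G ∖ᴳ G*} {G' = G' ∖ᴳ G*}
      (λ u v e → ∧-intro (proj₁ (∧-true (proj₁ (∧-true e)))) (proj₂ (∧-true {adj G' u v} e))) cp , cl
    kill : ∀ i j → not (adj H i j ∧ κ (lookup φ i) (lookup φ j)) ≡ false →
      1 ≤ ∑₂ n n (λ u v → 𝟙 ((adj G u v ∧ not (misses φ u v)) ∧ κ u v))
    kill i j e = ≤-trans
      (≤-reflexive (cong 𝟙 (sym (∧-intro (∧-intro (proj₂ copy-in-G i j a) (cong not (misses-edge φ a))) k))))
      (∑₂-term n n _ (lookup φ i) (lookup φ j))
      where
      a = proj₁ (∧-true {adj H i j} (not-false e))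
      k = proj₂ (∧-true {adj H i j} (not-false e))
    result : CleanCopy (G ∖ᴳ G*) κ ⊎
      #E (G ∖ᴳ G*) ≤ h * h * ∑₂ n n (λ u v → 𝟙 (adj (G ∖ᴳ G*) u v ∧ κ u v))
    result with κ-avoids in av
    ... | true  = inj₁ (clean av)
    ... | false with strip-dichotomy κ l G'
    ...   | inj₁ p = inj₁ (grow p)
    ...   | inj₂ p with allᵇ-false h av
    ...     | i , e with allᵇ-false h e
    ...       | j , e' = inj₂ (begin
      #E (G ∖ᴳ G*)
        ≤⟨ ∑₂-mono n n (λ u v → split (adj G u v) (misses φ u v) (adj G* u v)) ⟩
      ∑₂ n n (λ u v → 𝟙 (adj (G' ∖ᴳ G*) u v) + 𝟙 (not (misses φ u v)))
        ≡⟨ ∑₂-+ n n _ _ ⟩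
      #E (G' ∖ᴳ G*) + ∑₂ n n (λ u v → 𝟙 (not (misses φ u v)))
        ≤⟨ +-mono-≤ p (≤-trans (hits≤ φ) (≤-trans (≤-reflexive (sym (*-identityʳ (h * h)))) (*-monoʳ-≤ (h * h) (kill i j e')))) ⟩
      h * h * ∑₂ n n old + h * h * ∑₂ n n new
        ≡⟨ trans (sym (*-distribˡ-+ (h * h) (∑₂ n n old) (∑₂ n n new))) (cong (h * h *_) (sym (∑₂-+ n n old new))) ⟩
      h * h * ∑₂ n n (λ u v → old u v + new u v)
        ≤⟨ *-monoʳ-≤ (h * h) (∑₂-mono n n (λ u v → merge (adj G u v) (misses φ u v) (adj G* u v) (κ u v) (λ q → proj₂ (∧-true {adj G u v} (G*⊆G' u v q))))) ⟩
      h * h * ∑₂ n n (λ u v → 𝟙 (adj (G ∖ᴳ G*) u v ∧ κ u v)) ∎)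
      where
      open ≤-Reasoning
      old new : Fin n → Fin n → ℕ
      old u v = 𝟙 (adj (G' ∖ᴳ G*) u v ∧ κ u v)
      new u v = 𝟙 ((adj G u v ∧ not (misses φ u v)) ∧ κ u v)
      split : ∀ g m s → 𝟙 (g ∧ not s) ≤ 𝟙 ((g ∧ m) ∧ not s) + 𝟙 (not m)
      split false m     s     = z≤n
      split true  true  s     = m≤m+n _ _
      split true  false true  = z≤n
      split true  false false = ≤-refl
      -- Old and new pairs are told apart by `misses φ`. The new ones are also outside `G*`, because
      -- `G*` is contained in `G'`.
      merge : ∀ g m s k → (s ≡ true → m ≡ true) →
        𝟙 (((g ∧ m) ∧ not s) ∧ k) + 𝟙 ((g ∧ not m) ∧ k) ≤ 𝟙 ((g ∧ not s) ∧ k)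
      merge false m     s     k     f = z≤n
      merge true  true  s     k     f = ≤-reflexive (+-identityʳ _)
      merge true  false false k     f = ≤-refl
      merge true  false true  k     f with f refl
      ... | ()

-- Equipartitions and regular pairs

∣tabulate∣ : ∀ n (f : Fin n → Bool) → ∣ tabulate f ∣ ≡ sumFin n (λ v → 𝟙 (f v))
∣tabulate∣ zero    f = refl
∣tabulate∣ (suc n) f with f zero
... | true  = cong suc (∣tabulate∣ n (λ v → f (suc v)))
... | false = ∣tabulate∣ n (λ v → f (suc v))

eG-tabulate : ∀ {n} (G : Graph n) (a b : Fin n → Bool) →
  eG G (tabulate a) (tabulate b) ≡ ∑₂ n n (λ u v → 𝟙 (a u) * 𝟙 (b v) * 𝟙 (adj G u v))
eG-tabulate {n} G a b = ∑-cong n (λ u → trans (count≡∑ n _) (∑-cong n (λ v → pt u v)))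
  where
  pt : ∀ u v → 𝟙 (lookup (tabulate a) u ∧ (lookup (tabulate b) v ∧ adj G u v)) ≡ 𝟙 (a u) * 𝟙 (b v) * 𝟙 (adj G u v)
  pt u v rewrite lookup∘tabulate a u | lookup∘tabulate b v =
    trans (𝟙-∧ (a u) _) (trans (cong (𝟙 (a u) *_) (𝟙-∧ (b v) _)) (sym (*-assoc (𝟙 (a u)) _ _)))

eG-full : ∀ {n} (G : Graph n) → eG G (fullSet n) (fullSet n) ≡ #E G
eG-full {n} G = ∑-cong n (λ u → trans (count≡∑ n _) (∑-cong n (λ v → pt u v)))
  where
  pt : ∀ u v → 𝟙 (lookup (fullSet n) u ∧ (lookup (fullSet n) v ∧ adj G u v)) ≡ 𝟙 (adj G u v)
  pt u v rewrite lookup-replicate u true | lookup-replicate v true = refl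

diff# : ∀ {n} → Graph n → Graph n → ℕ
diff# {n} G G' = ∑₂ n n (λ u v → 𝟙 (diffᵇ (adj G u v) (adj G' u v)))

editDist≡ : ∀ {n} (G G' : Graph n) → editDist G G' ≡ ratio (diff# G G') 2
editDist≡ {n} G G' = cong (λ x → ratio x 2) (∑-cong n (λ u → count≡∑ n _))

size : ∀ {n k} → (Fin n → Fin k) → Fin k → ℕ
size {n} f i = sumFin n (λ v → 𝟙 ⌊ f v ≟ i ⌋)

∣Part∣ : ∀ {n k} (P : Partition n k) i → ∣ Part P i ∣ ≡ size (part P) i
∣Part∣ {n} P i = ∣tabulate∣ n (λ v → ⌊ part P v ≟ i ⌋)

∑-size : ∀ {n k} (f : Fin n → Fin k) → sumFin k (size f) ≡ n
∑-size {n} {k} f = trans (∑-swap k n _) (trans (∑-cong n (λ v → ∑-δ1 k (f v))) (trans (∑-const n 1) (*-identityʳ n)))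

argmin : ∀ k (g : Fin (suc k) → ℕ) → ∃ λ i → ∀ j → g i ≤ g j
argmin zero    g = zero , λ { zero → ≤-refl }
argmin (suc k) g with argmin k (λ i → g (suc i))
... | i , min with g zero ≤? g (suc i)
...   | yes p = zero  , λ { zero → ≤-refl ; (suc j) → ≤-trans p (min j) }
...   | no  p = suc i , λ { zero → <⇒≤ (≰⇒> p) ; (suc j) → min j }

-- Each further vertex joins a smallest part.
balanced : ∀ n k → ∃ λ (f : Fin n → Fin (suc k)) → ∀ i j → size f i ≤ size f j + 1
balanced zero    k = (λ ()) , λ _ _ → z≤n
balanced (suc n) k with balanced n k
... | f , bal with argmin k (size f)
...   | i₀ , min = f' , bal'
  where
  f' : Fin (suc n) → Fin (suc k)
  f' zero    = i₀
  f' (suc v) = f v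
  bal' : ∀ i j → size f' i ≤ size f' j + 1
  bal' i j with i₀ ≟ i
  ... | yes refl = ≤-trans (≤-reflexive (+-comm 1 (size f i))) (+-monoˡ-≤ 1 (≤-trans (min j) (m≤n+m _ _)))
  ... | no  _    = ≤-trans (bal i j) (+-monoˡ-≤ 1 (m≤n+m _ (𝟙 ⌊ i₀ ≟ j ⌋)))

equipartition : ∀ n k → suc k ≤ n → Σ (Partition n (suc k)) IsEquipartition
equipartition n k k<n with balanced n k
... | f , bal = P , λ i j → subst₂ (λ a b → a ≤ b + 1) (sym (∣Part∣ P i)) (sym (∣Part∣ P j)) (bal i j)
  where
  positive : ∀ i → 1 ≤ size f i
  positive i with size f i in e
  ... | suc _ = s≤s z≤n
  -- An empty part `i` bounds all other parts by one. Adding the indicator of `i` makes the bound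
  -- one in every place, so `n + 1` would be at most `suc k`.
  ... | zero  = ⊥-elim (<⇒≱ (s≤s k<n) (begin
    suc n                                           ≡⟨ +-comm 1 n ⟩
    n + 1                                           ≡⟨ sym (cong₂ _+_ (∑-size f) (∑-δ1 (suc k) i)) ⟩
    sumFin (suc k) (size f) + sumFin (suc k) (λ j → 𝟙 ⌊ i ≟ j ⌋) ≡⟨ sym (∑-+ (suc k) (size f) (λ j → 𝟙 ⌊ i ≟ j ⌋)) ⟩
    sumFin (suc k) (λ j → size f j + 𝟙 ⌊ i ≟ j ⌋)   ≤⟨ ∑-bound (suc k) 1 pt ⟩
    suc k * 1                                       ≡⟨ *-identityʳ (suc k) ⟩
    suc k                                           ∎))
    where
    open ≤-Reasoning
    pt : ∀ j → size f j + 𝟙 ⌊ i ≟ j ⌋ ≤ 1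
    pt j with i ≟ j
    ... | yes refl = ≤-reflexive (cong (_+ 1) e)
    ... | no  _    = ≤-trans (≤-reflexive (+-identityʳ _)) (≤-trans (bal j i) (≤-reflexive (cong (_+ 1) e)))
  P : Partition n (suc k)
  part P = f
  nonempty P i with ∑-zero⇒ n (λ v → 𝟙 ⌊ f v ≟ i ⌋) (positive i)
  ... | v , p = v , hit p
    where
    hit : 1 ≤ 𝟙 ⌊ f v ≟ i ⌋ → f v ≡ i
    hit p with f v ≟ i
    ... | yes e = e
    hit () | no _

-- Representatives of different parts of `P` lie in different parts of `Q`.
refines⇒≤ : ∀ {n k l} (Q : Partition n l) (P : Partition n k) → Refines Q P → k ≤ l
refines⇒≤ Q P r = Fin.injective⇒≤ {f = λ i → part Q (proj₁ (nonempty P i))}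
  (λ {i} {j} e → trans (sym (proj₂ (nonempty P i))) (trans (r _ _ e) (proj₂ (nonempty P j))))

complete : ∀ k → Graph k
adj       (complete k) u v = not ⌊ u ≟ v ⌋
Graph.sym (complete k) u v = cong not (⌊≟⌋-sym u v)
irrefl    (complete k) u   = cong not (⌊≟⌋-refl u)

#E-complete : ∀ k → #E (complete k) + k ≡ k * k
#E-complete k = begin
  #E (complete k) + k
    ≡⟨ cong (#E (complete k) +_) (sym (trans (∑-cong k (∑-δ1 k)) (trans (∑-const k 1) (*-identityʳ k)))) ⟩
  #E (complete k) + ∑₂ k k (λ u v → 𝟙 ⌊ u ≟ v ⌋)
    ≡⟨ sym (∑₂-+ k k _ _) ⟩
  ∑₂ k k (λ u v → 𝟙 (not ⌊ u ≟ v ⌋) + 𝟙 ⌊ u ≟ v ⌋)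
    ≡⟨ ∑₂-cong k k (λ u v → one ⌊ u ≟ v ⌋) ⟩
  ∑₂ k k (λ _ _ → 1)
    ≡⟨ trans (∑₂-const k k 1) (cong (k *_) (*-identityʳ k)) ⟩
  k * k ∎
  where
  open ≡-Reasoning
  one : ∀ b → 𝟙 (not b) + 𝟙 b ≡ 1
  one true  = refl
  one false = refl

discrete : ∀ k → Partition k k
part     (discrete k) v = v
nonempty (discrete k) i = i , refl

discrete-equi : ∀ k → IsEquipartition (discrete k)
discrete-equi k i j = ≤-trans (≤-reflexive (one i)) (m≤n+m 1 _)
  where
  one : ∀ i → ∣ Part (discrete k) i ∣ ≡ 1
  one i = trans (∣Part∣ (discrete k) i) (trans (∑-cong k (λ v → cong 𝟙 (⌊≟⌋-sym v i))) (∑-δ1 k i))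

-- What the hypothesis on `S` provides

module _ (m : ℕ) (ε : ℚ) (0≤ε : 0ℚ ℚ.≤ ε) (mε≤1 : ⟦ m ⟧ ℚ.* ε ℚ.≤ 1ℚ) (2≤m : 2 ≤ m) (C : ℕ) (2≤C : 2 ≤ C)
         (Δ : ℕ) .{{_ : NonZero Δ}} (S : ℕ) (sp : SProp (ε ^ℚ C) (ratio 1 Δ) ε S) where

  private
    η = ε ^ℚ C
    1≤m = ≤-trans (n≤1+n 1) 2≤m

    0≤η : 0ℚ ℚ.≤ η
    0≤η = ^ℚ-nonNeg 0≤ε C

    Kη≤1 : ⟦ m ^ C ⟧ ℚ.* η ℚ.≤ 1ℚ
    Kη≤1 = power-bound 0≤ε mε≤1 C

    order : ⟦ m * m ⟧ ℚ.* η ℚ.≤ 1ℚ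
    order = ℚ.≤-trans (ℚ.*-monoʳ-≤-nonNeg η {{ℚ.nonNegative 0≤η}} (⟦⟧-mono (begin
      m * m ≡⟨ cong (m *_) (sym (*-identityʳ m)) ⟩
      m ^ 2 ≤⟨ ^-monoʳ-≤ m {{>-nonZero 1≤m}} 2≤C ⟩
      m ^ C ∎))) Kη≤1
      where open ≤-Reasoning

    density≥ : ∀ n (G : Graph n) → 1 ≤ n → n * n ≤ m * #E G → ε ℚ.≤ density G
    density≥ n G 1≤n p = ℚ.≤-trans
      (many⇒dense m ε (n * n) {{>-nonZero (*-mono-≤ 1≤n 1≤n)}} (#E G) mε≤1 0≤ε p)
      (ℚ.≤-reflexive (cong (λ x → ratio x (n * n)) (sym (eG-full G))))

  -- The complete graph on `m * m` vertices, split into singletons, is an admissible input of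
  -- `SProp`, and a refinement has at least as many parts. The bound lets factors that depend on `ε`
  -- or `h` be absorbed into powers of `S`.
  m²≤S : m * m ≤ S
  m²≤S = conclude (sp k (complete k) (density≥ k (complete k) 1≤k many) k (discrete k) (discrete-equi k) order)
    where
    k = m * m
    1≤k : 1 ≤ k
    1≤k = *-mono-≤ 1≤m 1≤m
    2k≤k² : 2 * k ≤ k * k
    2k≤k² = *-monoˡ-≤ k (≤-trans 2≤m (m≤m*n m m {{>-nonZero 1≤m}}))
    many : k * k ≤ m * #E (complete k)
    many = ≤-trans (+-cancelʳ-≤ (2 * k) (k * k) (2 * #E (complete k)) (begin
      k * k + 2 * k                   ≤⟨ +-monoʳ-≤ (k * k) 2k≤k² ⟩
      k * k + k * k                   ≡⟨ cong (k * k +_) (sym (+-identityʳ (k * k))) ⟩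
      2 * (k * k)                     ≡⟨ cong (2 *_) (sym (#E-complete k)) ⟩
      2 * (#E (complete k) + k)       ≡⟨ *-distribˡ-+ 2 (#E (complete k)) k ⟩
      2 * #E (complete k) + 2 * k     ∎)) (*-monoˡ-≤ (#E (complete k)) 2≤m)
      where open ≤-Reasoning
    conclude : (Σ (Graph k) λ G' → editDist (complete k) G' ℚ.≤ ratio 1 Δ ℚ.* numEdges (complete k) ×
                 Σ ℕ λ l → l ≤ S × Σ (Partition k l) λ Q → Refines Q (discrete k) × IsRegularPartition η G' Q) →
               k ≤ S
    conclude (_ , _ , l , l≤S , Q , r , _) = ≤-trans (refines⇒≤ Q (discrete k) r) l≤S

  -- The outcome of `SProp` with denominators cleared; only the regularity of pairs stays rational,
  -- until `regular⇒cut`.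
  record Regularized {n : ℕ} (G : Graph n) : Set where
    field
      G'       : Graph n
      edits    : Δ * diff# G G' ≤ #E G
      l        : ℕ
      l≤S      : l ≤ S
      m²≤l     : m * m ≤ l
      π        : Fin n → Fin l
      occupied : ∀ i → 1 ≤ size π i
      equi     : ∀ i j → size π i ≤ size π j + 1
      bad      : Fin l → Fin l → Bool
      few-bad  : m ^ C * ∑₂ l l (λ i j → 𝟙 (bad i j)) ≤ l * l
      regular  : ∀ i j → i ≢ j → bad i j ≡ false →
        RegularPair η G' (tabulate (λ v → ⌊ π v ≟ i ⌋)) (tabulate (λ v → ⌊ π v ≟ j ⌋))

  -- The initial equipartition serves to force `m * m ≤ l`, so that few edges can lie inside parts;
  -- it exists because `m * m ≤ n`.
  regularize : ∀ n (G : Graph n) → m * m ≤ n → n * n ≤ m * #E G → Regularized G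
  regularize n G m²≤n p = go (pred (m * m)) (suc-pred (m * m) {{m*n≢0 m m {{>-nonZero 1≤m}} {{>-nonZero 1≤m}}}})
    where
    go : ∀ k → suc k ≡ m * m → Regularized G
    go k k≡ = conclude (sp n G (density≥ n G (≤-trans (s≤s z≤n) k<n) p) (suc k) P₀ (proj₂ eq)
                          (subst (λ z → ⟦ z ⟧ ℚ.* η ℚ.≤ 1ℚ) (sym k≡) order))
      where
      k<n : suc k ≤ n
      k<n = ≤-trans (≤-reflexive k≡) m²≤n
      eq : Σ (Partition n (suc k)) IsEquipartition
      eq = equipartition n k k<n
      P₀ : Partition n (suc k)
      P₀ = proj₁ eq
      conclude : (Σ (Graph n) λ G' → editDist G G' ℚ.≤ ratio 1 Δ ℚ.* numEdges G ×
                   Σ ℕ λ l → l ≤ S × Σ (Partition n l) λ Q → Refines Q P₀ × IsRegularPartition η G' Q) →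
                 Regularized G
      conclude (G' , ed , l , l≤S , Q , r , eqQ , bad , fb , reg) = record
        { G' = G'
        ; edits = edits-cancel Δ (diff# G G') (#E G)
            (subst₂ (λ a b → a ℚ.≤ ratio 1 Δ ℚ.* ratio b 2) (editDist≡ G G') (eG-full G) ed)
        ; l = l
        ; l≤S = l≤S
        ; m²≤l = ≤-trans (≤-reflexive (sym k≡)) (refines⇒≤ Q P₀ r)
        ; π = part Q
        ; occupied = λ i → ≤-trans (≤-reflexive (cong 𝟙 (sym (trans (cong (λ z → ⌊ z ≟ i ⌋) (proj₂ (nonempty Q i))) (⌊≟⌋-refl i)))))
            (∑-term n (λ v → 𝟙 ⌊ part Q v ≟ i ⌋) (proj₁ (nonempty Q i)))
        ; equi = λ i j → subst₂ (λ a b → a ≤ b + 1) (∣Part∣ Q i) (∣Part∣ Q j) (eqQ i j)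
        ; bad = bad
        ; few-bad = scale-cancel (m ^ C) Kη≤1 _ (l * l)
            (subst (λ z → ⟦ z ⟧ ℚ.≤ η ℚ.* ⟦ l * l ⟧) (∑-cong l (λ i → count≡∑ l (bad i))) fb)
        ; regular = reg
        }

-- For X, Y smaller than a 1/K fraction the bound is trivial, so the size conditions in RegularPair disappear.
regular⇒cut : ∀ {h n} (K : ℕ) (η : ℚ) → 0ℚ ℚ.≤ η → ⟦ K ⟧ ℚ.* η ℚ.≤ 1ℚ →
  (G : Graph n) (a : Fin h → Fin n → Bool) (i j : Fin h) →
  (∀ i → NonZero (mass (λ i x → 𝟙 (a i x)) i)) →
  RegularPair η G (tabulate (a i)) (tabulate (a j)) →
  Cut (λ i x → 𝟙 (a i x)) K (adj G) (i , j)
regular⇒cut {h} {n} K η 0≤η Kη≤1 G a i j pos reg X Y = result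
  where
  w : Weights h n
  w i x = 𝟙 (a i x)
  mi = mass w i
  mj = mass w j
  P = mi * mj
  E = edges w (adj G) (i , j)
  X' Y' : Fin n → Bool
  X' u = a i u ∧ X u
  Y' v = a j v ∧ Y v
  x = sumFin n (λ u → 𝟙 (X' u))
  y = sumFin n (λ v → 𝟙 (Y' v))
  e = rect w i j (λ u v → (X u ∧ Y v) ∧ adj G u v)
  A = rect w i j (λ u v → X u ∧ Y v)

  A≡ : A ≡ x * y
  A≡ = trans (∑₂-cong n n (λ u v → pt (a i u) (a j v) (X u) (Y v))) (∑₂-prod n n _ _)
    where
    pt : ∀ p q r s → 𝟙 p * 𝟙 q * 𝟙 (r ∧ s) ≡ 𝟙 (p ∧ r) * 𝟙 (q ∧ s)
    pt false q     r     s = refl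
    pt true  false false s = refl
    pt true  false true  s = refl
    pt true  true  false s = refl
    pt true  true  true  s = refl
  e≡ : e ≡ eG G (tabulate X') (tabulate Y')
  e≡ = trans (∑₂-cong n n (λ u v → pt (a i u) (a j v) (X u) (Y v) (adj G u v))) (sym (eG-tabulate G X' Y'))
    where
    pt : ∀ p q r s t → 𝟙 p * 𝟙 q * 𝟙 ((r ∧ s) ∧ t) ≡ 𝟙 (p ∧ r) * 𝟙 (q ∧ s) * 𝟙 t
    pt false q     r     s     t = refl
    pt true  false false s     t = refl
    pt true  false true  s     t = refl
    pt true  true  false s     t = refl
    pt true  true  true  false t = refl
    pt true  true  true  true  t = refl
  ∧≤ : ∀ p q → 𝟙 (p ∧ q) ≤ 𝟙 p
  ∧≤ false q = z≤n
  ∧≤ true  q = 𝟙≤1 q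
  e≤A : e ≤ A
  e≤A = ∑₂-mono n n (λ u v → *-monoʳ-≤ (w i u * w j v) (∧≤ (X u ∧ Y v) (adj G u v)))
  x≤mi : x ≤ mi
  x≤mi = ∑-mono n (λ u → ∧≤ (a i u) (X u))
  y≤mj : y ≤ mj
  y≤mj = ∑-mono n (λ v → ∧≤ (a j v) (Y v))

  Goal : Set
  Goal = K * (P * e) ≤ K * (E * A) + P * P × K * (E * A) ≤ K * (P * e) + P * P

  trivial : K * A ≤ P → Goal
  trivial small =
    ≤-trans (≤-trans (*-monoʳ-≤ K (*-monoʳ-≤ P e≤A)) (≤-trans (≤-reflexive (*-swap K P A)) (*-monoʳ-≤ P small))) (m≤n+m _ _) ,
    ≤-trans (≤-trans (*-monoʳ-≤ K (*-monoˡ-≤ A (edges≤area w (adj G) (i , j)))) (≤-trans (≤-reflexive (*-swap K P A)) (*-monoʳ-≤ P small))) (m≤n+m _ _)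

  -- Sets that are large enough are also nonempty, so the default value of `ratio` at denominator
  -- zero never occurs.
  nz : ∀ {s t} → NonZero s → s ≤ K * t → NonZero t
  nz {suc s} {zero}  _ p = ⊥-elim (n≮0 (subst (suc s ≤_) (*-zeroʳ K) p))
  nz {suc s} {suc t} _ p = _

  sub : ∀ (p q : Fin n → Bool) → tabulate (λ u → p u ∧ q u) ⊆ tabulate p
  sub p q {u} u∈ = lookup⇒[]= u (tabulate p) (trans (lookup∘tabulate p u)
    (proj₁ (∧-true (trans (sym (lookup∘tabulate (λ u → p u ∧ q u) u)) ([]=⇒lookup u∈)))))

  dense≡ : ∀ p q → dG G (tabulate p) (tabulate q) ≡
    ratio (eG G (tabulate p) (tabulate q)) (sumFin n (λ u → 𝟙 (p u)) * sumFin n (λ v → 𝟙 (q v)))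
  dense≡ p q = cong₂ (λ s t → ratio (eG G (tabulate p) (tabulate q)) (s * t)) (∣tabulate∣ n p) (∣tabulate∣ n q)

  cut-from-regular : mi ≤ K * x → mj ≤ K * y → Goal
  cut-from-regular bigX bigY = ≤-trans (proj₁ cd) (+-monoʳ-≤ (K * (E * A)) (*-monoʳ-≤ P A≤P)) ,
                               ≤-trans (proj₂ cd) (+-monoʳ-≤ (K * (P * e)) (*-monoʳ-≤ P A≤P))
    where
    A≤P : A ≤ P
    A≤P = ≤-trans (≤-reflexive A≡) (*-mono-≤ x≤mi y≤mj)
    instance
      P≢0 : NonZero P
      P≢0 = m*n≢0 mi mj {{pos i}} {{pos j}}
      A≢0 : NonZero A
      A≢0 = subst NonZero (sym A≡) (m*n≢0 x y {{nz (pos i) bigX}} {{nz (pos j) bigY}})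
    E≡ : eG G (tabulate (a i)) (tabulate (a j)) ≡ E
    E≡ = eG-tabulate G (a i) (a j)
    large : ∀ p q → sumFin n (λ u → 𝟙 (p u)) ≤ K * sumFin n (λ u → 𝟙 (q u)) →
      η ℚ.* ⟦ ∣ tabulate p ∣ ⟧ ℚ.≤ ⟦ ∣ tabulate q ∣ ⟧
    large p q le = scale-up K Kη≤1 0≤η _ _ (subst₂ (λ s t → s ≤ K * t) (sym (∣tabulate∣ n p)) (sym (∣tabulate∣ n q)) le)
    close : ℚ.∣ ratio E P ℚ.- ratio e A ∣ ℚ.≤ η
    close = subst₂ (λ s t → ℚ.∣ s ℚ.- t ∣ ℚ.≤ η)
      (trans (dense≡ (a i) (a j)) (cong (λ z → ratio z P) E≡))
      (trans (dense≡ X' Y') (cong₂ ratio (sym e≡) (sym A≡)))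
      (reg (tabulate X') (tabulate Y') (sub (a i) X) (sub (a j) Y) (large (a i) X' bigX) (large (a j) Y' bigY))
    cd : K * (P * e) ≤ K * (E * A) + P * A × K * (E * A) ≤ K * (P * e) + P * A
    cd = clear-denominators₂ K Kη≤1 E P e A close

  smallX : K * x ≤ mi → Goal
  smallX small = trivial (begin
    K * A           ≡⟨ trans (cong (K *_) A≡) (sym (*-assoc K x y)) ⟩
    K * x * y       ≤⟨ *-mono-≤ small y≤mj ⟩
    mi * mj         ∎)
    where open ≤-Reasoning

  smallY : K * y ≤ mj → Goal
  smallY small = trivial (begin
    K * A           ≡⟨ trans (cong (K *_) A≡) (*-swap K x y) ⟩
    x * (K * y)     ≤⟨ *-mono-≤ x≤mi small ⟩
    mi * mj         ∎)
    where
    open ≤-Reasoning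

  result : Goal
  result = [ (λ bigX → [ cut-from-regular bigX , smallY ]′ (≤-total mj (K * y))) , smallX ]′ (≤-total mi (K * x))

-- The list of edges of `H`

⌊⌋-true : ∀ {P : Set} (d : Dec P) → ⌊ d ⌋ ≡ true → P
⌊⌋-true (yes p) _ = p

⌊⌋-false : ∀ {P : Set} (d : Dec P) → ⌊ d ⌋ ≡ false → ¬ P
⌊⌋-false (no p) _ = p

∨-false : ∀ {a b} → a ∨ b ≡ false → a ≡ false × b ≡ false
∨-false {false} e = refl , e

length-cartesianProduct : ∀ {A B : Set} (xs : List A) (ys : List B) →
  length (cartesianProduct xs ys) ≡ length xs * length ys
length-cartesianProduct []       ys = refl
length-cartesianProduct (x ∷ xs) ys = trans (length-++ (map (x ,_) ys))
  (cong₂ _+_ (length-map (x ,_) ys) (length-cartesianProduct xs ys))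

module _ {h : ℕ} (H : Graph h) where

  private
    isEdge? : ∀ (e : Edge h) → Dec (Increasing e × adj H (proj₁ e) (proj₂ e) ≡ true)
    isEdge? (i , j) = (i Fin.<? j) ×-dec (adj H i j ≟ᵇ true)

  edgeList : List (Edge h)
  edgeList = filter isEdge? (cartesianProduct (allFin h) (allFin h))

  edgeList-unique : Unique edgeList
  edgeList-unique = Unique.filter⁺ isEdge? (Unique.cartesianProduct⁺ (Unique.allFin⁺ h) (Unique.allFin⁺ h))

  edgeList-sound : ∀ {e} → e ∈ edgeList → Increasing e × adj H (proj₁ e) (proj₂ e) ≡ true
  edgeList-sound p = proj₂ (∈-filter⁻ isEdge? {xs = cartesianProduct (allFin h) (allFin h)} p)

  edgeList-length : length edgeList ≤ h * h
  edgeList-length = ≤-trans (length-filter isEdge? (cartesianProduct (allFin h) (allFin h)))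
    (≤-reflexive (trans (length-cartesianProduct (allFin h) (allFin h)) (cong (λ k → k * k) (length-tabulate {n = h} (λ i → i)))))

  edgeList-complete : ∀ i j → adj H i j ≡ true → (i , j) ∈ edgeList ⊎ (j , i) ∈ edgeList
  edgeList-complete i j a with Fin.<-cmp i j
  ... | tri< i<j _ _ = inj₁ (∈-filter⁺ isEdge? (∈-cartesianProduct⁺ (∈-allFin i) (∈-allFin j)) (i<j , a))
  ... | tri> _ _ j<i = inj₂ (∈-filter⁺ isEdge? (∈-cartesianProduct⁺ (∈-allFin j) (∈-allFin i)) (j<i , trans (Graph.sym H j i) a))
  ... | tri≈ _ refl _ = ⊥-elim (true≢false (trans (sym a) (irrefl H i)))

-- Cleaning

module _ {n l : ℕ} (π : Fin n → Fin l) (occupied : ∀ i → 1 ≤ size π i)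
         (equi : ∀ i j → size π i ≤ size π j + 1) where

  -- As no part is empty, a difference of one costs at most a factor two.
  size≤2size : ∀ i j → size π i ≤ 2 * size π j
  size≤2size i j = ≤-trans (equi i j) (+-monoʳ-≤ (size π j) (≤-trans (occupied j) (≤-reflexive (sym (+-identityʳ _)))))

  size-upper : ∀ i → l * size π i ≤ 2 * n
  size-upper i = begin
    l * size π i                     ≡⟨ sym (∑-const l _) ⟩
    sumFin l (λ _ → size π i)        ≤⟨ ∑-mono l (size≤2size i) ⟩
    sumFin l (λ j → 2 * size π j)    ≡⟨ ∑-*ˡ l 2 (size π) ⟩
    2 * sumFin l (size π)            ≡⟨ cong (2 *_) (∑-size π) ⟩
    2 * n                            ∎
    where open ≤-Reasoning

  size-lower : ∀ i → n ≤ 2 * l * size π i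
  size-lower i = begin
    n                                ≡⟨ sym (∑-size π) ⟩
    sumFin l (size π)                ≤⟨ ∑-bound l (2 * size π i) (λ j → size≤2size j i) ⟩
    l * (2 * size π i)               ≡⟨ comm l (size π i) ⟩
    2 * l * size π i                 ∎
    where
    open ≤-Reasoning
    comm : ∀ a b → a * (2 * b) ≡ 2 * a * b
    comm = solve-∀

  block : Rel n → Fin l → Fin l → ℕ
  block W i j = ∑₂ n n (λ u v → 𝟙 ⌊ π u ≟ i ⌋ * 𝟙 ⌊ π v ≟ j ⌋ * 𝟙 (W u v))

  ∑-block : ∀ W → ∑₂ l l (block W) ≡ ∑₂ n n (λ u v → 𝟙 (W u v))
  ∑-block W = sym (trans (∑₂-cong n n (λ u v → sym (*-identityˡ (𝟙 (W u v)))))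
    (trans (∑₂-fibre π (λ _ _ → 1) (λ u v → 𝟙 (W u v))) (∑₂-cong l l (λ i j → *-identityˡ (block W i j)))))

  ∑-size² : ∑₂ l l (λ i j → size π i * size π j) ≡ n * n
  ∑-size² = trans (∑₂-prod l l (size π) (size π)) (cong₂ _*_ (∑-size π) (∑-size π))


  within-parts : l * ∑₂ n n (λ u v → 𝟙 ⌊ π u ≟ π v ⌋) ≤ 2 * (n * n)
  within-parts = begin
    l * ∑₂ n n (λ u v → 𝟙 ⌊ π u ≟ π v ⌋)                 ≡⟨ sym (∑-*ˡ n l _) ⟩
    sumFin n (λ u → l * sumFin n (λ v → 𝟙 ⌊ π u ≟ π v ⌋)) ≤⟨ ∑-bound n (2 * n) (λ u → ≤-trans (≤-reflexive (cong (l *_) (∑-cong n (λ v → cong 𝟙 (⌊≟⌋-sym (π u) (π v)))))) (size-upper (π u))) ⟩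
    n * (2 * n)                                          ≡⟨ *-swap n 2 n ⟩
    2 * (n * n)                                          ∎
    where open ≤-Reasoning

  -- By `size-upper`, a pair of parts spans at most `4 n² / l²` pairs of vertices, whichever pairs
  -- of parts are selected.
  selected-area : ∀ (β : Fin l → Fin l → Bool) K → K * ∑₂ l l (λ i j → 𝟙 (β i j)) ≤ l * l → 1 ≤ l →
    K * ∑₂ n n (λ u v → 𝟙 (β (π u) (π v))) ≤ 4 * (n * n)
  selected-area β K few 1≤l = *-cancelˡ-≤ (l * l) {{>-nonZero (*-mono-≤ 1≤l 1≤l)}} (begin
    l * l * (K * s)                       ≡⟨ *-swap (l * l) K s ⟩
    K * (l * l * s)                       ≡⟨ cong (λ z → K * (l * l * z)) fibre ⟩
    K * (l * l * ∑₂ l l (λ i j → 𝟙 (β i j) * (size π i * size π j)))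
                                          ≡⟨ cong (K *_) (sym (∑₂-*ˡ l l (l * l) _)) ⟩
    K * ∑₂ l l (λ i j → l * l * (𝟙 (β i j) * (size π i * size π j)))
                                          ≤⟨ *-monoʳ-≤ K (∑₂-mono l l pt) ⟩
    K * ∑₂ l l (λ i j → 4 * (n * n) * 𝟙 (β i j))
                                          ≡⟨ trans (cong (K *_) (∑₂-*ˡ l l (4 * (n * n)) _)) (*-swap K (4 * (n * n)) _) ⟩
    4 * (n * n) * (K * ∑₂ l l (λ i j → 𝟙 (β i j))) ≤⟨ *-monoʳ-≤ (4 * (n * n)) few ⟩
    4 * (n * n) * (l * l)                 ≡⟨ *-comm (4 * (n * n)) (l * l) ⟩
    l * l * (4 * (n * n))                 ∎)
    where
    open ≤-Reasoning
    s = ∑₂ n n (λ u v → 𝟙 (β (π u) (π v)))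
    fibre : s ≡ ∑₂ l l (λ i j → 𝟙 (β i j) * (size π i * size π j))
    fibre = trans (∑₂-cong n n (λ u v → sym (*-identityʳ _)))
      (trans (∑₂-fibre π (λ i j → 𝟙 (β i j)) (λ _ _ → 1))
        (∑₂-cong l l (λ i j → cong (𝟙 (β i j) *_) (trans (∑₂-cong n n (λ u v → *-identityʳ _)) (∑₂-prod n n _ _)))))
    a1 : ∀ l b x y → l * l * (b * (x * y)) ≡ (l * x) * (l * y) * b
    a1 = solve-∀
    a2 : ∀ n b → (2 * n) * (2 * n) * b ≡ 4 * (n * n) * b
    a2 = solve-∀
    pt : ∀ i j → l * l * (𝟙 (β i j) * (size π i * size π j)) ≤ 4 * (n * n) * 𝟙 (β i j)
    pt i j = ≤-trans (≤-reflexive (a1 l (𝟙 (β i j)) (size π i) (size π j)))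
      (≤-trans (*-monoˡ-≤ (𝟙 (β i j)) (*-mono-≤ (size-upper i) (size-upper j))) (≤-reflexive (a2 n (𝟙 (β i j)))))

  -- Sparseness and excess are inequalities between block counts, so they can be summed over the
  -- selected blocks; the other blocks contribute zero on the left.
  selected-edges : ∀ (β : Fin l → Fin l → Bool) (W : Rel n) c (f : Fin l → Fin l → ℕ) →
    (∀ i j → β i j ≡ true → c * block W i j ≤ f i j) →
    c * ∑₂ n n (λ u v → 𝟙 (β (π u) (π v)) * 𝟙 (W u v)) ≤ ∑₂ l l f
  selected-edges β W c f p = begin
    c * ∑₂ n n (λ u v → 𝟙 (β (π u) (π v)) * 𝟙 (W u v))
      ≡⟨ cong (c *_) (∑₂-fibre π (λ i j → 𝟙 (β i j)) (λ u v → 𝟙 (W u v))) ⟩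
    c * ∑₂ l l (λ i j → 𝟙 (β i j) * block W i j)
      ≡⟨ sym (∑₂-*ˡ l l c _) ⟩
    ∑₂ l l (λ i j → c * (𝟙 (β i j) * block W i j))
      ≤⟨ ∑₂-mono l l pt ⟩
    ∑₂ l l f ∎
    where
    open ≤-Reasoning
    pt : ∀ i j → c * (𝟙 (β i j) * block W i j) ≤ f i j
    pt i j with β i j in e
    ... | false = ≤-trans (≤-reflexive (*-zeroʳ c)) z≤n
    ... | true  = ≤-trans (≤-reflexive (cong (c *_) (+-identityʳ _))) (p i j e)

  module _ (q m C : ℕ) (1≤q : 1 ≤ q) (24q≤m : 24 * q ≤ m) (2≤C : 2 ≤ C) (m²≤l : m * m ≤ l)
           (bad : Fin l → Fin l → Bool) (few-bad : m ^ C * ∑₂ l l (λ i j → 𝟙 (bad i j)) ≤ l * l)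
           (G₁ G' : Graph n) (many : n * n ≤ m * #E G₁)
           (edits : 12 * (q * q) * diff# G₁ G' ≤ #E G₁) where

    added : Rel n
    added u v = adj G' u v ∧ not (adj G₁ u v)

    -- The constants make each of the five terms in killed cost at most e₁/(6q) edges of G₁.
    sparse excess : Fin l → Fin l → Bool
    sparse i j = not ⌊ size π i * size π j ≤? 6 * q * m * block (adj G') i j ⌋
    excess i j = not ⌊ 2 * q * block added i j ≤? block (adj G') i j ⌋

    killed : Rel n
    killed u v = not (adj G' u v) ∨ (⌊ π u ≟ π v ⌋ ∨ (bad (π u) (π v) ∨ (sparse (π u) (π v) ∨ excess (π u) (π v))))

    private
      e₁ = #E G₁
      diff = diff# G₁ G'
      k = λ (u v : Fin n) → 𝟙 (adj G₁ u v ∧ killed u v)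
      sA = diff
      sB = ∑₂ n n (λ u v → 𝟙 ⌊ π u ≟ π v ⌋)
      sC = ∑₂ n n (λ u v → 𝟙 (bad (π u) (π v)))
      sD = ∑₂ n n (λ u v → 𝟙 (sparse (π u) (π v)) * 𝟙 (adj G' u v))
      sE = ∑₂ n n (λ u v → 𝟙 (excess (π u) (π v)) * 𝟙 (adj G' u v))

      1≤m : 1 ≤ m
      1≤m = ≤-trans (*-mono-≤ {1} {24} (s≤s z≤n) 1≤q) 24q≤m
      1≤l : 1 ≤ l
      1≤l = ≤-trans (*-mono-≤ 1≤m 1≤m) m²≤l

      -- As `n² ≤ m e₁`, a loss of order `n² / m²` is one of order `e₁ / m`. The second factor `m`
      -- is why `m²` parts and irregularity at most `1 / m²` are required.
      divide : ∀ s a → m * m * s ≤ a * (n * n) → m * s ≤ a * e₁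
      divide s a p = *-cancelˡ-≤ m {{>-nonZero 1≤m}} (begin
        m * (m * s)      ≡⟨ sym (*-assoc m m s) ⟩
        m * m * s        ≤⟨ p ⟩
        a * (n * n)      ≤⟨ *-monoʳ-≤ a many ⟩
        a * (m * e₁)     ≡⟨ *-swap a m e₁ ⟩
        m * (a * e₁)     ∎)
        where open ≤-Reasoning

      boundA : 6 * q * sA ≤ e₁
      boundA = ≤-trans (*-monoˡ-≤ sA (≤-trans (*-mono-≤ {6} {12} (m≤m+n 6 6) (m≤m*n q q {{>-nonZero 1≤q}})) ≤-refl)) edits

      boundB : 6 * q * sB ≤ e₁
      boundB = *-cancelˡ-≤ 2 (begin
        2 * (6 * q * sB)   ≡⟨ a1 q sB ⟩
        12 * q * sB        ≤⟨ *-monoˡ-≤ sB (≤-trans (*-monoˡ-≤ q (m≤m+n 12 12)) 24q≤m) ⟩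
        m * sB             ≤⟨ divide sB 2 (≤-trans (*-monoˡ-≤ sB m²≤l) within-parts) ⟩
        2 * e₁             ∎)
        where
        open ≤-Reasoning
        a1 : ∀ q s → 2 * (6 * q * s) ≡ 12 * q * s
        a1 = solve-∀

      boundC : 6 * q * sC ≤ e₁
      boundC = *-cancelˡ-≤ 4 (begin
        4 * (6 * q * sC)   ≡⟨ a1 q sC ⟩
        24 * q * sC        ≤⟨ *-monoˡ-≤ sC 24q≤m ⟩
        m * sC             ≤⟨ divide sC 4 (≤-trans (*-monoˡ-≤ sC m²≤mᶜ) (selected-area bad (m ^ C) few-bad 1≤l)) ⟩
        4 * e₁             ∎)
        where
        open ≤-Reasoning
        a1 : ∀ q s → 4 * (6 * q * s) ≡ 24 * q * s
        a1 = solve-∀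
        m²≤mᶜ : m * m ≤ m ^ C
        m²≤mᶜ = ≤-trans (≤-reflexive (cong (m *_) (sym (*-identityʳ m)))) (^-monoʳ-≤ m {{>-nonZero 1≤m}} 2≤C)

      -- All sparse blocks together carry at most `n² / (6qm)` pairs of `G'`, and `n² ≤ m e₁`.
      boundD : 6 * q * sD ≤ e₁
      boundD = *-cancelˡ-≤ m {{>-nonZero 1≤m}} (begin
        m * (6 * q * sD)   ≡⟨ trans (*-swap m (6 * q) sD) (sym (*-assoc (6 * q) m sD)) ⟩
        6 * q * m * sD     ≤⟨ selected-edges sparse (adj G') (6 * q * m) (λ i j → size π i * size π j)
                                (λ i j s → <⇒≤ (≰⇒> (⌊⌋-false (size π i * size π j ≤? 6 * q * m * block (adj G') i j) (not-true s)))) ⟩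
        ∑₂ l l (λ i j → size π i * size π j) ≡⟨ ∑-size² ⟩
        n * n              ≤⟨ many ⟩
        m * e₁             ∎)
        where
        open ≤-Reasoning

      -- A block with excess has fewer pairs of `G'` than `2 * q` times its added pairs, and those
      -- number at most `diff` in all. The product of `2 * q` and `6 * q` is the `12 * (q * q)` in
      -- `δ₀`.
      boundE : 6 * q * sE ≤ e₁
      boundE = begin
        6 * q * sE         ≡⟨ cong (6 * q *_) (sym (*-identityˡ sE)) ⟩
        6 * q * (1 * sE)   ≤⟨ *-monoʳ-≤ (6 * q) (selected-edges excess (adj G') 1 (λ i j → 2 * q * block added i j)
                                (λ i j s → ≤-trans (≤-reflexive (*-identityˡ _)) (<⇒≤ (≰⇒> (⌊⌋-false (2 * q * block added i j ≤? block (adj G') i j) (not-true s)))))) ⟩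
        6 * q * ∑₂ l l (λ i j → 2 * q * block added i j) ≡⟨ cong (6 * q *_) (trans (∑₂-*ˡ l l (2 * q) _) (cong (2 * q *_) (∑-block added))) ⟩
        6 * q * (2 * q * ∑₂ n n (λ u v → 𝟙 (added u v))) ≤⟨ *-monoʳ-≤ (6 * q) (*-monoʳ-≤ (2 * q) (∑₂-mono n n (λ u v → added≤diff (adj G' u v) (adj G₁ u v)))) ⟩
        6 * q * (2 * q * diff) ≡⟨ a1 q diff ⟩
        12 * (q * q) * diff ≤⟨ edits ⟩
        e₁                 ∎
        where
        open ≤-Reasoning
        a1 : ∀ q d → 6 * q * (2 * q * d) ≡ 12 * (q * q) * d
        a1 = solve-∀
        added≤diff : ∀ g' g → 𝟙 (g' ∧ not g) ≤ 𝟙 (diffᵇ g g')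
        added≤diff true  true  = z≤n
        added≤diff true  false = ≤-refl
        added≤diff false g     = z≤n

      -- Pairs missing from `G'` are charged to `sA` first. What remains lies in `G'`, so sparse and
      -- excess blocks may be charged by their edges in `G'`, which is what their definitions
      -- control.
      split : ∑₂ n n k ≤ sA + (sB + (sC + (sD + sE)))
      split = ≤-trans (∑₂-mono n n (λ u v → pt (adj G₁ u v) (adj G' u v) ⌊ π u ≟ π v ⌋ (bad (π u) (π v)) (sparse (π u) (π v)) (excess (π u) (π v))))
        (≤-reflexive (trans (∑₂-+ n n _ _) (cong (sA +_) (trans (∑₂-+ n n _ _) (cong (sB +_) (trans (∑₂-+ n n _ _) (cong (sC +_) (∑₂-+ n n _ _))))))))
        where
        pt : ∀ g g' b c d e → 𝟙 (g ∧ (not g' ∨ (b ∨ (c ∨ (d ∨ e))))) ≤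
          𝟙 (diffᵇ g g') + (𝟙 b + (𝟙 c + (𝟙 d * 𝟙 g' + 𝟙 e * 𝟙 g')))
        pt false g'    b     c     d     e     = z≤n
        pt true  false b     c     d     e     = s≤s z≤n
        pt true  true  true  c     d     e     = s≤s z≤n
        pt true  true  false true  d     e     = s≤s z≤n
        pt true  true  false false true  e     = s≤s z≤n
        pt true  true  false false false true  = ≤-refl
        pt true  true  false false false false = z≤n

    few-killed : 6 * (q * ∑₂ n n (λ u v → 𝟙 (adj G₁ u v ∧ killed u v))) ≤ 5 * #E G₁
    few-killed = begin
      6 * (q * ∑₂ n n k)                      ≡⟨ sym (*-assoc 6 q _) ⟩
      6 * q * ∑₂ n n k                        ≤⟨ *-monoʳ-≤ (6 * q) split ⟩
      6 * q * (sA + (sB + (sC + (sD + sE))))  ≡⟨ a1 (6 * q) sA sB sC sD sE ⟩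
      6 * q * sA + (6 * q * sB + (6 * q * sC + (6 * q * sD + 6 * q * sE)))
        ≤⟨ +-mono-≤ boundA (+-mono-≤ boundB (+-mono-≤ boundC (+-mono-≤ boundD boundE))) ⟩
      e₁ + (e₁ + (e₁ + (e₁ + e₁)))            ≡⟨ a2 e₁ ⟩
      5 * e₁                                  ∎
      where
      open ≤-Reasoning
      a1 : ∀ x a b c d e → x * (a + (b + (c + (d + e)))) ≡ x * a + (x * b + (x * c + (x * d + x * e)))
      a1 = solve-∀
      a2 : ∀ e → e + (e + (e + (e + e))) ≡ 5 * e
      a2 = solve-∀

-- Copies of `H` from a surviving copy

power-∏mass : ∀ {n} h (w : Weights h n) c → (∀ i → n ≤ c * mass w i) → n ^ h ≤ c ^ h * ∏mass h w
power-∏mass zero    w c p = ≤-refl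
power-∏mass (suc h) w c p = ≤-trans (*-mono-≤ (p zero) (power-∏mass h (λ i → w (suc i)) c (λ i → p (suc i))))
  (≤-reflexive (interchangeℕ c (mass w zero) (c ^ h) _))
  where
  interchangeℕ : ∀ a b c d → a * b * (c * d) ≡ a * c * (b * d)
  interchangeℕ = solve-∀

module _ {h n l : ℕ} (H : Graph h) (1≤h : 1 ≤ h) (m C : ℕ) (24q≤m : 24 * (h * h) ≤ m) (2≤C : 2 ≤ C)
         (8q²D^q≤K : 8 * (h * h * (h * h)) * (6 * (h * h) * m) ^ (h * h) ≤ m ^ C)
         (η : ℚ) (0≤η : 0ℚ ℚ.≤ η) (Kη≤1 : ⟦ m ^ C ⟧ ℚ.* η ℚ.≤ 1ℚ)
         (G₁ G' : Graph n) (many : n * n ≤ m * #E G₁) (1≤e : 1 ≤ #E G₁)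
         (edits : 12 * (h * h * (h * h)) * diff# G₁ G' ≤ #E G₁)
         (m²≤l : m * m ≤ l) (π : Fin n → Fin l) (occupied : ∀ i → 1 ≤ size π i)
         (equi : ∀ i j → size π i ≤ size π j + 1)
         (bad : Fin l → Fin l → Bool) (few-bad : m ^ C * ∑₂ l l (λ i j → 𝟙 (bad i j)) ≤ l * l)
         (regular : ∀ i j → i ≢ j → bad i j ≡ false →
           RegularPair η G' (tabulate (λ v → ⌊ π v ≟ i ⌋)) (tabulate (λ v → ⌊ π v ≟ j ⌋))) where

  private
    q D : ℕ
    q = h * h
    D = 6 * q * m

    1≤q : 1 ≤ q
    1≤q = *-mono-≤ 1≤h 1≤h

    1≤m : 1 ≤ m
    1≤m = ≤-trans (*-mono-≤ {1} {24} (s≤s z≤n) 1≤q) 24q≤m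

    κ : Rel n
    κ = killed π occupied equi q m C 1≤q 24q≤m 2≤C m²≤l bad few-bad G₁ G' many edits

    add : Rel n
    add = added π occupied equi q m C 1≤q 24q≤m 2≤C m²≤l bad few-bad G₁ G' many edits

    kept : Rel n
    kept u v = adj G' u v ∧ adj G₁ u v

    es : List (Edge h)
    es = edgeList H

  survivor : (CleanCopy H G₁ κ ⊎ #E G₁ ≤ q * ∑₂ n n (λ u v → 𝟙 (adj G₁ u v ∧ κ u v))) → CleanCopy H G₁ κ
  survivor (inj₁ c) = c
  -- Six times `p`, together with `few-killed`, would give `6 e ≤ 5 e` for the positive number
  -- `e = #E G₁`.
  survivor (inj₂ p) = ⊥-elim (<⇒≱ (m<n+m (5 * #E G₁) 1≤e)
    (≤-trans (*-monoʳ-≤ 6 p) (few-killed π occupied equi q m C 1≤q 24q≤m 2≤C m²≤l bad few-bad G₁ G' many edits)))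

  -- The surviving copy is used only to select a part for each vertex of `H`. Adjacent vertices get
  -- different parts with a good pair between them; nonadjacent ones may share a part, which the
  -- separate weights allow. Every part has at least `n / (2 * l)` vertices.
  embeddings : CleanCopy H G₁ κ →
    n ^ h ≤ 4 * D ^ q * (2 * l) ^ h * T unit (conj kept (λ _ → true) es)
  embeddings (φ , (_ , hom) , clean) = begin
    n ^ h
      ≤⟨ power-∏mass h w (2 * l) (λ i → size-lower π occupied equi (c i)) ⟩
    (2 * l) ^ h * vol w
      ≤⟨ *-monoʳ-≤ ((2 * l) ^ h) lemma ⟩
    (2 * l) ^ h * (4 * D ^ q * T w (conj kept (λ _ → true) es))
      ≤⟨ *-monoʳ-≤ ((2 * l) ^ h) (*-monoʳ-≤ (4 * D ^ q) (∑W-monoʷ h _ (λ i x → 𝟙≤1 ⌊ π x ≟ c i ⌋))) ⟩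
    (2 * l) ^ h * (4 * D ^ q * T unit (conj kept (λ _ → true) es))
      ≡⟨ trans (sym (*-assoc ((2 * l) ^ h) (4 * D ^ q) _)) (cong (_* T unit (conj kept (λ _ → true) es)) (*-comm ((2 * l) ^ h) (4 * D ^ q))) ⟩
    4 * D ^ q * (2 * l) ^ h * T unit (conj kept (λ _ → true) es) ∎
    where
    open ≤-Reasoning
    c : Fin h → Fin l
    c i = π (lookup φ i)
    a : Fin h → Fin n → Bool
    a i x = ⌊ π x ≟ c i ⌋
    w : Weights h n
    w i x = 𝟙 (a i x)
    pos : ∀ i → NonZero (mass w i)
    pos i = >-nonZero (occupied (c i))

    Good : Fin h → Fin h → Set
    Good i j = c i ≢ c j × bad (c i) (c j) ≡ false ×
      size π (c i) * size π (c j) ≤ D * block π occupied equi (adj G') (c i) (c j) ×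
      2 * q * block π occupied equi add (c i) (c j) ≤ block π occupied equi (adj G') (c i) (c j)

    good : ∀ i j → adj H i j ≡ true → Good i j
    good i j e = distinct , proj₁ k₂ , dense , few
      where
      k₁ = ∨-false {⌊ c i ≟ c j ⌋} (proj₂ (∨-false {not (adj G' (lookup φ i) (lookup φ j))} (clean i j e)))
      k₂ = ∨-false {bad (c i) (c j)} (proj₂ k₁)
      k₃ = ∨-false {not ⌊ size π (c i) * size π (c j) ≤? 6 * q * m * block π occupied equi (adj G') (c i) (c j) ⌋} (proj₂ k₂)
      distinct : c i ≢ c j
      distinct = ⌊⌋-false (c i ≟ c j) (proj₁ k₁)
      dense : size π (c i) * size π (c j) ≤ D * block π occupied equi (adj G') (c i) (c j)
      dense = ⌊⌋-true (size π (c i) * size π (c j) ≤? D * block π occupied equi (adj G') (c i) (c j)) (not-false (proj₁ k₃))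
      few : 2 * q * block π occupied equi add (c i) (c j) ≤ block π occupied equi (adj G') (c i) (c j)
      few = ⌊⌋-true (2 * q * block π occupied equi add (c i) (c j) ≤? block π occupied equi (adj G') (c i) (c j)) (not-false (proj₂ k₃))

    good-edge : ∀ {e} → e ∈ es → Good (proj₁ e) (proj₂ e)
    good-edge {i , j} e∈ = good i j (proj₂ (edgeList-sound H e∈))

    cut : ∀ {e} → e ∈ es → Cut w (m ^ C) (adj G') e
    cut {i , j} e∈ = regular⇒cut (m ^ C) η 0≤η Kη≤1 G' a i j pos
      (regular (c i) (c j) (proj₁ (good-edge e∈)) (proj₁ (proj₂ (good-edge e∈))))

    lemma : vol w ≤ 4 * D ^ q * T w (conj kept (λ _ → true) es)
    lemma = counting-lemma (adj G') kept add cover w pos (m ^ C) D q 8q²D^q≤K 1≤q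
      (*-mono-≤ (*-mono-≤ {1} {6} (s≤s z≤n) 1≤q) 1≤m) es
      (edgeList-unique H) (All.tabulate (λ e∈ → proj₁ (edgeList-sound H e∈))) (edgeList-length H)
      (All.tabulate cut)
      (λ { (i , j) e∈ → proj₁ (proj₂ (proj₂ (good-edge e∈))) })
      (λ { (i , j) e∈ → proj₂ (proj₂ (proj₂ (good-edge e∈))) })
      where
      cover : ∀ x y → adj G' x y ≡ true → kept x y ≡ false → add x y ≡ true
      cover x y g k rewrite g = cong not k

  -- The losses collected in `2 * Z * q` are `8 * q`, `D ^ q` and `(2 * l) ^ h`. The first base is
  -- at most `m`, `D` is at most `m * m`, and `2 * l` is at most `S * S`.
  copies-from-survivor : ∀ S (G₀ : Graph n) → SubgraphOf G₁ G₀ → CleanCopy H G₁ κ → 1 ≤ n → 1 ≤ copies H G₀ →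
    m * m ≤ S → l ≤ S → n ^ h ≤ S ^ ((2 + (q + q) + (h + h)) * h) * copies H G₀
  copies-from-survivor S G₀ sub cc 1≤n 1≤c m²≤S l≤S = begin
    n ^ h
      ≤⟨ homs⇒copies H G₀ es (edgeList-complete H) kept (λ x y e → sub x y (proj₂ (∧-true {adj G' x y} e)))
           Z 1≤Z 1≤h 1≤n 1≤c (embeddings cc) ⟩
    (2 * Z * q) ^ h * copies H G₀
      ≤⟨ *-monoˡ-≤ (copies H G₀) (^-monoˡ-≤ h bound) ⟩
    (S ^ (2 + (q + q) + (h + h))) ^ h * copies H G₀
      ≡⟨ cong (_* copies H G₀) (^-*-assoc S (2 + (q + q) + (h + h)) h) ⟩
    S ^ ((2 + (q + q) + (h + h)) * h) * copies H G₀ ∎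
    where
    open ≤-Reasoning
    Z = 4 * D ^ q * (2 * l) ^ h
    m≤S : m ≤ S
    m≤S = ≤-trans (m≤m*n m m {{>-nonZero 1≤m}}) m²≤S
    1≤S : 1 ≤ S
    1≤S = ≤-trans 1≤m m≤S
    1≤l : 1 ≤ l
    1≤l = ≤-trans (*-mono-≤ 1≤m 1≤m) m²≤l
    1≤D : 1 ≤ D
    1≤D = *-mono-≤ (*-mono-≤ {1} {6} (s≤s z≤n) 1≤q) 1≤m
    1≤Z : 1 ≤ Z
    1≤Z = *-mono-≤ (*-mono-≤ {1} {4} (s≤s z≤n) (m^n>0 D {{>-nonZero 1≤D}} q))
            (m^n>0 (2 * l) {{>-nonZero (*-mono-≤ {1} {2} (s≤s z≤n) 1≤l)}} h)
    2≤S : 2 ≤ S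
    2≤S = ≤-trans (≤-trans (*-mono-≤ {2} {24} (m≤m+n 2 22) 1≤q) 24q≤m) m≤S
    D≤S : D ≤ S
    D≤S = ≤-trans (*-monoˡ-≤ m (≤-trans (*-monoˡ-≤ q (m≤m+n 6 18)) 24q≤m)) m²≤S
    8q≤S : 8 * q ≤ S
    8q≤S = ≤-trans (≤-trans (*-monoˡ-≤ q (m≤m+n 8 16)) 24q≤m) m≤S
    S² : S * S ≡ S ^ 2
    S² = cong (S *_) (sym (*-identityʳ S))
    re : ∀ d e q → 2 * (4 * d * e) * q ≡ 8 * q * d * e
    re = solve-∀
    bound : 2 * Z * q ≤ S ^ (2 + (q + q) + (h + h))
    bound = begin
      2 * Z * q                          ≡⟨ re (D ^ q) ((2 * l) ^ h) q ⟩
      8 * q * D ^ q * (2 * l) ^ h        ≤⟨ *-mono-≤ (*-mono-≤ 8q≤S (^-monoˡ-≤ q D≤S)) (^-monoˡ-≤ h (*-mono-≤ 2≤S l≤S)) ⟩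
      S ^ suc q * (S * S) ^ h            ≡⟨ cong (S ^ suc q *_) (trans (cong (_^ h) S²) (^-*-assoc S 2 h)) ⟩
      S ^ suc q * S ^ (2 * h)            ≡⟨ sym (^-distribˡ-+-* S (suc q) (2 * h)) ⟩
      S ^ (suc q + 2 * h)                ≤⟨ ^-monoʳ-≤ S {{>-nonZero 1≤S}} (+-mono-≤ (≤-trans (s≤s (m≤m+n q q)) (n≤1+n _)) (≤-reflexive (cong (h +_) (+-identityʳ h)))) ⟩
      S ^ (2 + (q + q) + (h + h))        ∎

-- With `q = h * h`, the summand `2 + (q + q)` makes `m ^ C` at least `8 * (q * q) * D ^ q`, as
-- `8 * (q * q)` and `D` are both at most `m * m`. The summand `h + h` covers `(2 * l) ^ h`, and the
-- outer factor `h` is the power taken in `homs⇒copies`.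
exponent : ℕ → ℕ
exponent h = (2 + (h * h + h * h) + (h + h)) * h

-- Degenerate cases and the final bound

module _ (h : ℕ) (1≤h : 1 ≤ h) (H : Graph h) (ε : ℚ) (0<ε : 0ℚ ℚ.< ε)
         (m : ℕ) (24q≤m : 24 * (h * h) ≤ m) (mε≤1 : ⟦ m ⟧ ℚ.* ε ℚ.≤ 1ℚ) (1≤2mε : 1ℚ ℚ.≤ ⟦ 2 * m ⟧ ℚ.* ε)
         {{_ : NonZero (12 * (h * h * (h * h)))}}
         (S : ℕ) (sp : SProp (ε ^ℚ exponent h) (ratio 1 (12 * (h * h * (h * h)))) ε S) where

  private
    q C : ℕ
    q = h * h
    C = exponent h

    0≤ε : 0ℚ ℚ.≤ ε
    0≤ε = ℚ.<⇒≤ 0<ε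

    1≤q : 1 ≤ q
    1≤q = *-mono-≤ 1≤h 1≤h

    24≤m : 24 ≤ m
    24≤m = ≤-trans (m≤m*n 24 q {{>-nonZero 1≤q}}) 24q≤m

    2≤m : 2 ≤ m
    2≤m = ≤-trans (m≤m+n 2 22) 24≤m

    1≤m : 1 ≤ m
    1≤m = ≤-trans (n≤1+n 1) 2≤m

    2+2q≤C : 2 + (q + q) ≤ C
    2+2q≤C = ≤-trans (m≤m+n _ (h + h)) (m≤m*n _ h {{>-nonZero 1≤h}})

    2≤C : 2 ≤ C
    2≤C = ≤-trans (m≤m+n 2 _) 2+2q≤C

    h≤C : h ≤ C
    h≤C = m≤n*m h (2 + (q + q) + (h + h))

    8q²D^q≤K : 8 * (q * q) * (6 * q * m) ^ q ≤ m ^ C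
    8q²D^q≤K = begin
      8 * (q * q) * (6 * q * m) ^ q   ≤⟨ *-mono-≤ 8q²≤m² (^-monoˡ-≤ q (*-monoˡ-≤ m (≤-trans (*-monoˡ-≤ q (m≤m+n 6 18)) 24q≤m))) ⟩
      m * m * (m * m) ^ q             ≡⟨ cong (λ z → z * z ^ q) (cong (m *_) (sym (*-identityʳ m))) ⟩
      m ^ 2 * (m ^ 2) ^ q             ≡⟨ cong (m ^ 2 *_) (^-*-assoc m 2 q) ⟩
      m ^ 2 * m ^ (2 * q)             ≡⟨ sym (^-distribˡ-+-* m 2 (2 * q)) ⟩
      m ^ (2 + 2 * q)                 ≡⟨ cong (λ z → m ^ (2 + (q + z))) (+-identityʳ q) ⟩
      m ^ (2 + (q + q))               ≤⟨ ^-monoʳ-≤ m {{>-nonZero 1≤m}} 2+2q≤C ⟩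
      m ^ C                           ∎
      where
      open ≤-Reasoning
      re : ∀ q → 8 * (q * q) ≡ (8 * q) * q
      re = solve-∀
      8q²≤m² : 8 * (q * q) ≤ m * m
      8q²≤m² = ≤-trans (≤-reflexive (re q))
        (*-mono-≤ (≤-trans (*-monoˡ-≤ q (m≤m+n 8 16)) 24q≤m) (≤-trans (m≤n*m q 24) 24q≤m))

    m²≤S' : m * m ≤ S
    m²≤S' = m²≤S m ε 0≤ε mε≤1 2≤m C 2≤C (12 * (q * q)) S sp

    m≤S : m ≤ S
    m≤S = ≤-trans (m≤m*n m m {{>-nonZero 1≤m}}) m²≤S'

    1≤S : 1 ≤ S
    1≤S = ≤-trans 1≤m m≤S

    small : ∀ n c → 1 ≤ c → n ≤ S → n ^ h ≤ S ^ C * c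
    small n c 1≤c n≤S = ≤-trans (^-monoˡ-≤ h n≤S)
      (≤-trans (^-monoʳ-≤ S {{>-nonZero 1≤S}} h≤C) (m≤m*n (S ^ C) c {{>-nonZero 1≤c}}))

  module _ (n : ℕ) (G : Graph n) (far : FarFromHFree ε H G) where

    private
      many-removed : ∀ (G* : Graph n) → SubgraphOf G* G → HFree H G* → n * n ≤ m * #E (G ∖ᴳ G*)
      many-removed G* sub free = far⇒many m ε (n * n) (#E (G ∖ᴳ G*)) 1≤2mε
        (ℚ.≤-trans (far G* sub free) (ℚ.≤-reflexive (trans (editDist≡ G G*)
          (cong (λ z → ratio z 2) (∑₂-cong n n (λ u v → cong 𝟙 (pt (adj G u v) (adj G* u v) (sub u v))))))))
        where
        pt : ∀ g s → (s ≡ true → g ≡ true) → diffᵇ g s ≡ g ∧ not s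
        pt true  true  f = refl
        pt true  false f = refl
        pt false true  f with f refl
        ... | ()
        pt false false f = refl

      1≤n*n⇒1≤e : ∀ e → 1 ≤ n → n * n ≤ m * e → 1 ≤ e
      1≤n*n⇒1≤e zero    1≤n p = ≤-trans (*-mono-≤ 1≤n 1≤n) (≤-trans p (≤-reflexive (*-zeroʳ m)))
      1≤n*n⇒1≤e (suc e) 1≤n p = s≤s z≤n

      -- Were `G` free of `H`, it would be its own competitor at distance zero, while farness asks
      -- for at least `ε n² > 0` edits.
      some-copy : 1 ≤ n → 1 ≤ copies H G
      some-copy 1≤n = ≮⇒≥ λ none → <⇒≱ (1≤n*n⇒1≤e _ 1≤n (many-removed G (λ u v e → e) (free none))) (≤-reflexive empty)
        where
        empty : #E (G ∖ᴳ G) ≡ 0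
        empty = trans (∑₂-cong n n (λ u v → cancel (adj G u v))) (trans (∑₂-const n n 0) (trans (cong (n *_) (*-zeroʳ n)) (*-zeroʳ n)))
          where
          cancel : ∀ b → 𝟙 (b ∧ not b) ≡ 0
          cancel true  = refl
          cancel false = refl
        free : copies H G < 1 → HFree H G
        free none (f , inj , hom) = <⇒≱ none (begin
          1                           ≡⟨ cong 𝟙 (sym copy) ⟩
          𝟙 (isCopyᵇ H G (tabulate f)) ≤⟨ sumList-term (λ φ → 𝟙 (isCopyᵇ H G φ)) (∈-allVecs (tabulate f)) ⟩
          _                           ≡⟨ sym (length-filterᵇ (isCopyᵇ H G) (allVecs h n)) ⟩
          copies H G                  ∎)
          where
          open ≤-Reasoning
          copy : isCopyᵇ H G (tabulate f) ≡ true
          copy = isCopyᵇ-complete H G (tabulate f)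
            ( (λ i j e → inj i j (trans (sym (lookup∘tabulate f i)) (trans e (lookup∘tabulate f j))))
            , (λ i j a → trans (cong₂ (adj G) (lookup∘tabulate f i) (lookup∘tabulate f j)) (hom i j a)))

      -- Without edges in `H` there is nothing to pack, but every tuple is a homomorphism and only
      -- injectivity has to be ensured.
      edgeless : (∀ i j → adj H i j ≡ true → (i , j) ∈ [] ⊎ (j , i) ∈ []) → 1 ≤ n → n ^ h ≤ S ^ C * copies H G
      edgeless none 1≤n = begin
        n ^ h
          ≤⟨ homs⇒copies H G [] none (adj G) (λ _ _ e → e) 1 ≤-refl 1≤h 1≤n (some-copy 1≤n)
               (≤-reflexive (sym (trans (*-identityˡ _) (trans (∑W-1 h unit) (∏mass-unit h n))))) ⟩
        (2 * 1 * q) ^ h * copies H G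
          ≤⟨ *-monoˡ-≤ (copies H G) (^-monoˡ-≤ h (≤-trans (*-monoˡ-≤ q (m≤m+n 2 22)) (≤-trans 24q≤m m≤S))) ⟩
        S ^ h * copies H G
          ≤⟨ *-monoˡ-≤ (copies H G) (^-monoʳ-≤ S {{>-nonZero 1≤S}} h≤C) ⟩
        S ^ C * copies H G ∎
        where open ≤-Reasoning

      with-edge : ∀ i₀ j₀ → adj H i₀ j₀ ≡ true → 1 ≤ n → m * m ≤ n → n ^ h ≤ S ^ C * copies H G
      with-edge i₀ j₀ edge₀ 1≤n m²≤n = conclude (regularize m ε 0≤ε mε≤1 2≤m C 2≤C (12 * (q * q)) S sp n G₁ m²≤n many)
        where
        G* = strip H (allVecs h n) G
        G₁ = G ∖ᴳ G*
        many : n * n ≤ m * #E G₁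
        many = many-removed G* (strip-⊆ H (allVecs h n) G) (strip-HFree H i₀ j₀ edge₀ G)
        conclude : Regularized m ε 0≤ε mε≤1 2≤m C 2≤C (12 * (q * q)) S sp G₁ → n ^ h ≤ S ^ C * copies H G
        conclude r = copies-from-survivor H 1≤h m C 24q≤m 2≤C 8q²D^q≤K (ε ^ℚ C) (^ℚ-nonNeg 0≤ε C)
            (power-bound 0≤ε mε≤1 C) G₁ G' many 1≤e edits m²≤l π occupied equi bad few-bad regular S G
            (λ u v e → proj₁ (∧-true e))
            (survivor H 1≤h m C 24q≤m 2≤C 8q²D^q≤K (ε ^ℚ C) (^ℚ-nonNeg 0≤ε C)
              (power-bound 0≤ε mε≤1 C) G₁ G' many 1≤e edits m²≤l π occupied equi bad few-bad regular
              (strip-dichotomy H _ (allVecs h n) G))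
            1≤n (some-copy 1≤n) m²≤S' l≤S
          where
          open Regularized r
          1≤e : 1 ≤ #E G₁
          1≤e = 1≤n*n⇒1≤e (#E G₁) 1≤n many

      positive-order : 1 ≤ n → n ^ h ≤ S ^ C * copies H G
      positive-order 1≤n = by-edges (edgeList H) refl
        where
        by-edges : ∀ es → edgeList H ≡ es → n ^ h ≤ S ^ C * copies H G
        by-edges []             e = edgeless (subst (λ l → ∀ i j → adj H i j ≡ true → (i , j) ∈ l ⊎ (j , i) ∈ l) e (edgeList-complete H)) 1≤n
        -- With fewer than `m * m` vertices the initial equipartition may not exist; but then
        -- `n ≤ S`, and a single copy is enough.
        by-edges ((i , j) ∷ es) e = [ with-edge i j (proj₂ (edgeList-sound H (subst ((i , j) ∈_) (sym e) (here refl)))) 1≤n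
                                    , (λ n≤m² → small n (copies H G) (some-copy 1≤n) (≤-trans n≤m² m²≤S')) ]′ (≤-total (m * m) n)

    removal-bound : n ^ h ≤ S ^ C * copies H G
    removal-bound = [ positive-order , (λ n<1 → subst (λ k → k ^ h ≤ S ^ C * copies H G) (sym (n<1⇒n≡0 n<1))
        (≤-trans (≤-reflexive (0^ h 1≤h)) z≤n)) ]′ (≤-<-connex 1 n)
      where
      0^ : ∀ h → 1 ≤ h → 0 ^ h ≡ 0
      0^ (suc h) _ = refl

ratio-pos : ∀ N .{{_ : NonZero N}} → 0ℚ ℚ.< ratio 1 N
ratio-pos N = ℚ.≰⇒> λ r≤0 → 1+n≰n (⟦⟧-cancel {1} {0} (ℚ.≤-trans (ℚ.≤-reflexive (sym (ratio-* 1 N)))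
  (ℚ.≤-trans (ℚ.*-monoʳ-≤-nonNeg ⟦ N ⟧ {{⟦⟧-nonNeg N}} r≤0) (ℚ.≤-reflexive (ℚ.*-zeroˡ ⟦ N ⟧)))))

theorem1p2 : ∀ (h : ℕ) → 3 ≤ h →
    Σ ℚ λ ε₀ → Σ ℚ λ δ₀ → Σ ℕ λ C →
    0ℚ ℚ.< ε₀ × 0ℚ ℚ.< δ₀ × 1 ≤ C ×
    (∀ (H : Graph h) (ε : ℚ) → 0ℚ ℚ.< ε → ε ℚ.≤ ε₀ →
    ∀ (S : ℕ) → SProp (ε ^ℚ C) δ₀ ε S → RemProp H ε (S ^ C))
-- The `24` in `ε₀` is what `boundC` needs: the share `6 * q` times the `4` of `selected-area`.
theorem1p2 h 3≤h = ratio 1 (24 * (h * h)) , ratio 1 (12 * (h * h * (h * h))) , exponent h ,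
    ratio-pos (24 * (h * h)) , ratio-pos (12 * (h * h * (h * h))) , ≤-trans 1≤h (m≤n*m h (2 + (h * h + h * h) + (h + h))) ,
    λ H ε 0<ε ε≤ S sp → conclude H ε 0<ε S sp (floor-inverse (24 * (h * h)) ε 0<ε ε≤)
  where
  1≤h : 1 ≤ h
  1≤h = ≤-trans (m≤m+n 1 2) 3≤h
  1≤q : 1 ≤ h * h
  1≤q = *-mono-≤ 1≤h 1≤h
  instance
    24q≢0 : NonZero (24 * (h * h))
    24q≢0 = >-nonZero (*-mono-≤ {1} {24} (s≤s z≤n) 1≤q)
    12q²≢0 : NonZero (12 * (h * h * (h * h)))
    12q²≢0 = >-nonZero (*-mono-≤ {1} {12} (s≤s z≤n) (*-mono-≤ 1≤q 1≤q))
  conclude : ∀ (H : Graph h) (ε : ℚ) → 0ℚ ℚ.< ε → ∀ S →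
    SProp (ε ^ℚ exponent h) (ratio 1 (12 * (h * h * (h * h)))) ε S →
    (∃ λ m → 24 * (h * h) ≤ m × ⟦ m ⟧ ℚ.* ε ℚ.≤ 1ℚ × 1ℚ ℚ.≤ ⟦ 2 * m ⟧ ℚ.* ε) → RemProp H ε (S ^ exponent h)
  conclude H ε 0<ε S sp (m , 24q≤m , mε≤1 , 1≤2mε) n G far =
    removal-bound h 1≤h H ε 0<ε m 24q≤m mε≤1 1≤2mε S sp n G far
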